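{- Let $R(q)=\dfrac{(q;q^5)_\infty(q^4;q^5)_\infty}{(q^2;q^5)_\infty(q^3;q^5)_\infty}$ and define integers $B(n)$ by $R^5(q)=\sum_{n=0}^{\infty}B(n)q^{n}$. Then for all nonnegative integers $n$, $$B(5n+1)<0,\quad B(5n+2)>0,\quad B(5n+3)<0,\quad B(5n+4)>0.$$
   Context: For complex $a,q$ with $|q|<1$, $(a;q)_\infty:=\prod_{k=0}^{\infty}(1-aq^k)$. All series are power series in $q$. -}

module Defs where

open import Data.Nat as ℕ using (ℕ; zero; suc; _∸_; _≡ᵇ_)
open import Data.Integer as ℤ using (ℤ; 0ℤ; 1ℤ)
open import Data.List using (List; []; _∷_; map; foldr; upTo; zipWith; applyUpTo)
open import Data.Bool using (if_then_else_)

-- Formal power series in q with integer coefficients: n ↦ coefficient of q^n.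
FPS : Set
FPS = ℕ → ℤ

sumℤ : List ℤ → ℤ
sumℤ = foldr ℤ._+_ 0ℤ

one : FPS
one zero    = 1ℤ
one (suc _) = 0ℤ

mono : ℕ → FPS
mono m i = if m ≡ᵇ i then 1ℤ else 0ℤ

_⊕_ : FPS → FPS → FPS
(f ⊕ g) n = f n ℤ.+ g n

⊖_ : FPS → FPS
(⊖ f) n = ℤ.- f n

_⊛_ : FPS → FPS → FPS
(f ⊛ g) n = sumℤ (map (λ i → f i ℤ.* g (n ∸ i)) (upTo (suc n)))

pow : FPS → ℕ → FPS
pow f zero    = one
pow f (suc k) = f ⊛ pow f k

-- Multiplicative inverse of a series with constant term 1:
-- g 0 = 1,  g n = - Σ_{i=1}^{n} a i * g (n - i).
-- invList a n = [g n , g (n-1) , … , g 0]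
invList : FPS → ℕ → List ℤ
invList a zero    = 1ℤ ∷ []
invList a (suc n) =
  let prev = invList a n in
  ℤ.- sumℤ (zipWith ℤ._*_ (applyUpTo (λ i → a (suc i)) (suc n)) prev) ∷ prev

inv : FPS → FPS
inv a n with invList a n
... | x ∷ _ = x
... | []    = 0ℤ

prodUpTo : (ℕ → FPS) → ℕ → FPS
prodUpTo f N = foldr _⊛_ one (map f (upTo (suc N)))

-- Infinite product ∏_{k≥0} f k, for factors with f k ≡ 1 mod q^(k+1)
-- (so the coefficient of q^n is determined by the factors f 0,…,f n).
prodInf : (ℕ → FPS) → FPS
prodInf f n = prodUpTo f n n

poch5 : ℕ → FPS
poch5 r = prodInf (λ k → one ⊕ (⊖ mono (5 ℕ.* k ℕ.+ r)))

-- Rogers–Ramanujan continued fraction (up to the q^(1/5) factor)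
R : FPS
R = (poch5 1 ⊛ poch5 4) ⊛ inv (poch5 2 ⊛ poch5 3)

B : ℕ → ℤ
B = pow R 5

{-# OPTIONS --safe #-}
module Submission where

-- Let E = (q;q)_∞, A = (q,q⁴;q⁵)_∞, C = (q²,q³;q⁵)_∞, G = 1/A, H = 1/C, so that R = A/C, and put v = q R(q⁵).
-- Splitting Euler's pentagonal series modulo 5 and recognising the pieces by the quintuple product identity gives
-- E(q) R(q⁵) = E(q²⁵) (1 - v - v²). Taking the norm to ℤ[[q⁵]], here through logarithmic derivatives so that no
-- roots of unity occur, yields (1 - 11 q R⁵ - q² R¹⁰) E(q⁵)⁶ = R⁵ E⁶. Comparing this identity with its value at q⁵
-- gives a quadratic equation for q R⁵ over ℤ[v], whence R⁵ = R(q⁵) N(v)/D(v) with quartic N, D, and finally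
--   R⁵ = R(q⁵)⁻⁴ (E(q²⁵)/E(q⁵))⁶ N(v)² (1 - v - v²).
-- Reading off exponents modulo 5, with E(q⁵)/E = G H,
--   Σ B(5n+1) qⁿ =  -5 (G⁹H³ - 3q G⁴H⁸),    Σ B(5n+2) qⁿ = 5 (3 G⁸H⁴ + q G³H⁹),
--   Σ B(5n+3) qⁿ = -10 (3 G⁷H⁵ + q G²H¹⁰),   Σ B(5n+4) qⁿ = 5 (8 G⁶H⁶ + q G H¹¹).
-- G and H have nonnegative coefficients, so only the first series needs an argument: the factors of G and H satisfy
-- gₖ - hₖ = q^(5k+1) (1-q)(1-q²) gₖ hₖ, so G - H is (1-q)(1-q²) times a nonnegative series, and (1-q) G and
-- (1-q²) H are nonnegative.

open import Defs
open import Algebra.Bundles using (CommutativeRing)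
import Algebra.Properties.Semiring.Exp as Exp
import Algebra.Solver.Ring as RingSolver
open import Algebra.Solver.Ring.AlmostCommutativeRing using (fromCommutativeRing; _-Raw-AlmostCommutative⟶_)
open import Algebra.Structures using (IsCommutativeRing)
open import Data.Fin.Base as Fin using (Fin; toℕ; fromℕ<)
open import Data.Fin.Patterns using (0F; 1F; 2F; 3F; 4F)
import Data.Fin.Properties as Finₚ
open import Data.Integer using (_<_; _>_; 0ℤ)
open import Data.Integer.Base as ℤ using (ℤ; 1ℤ; +_; -[1+_])
import Data.Integer.DivMod as ℤDM
import Data.Integer.Properties as ℤₚ
import Data.Integer.Solver as ℤSolver
open import Data.List.Base as List using (List; []; _∷_; _++_; map; upTo; applyUpTo; zipWith; cartesianProduct; deduplicate)
import Data.List.Membership.DecPropositional as DecMembership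
open import Data.List.Membership.Propositional using (_∈_; _∉_)
import Data.List.Membership.Propositional.Properties as ∈ₚ
import Data.List.Properties as Listₚ
open import Data.List.Relation.Binary.Permutation.Propositional as Perm using (_↭_)
import Data.List.Relation.Binary.Permutation.Propositional.Properties as Permₚ
import Data.List.Relation.Binary.Permutation.Setoid.Properties as PermSetoidₚ
open import Data.List.Relation.Unary.All as All using ([]; _∷_)
open import Data.List.Relation.Unary.AllPairs using ([]; _∷_)
open import Data.List.Relation.Unary.Any using (here; there)
import Data.List.Relation.Unary.Unique.DecPropositional.Properties as DecUniqueₚ
open import Data.List.Relation.Unary.Unique.Propositional using (Unique)
import Data.List.Relation.Unary.Unique.Propositional.Properties as Uniqueₚ
open import Data.Maybe.Base using (Maybe; just; nothing)
open import Data.Nat using (ℕ)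
open import Data.Nat.Base as ℕ using (zero; suc; _≤_; z≤n; s≤s)
import Data.Nat.DivMod as ℕDM
open import Data.Nat.Induction using (<-rec)
import Data.Nat.Properties as ℕₚ
open import Data.Nat.Solver using (module +-*-Solver)
open import Data.Product using (_×_)
open import Data.Product.Base using (_,_; proj₁; proj₂; ∃)
open import Data.Product.Properties using (≡-dec)
open import Data.Sum.Base as Sum using (_⊎_; inj₁; inj₂)
import Data.Sum.Properties as Sumₚ
open import Function.Base using (_∘_; id)
open import Relation.Binary.Bundles using (Setoid)
open import Relation.Binary.Definitions using (DecidableEquality)
open import Relation.Binary.PropositionalEquality as ≡ using (_≡_; refl; sym; trans; cong; cong₂; subst)
import Relation.Binary.Reasoning.Setoid as SetoidReasoning
open import Relation.Nullary using (¬_; contradiction; yes; no)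

-- Norm: Π f(ζq) over fifth roots of unity has logarithmic derivative Σ (Λ f)(ζq), five times the
-- part of Λ f in exponents divisible by 5. If the norm is g(q⁵), this says that Λ g is `sec 0` of Λ
-- f, an identity over ℤ, and it determines g because ℤ has no torsion. Conjugation sends v to ζv,
-- so 1 - v - v² has norm 1 - 11 v⁵ - v¹⁰; 11 is the fifth Lucas number. Quadratic: (1 - 11 x - x²)
-- / x is invariant under x ↦ -1/x. It takes the same value at x = q R⁵ and at x = v N/D, so q R⁵ is
-- v N/D or -D/(v N), and the latter is no power series. Quintuple product: only two instances
-- occur. Multiplied by E(q⁵), each compares products of two theta series, that is sums over ℤ²,
-- whose quadratic form is hexagonal. Hence the need for sums that do not depend on an order of
-- summation. Class 1: G⁹H³ - 3q G⁴H⁸ = G⁴H³ (G⁵ - 3q H⁵) is a genuine difference. The coefficient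
-- -3q can be paid only by the linear term 5 H⁴ (G - H) of G⁵, so the first summand of G - H has to
-- be known exactly; the rest need only be nonnegative.

infix 4 _≈_ _≈[_]_

-- A record rather than a function type, so that unification recovers `f` and `g` from a proof.
record _≈_ (f g : FPS) : Set where
  constructor coeffs
  field at : ∀ n → f n ≡ g n
open _≈_

-- Congruence modulo q^M. Limits of products and of sums are expressed by such congruences for every
-- `M`.
record _≈[_]_ (f : FPS) (M : ℕ) (g : FPS) : Set where
  constructor coeffs<
  field at< : ∀ n → n ℕ.< M → f n ≡ g n
open _≈[_]_

-- The commutative ring of formal power series

tail : FPS → FPS
tail f n = f (suc n)

⊛-zero : ∀ f g → (f ⊛ g) 0 ≡ f 0 ℤ.* g 0
⊛-zero f g = ℤₚ.+-identityʳ _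

⊛-suc : ∀ f g n → (f ⊛ g) (suc n) ≡ f 0 ℤ.* g (suc n) ℤ.+ (tail f ⊛ g) n
⊛-suc f g n = cong (λ l → f 0 ℤ.* g (suc n) ℤ.+ sumℤ l) (trans
  (Listₚ.map-applyUpTo suc (λ i → f i ℤ.* g (suc n ℕ.∸ i)) (suc n))
  (sym (Listₚ.map-upTo (λ i → tail f i ℤ.* g (n ℕ.∸ i)) (suc n))))

⊛-cong-≤ : ∀ n {f f′ g g′} → (∀ i → i ≤ n → f i ≡ f′ i) → (∀ i → i ≤ n → g i ≡ g′ i) →
           (f ⊛ g) n ≡ (f′ ⊛ g′) n
⊛-cong-≤ zero {f} {f′} {g} {g′} p r = trans (⊛-zero f g) (trans
  (cong₂ ℤ._*_ (p 0 z≤n) (r 0 z≤n)) (sym (⊛-zero f′ g′)))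
⊛-cong-≤ (suc n) {f} {f′} {g} {g′} p r = trans (⊛-suc f g n) (trans
  (cong₂ ℤ._+_ (cong₂ ℤ._*_ (p 0 z≤n) (r (suc n) ℕₚ.≤-refl))
    (⊛-cong-≤ n {tail f} {tail f′} {g} {g′} (λ i i≤n → p (suc i) (s≤s i≤n)) (λ i i≤n → r i (ℕₚ.m≤n⇒m≤1+n i≤n))))
  (sym (⊛-suc f′ g′ n)))

⊛-congˡ : ∀ {f f′} g n → (∀ i → f i ≡ f′ i) → (f ⊛ g) n ≡ (f′ ⊛ g) n
⊛-congˡ {f} {f′} g n p = ⊛-cong-≤ n {f} {f′} {g} {g} (λ i _ → p i) (λ _ _ → refl)

-- The mirror image of `⊛-suc`, peeling off the last term of the sum. With one recursion on each
-- side, commutativity becomes an induction.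
⊛-suc′ : ∀ f g n → (f ⊛ g) (suc n) ≡ (f ⊛ tail g) n ℤ.+ f (suc n) ℤ.* g 0
⊛-suc′ f g zero = trans (⊛-suc f g 0) (cong₂ ℤ._+_ (sym (⊛-zero f (tail g))) (⊛-zero (tail f) g))
⊛-suc′ f g (suc n) = trans (⊛-suc f g (suc n)) (trans
  (cong (λ x → f 0 ℤ.* g (suc (suc n)) ℤ.+ x) (⊛-suc′ (tail f) g n)) (trans
  (sym (ℤₚ.+-assoc (f 0 ℤ.* g (suc (suc n))) ((tail f ⊛ tail g) n) _))
  (cong (ℤ._+ f (suc (suc n)) ℤ.* g 0) (sym (⊛-suc f (tail g) n)))))

⊛-comm : ∀ f g n → (f ⊛ g) n ≡ (g ⊛ f) n
⊛-comm f g zero = trans (⊛-zero f g) (trans (ℤₚ.*-comm (f 0) (g 0)) (sym (⊛-zero g f)))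
⊛-comm f g (suc n) = trans (⊛-suc f g n) (trans
  (ℤₚ.+-comm (f 0 ℤ.* g (suc n)) _) (trans
  (cong₂ ℤ._+_ (⊛-comm (tail f) g n) (ℤₚ.*-comm (f 0) (g (suc n))))
  (sym (⊛-suc′ g f n))))

⊛-distribʳ : ∀ h f g n → ((f ⊕ g) ⊛ h) n ≡ (f ⊛ h) n ℤ.+ (g ⊛ h) n
⊛-distribʳ h f g zero = trans (⊛-zero (f ⊕ g) h) (trans (ℤₚ.*-distribʳ-+ (h 0) (f 0) (g 0))
  (sym (cong₂ ℤ._+_ (⊛-zero f h) (⊛-zero g h))))
⊛-distribʳ h f g (suc n) = trans (⊛-suc (f ⊕ g) h n) (trans
  (cong (λ x → (f 0 ℤ.+ g 0) ℤ.* h (suc n) ℤ.+ x) (⊛-distribʳ h (tail f) (tail g) n)) (trans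
  (solve 5 (λ a b c x y → (a :+ b) :* c :+ (x :+ y) := (a :* c :+ x) :+ (b :* c :+ y)) refl
    (f 0) (g 0) (h (suc n)) ((tail f ⊛ h) n) ((tail g ⊛ h) n))
  (sym (cong₂ ℤ._+_ (⊛-suc f h n) (⊛-suc g h n)))))
  where open ℤSolver.+-*-Solver

⊛-scaleˡ : ∀ c f g n → ((λ i → c ℤ.* f i) ⊛ g) n ≡ c ℤ.* (f ⊛ g) n
⊛-scaleˡ c f g zero = trans (⊛-zero (λ i → c ℤ.* f i) g) (trans (ℤₚ.*-assoc c (f 0) (g 0))
  (cong (c ℤ.*_) (sym (⊛-zero f g))))
⊛-scaleˡ c f g (suc n) = trans (⊛-suc (λ i → c ℤ.* f i) g n) (trans
  (cong₂ ℤ._+_ (ℤₚ.*-assoc c (f 0) (g (suc n))) (⊛-scaleˡ c (tail f) g n)) (trans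
  (sym (ℤₚ.*-distribˡ-+ c (f 0 ℤ.* g (suc n)) _))
  (cong (c ℤ.*_) (sym (⊛-suc f g n)))))

-- Read as an equation of series, `⊛-suc` says that the tail of `f ⊛ g` is `f 0` times `tail g` plus
-- `tail f ⊛ g`. Linearity in the left factor then leaves the claim for `tail f`, one degree lower.
⊛-assoc : ∀ f g h n → ((f ⊛ g) ⊛ h) n ≡ (f ⊛ (g ⊛ h)) n
⊛-assoc f g h zero = trans (⊛-zero (f ⊛ g) h) (trans (cong (ℤ._* h 0) (⊛-zero f g)) (trans
  (ℤₚ.*-assoc (f 0) (g 0) (h 0)) (trans (cong (f 0 ℤ.*_) (sym (⊛-zero g h)))
  (sym (⊛-zero f (g ⊛ h))))))
⊛-assoc f g h (suc n) = begin
  ((f ⊛ g) ⊛ h) (suc n)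
    ≡⟨ ⊛-suc (f ⊛ g) h n ⟩
  (f ⊛ g) 0 ℤ.* h (suc n) ℤ.+ (tail (f ⊛ g) ⊛ h) n
    ≡⟨ cong₂ ℤ._+_ (cong (ℤ._* h (suc n)) (⊛-zero f g)) (⊛-congˡ h n (⊛-suc f g)) ⟩
  f 0 ℤ.* g 0 ℤ.* h (suc n) ℤ.+ (((λ i → f 0 ℤ.* tail g i) ⊕ (tail f ⊛ g)) ⊛ h) n
    ≡⟨ cong (λ x → f 0 ℤ.* g 0 ℤ.* h (suc n) ℤ.+ x) (⊛-distribʳ h (λ i → f 0 ℤ.* tail g i) (tail f ⊛ g) n) ⟩
  f 0 ℤ.* g 0 ℤ.* h (suc n) ℤ.+ (((λ i → f 0 ℤ.* tail g i) ⊛ h) n ℤ.+ ((tail f ⊛ g) ⊛ h) n)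
    ≡⟨ cong₂ (λ x y → f 0 ℤ.* g 0 ℤ.* h (suc n) ℤ.+ (x ℤ.+ y))
         (⊛-scaleˡ (f 0) (tail g) h n) (⊛-assoc (tail f) g h n) ⟩
  f 0 ℤ.* g 0 ℤ.* h (suc n) ℤ.+ (f 0 ℤ.* (tail g ⊛ h) n ℤ.+ (tail f ⊛ (g ⊛ h)) n)
    ≡⟨ solve 5 (λ a b c x y → a :* b :* c :+ (a :* x :+ y) := a :* (b :* c :+ x) :+ y) refl
         (f 0) (g 0) (h (suc n)) ((tail g ⊛ h) n) ((tail f ⊛ (g ⊛ h)) n) ⟩
  f 0 ℤ.* (g 0 ℤ.* h (suc n) ℤ.+ (tail g ⊛ h) n) ℤ.+ (tail f ⊛ (g ⊛ h)) n
    ≡⟨ cong (λ x → f 0 ℤ.* x ℤ.+ (tail f ⊛ (g ⊛ h)) n) (sym (⊛-suc g h n)) ⟩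
  f 0 ℤ.* (g ⊛ h) (suc n) ℤ.+ (tail f ⊛ (g ⊛ h)) n
    ≡⟨ sym (⊛-suc f (g ⊛ h) n) ⟩
  (f ⊛ (g ⊛ h)) (suc n) ∎
  where open ≡.≡-Reasoning
        open ℤSolver.+-*-Solver

⊛-zeroˡ : ∀ g n → ((λ _ → 0ℤ) ⊛ g) n ≡ 0ℤ
⊛-zeroˡ g n = ⊛-scaleˡ 0ℤ (λ _ → 0ℤ) g n

⊛-identityˡ : ∀ g n → (one ⊛ g) n ≡ g n
⊛-identityˡ g zero = trans (⊛-zero one g) (ℤₚ.*-identityˡ _)
⊛-identityˡ g (suc n) = trans (⊛-suc one g n) (trans
  (cong₂ ℤ._+_ (ℤₚ.*-identityˡ (g (suc n))) (⊛-zeroˡ g n)) (ℤₚ.+-identityʳ _))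

-- The operations are opaque so that the ring solver never unfolds a convolution.
opaque
  infix  8 -_
  infixl 6 _+_
  infixl 7 _*_
  _+_ _*_ : FPS → FPS → FPS
  _+_ = _⊕_
  _*_ = _⊛_

  -_ : FPS → FPS
  -_ = ⊖_

  const : ℤ → FPS
  const c zero    = c
  const c (suc _) = 0ℤ

  +-at : ∀ f g n → (f + g) n ≡ f n ℤ.+ g n
  +-at f g n = refl

  neg-at : ∀ f n → (- f) n ≡ ℤ.- f n
  neg-at f n = refl

  *-as-⊛ : ∀ f g → f * g ≡ f ⊛ g
  *-as-⊛ f g = refl

  +-as-⊕ : ∀ f g → f + g ≡ f ⊕ g
  +-as-⊕ f g = refl

  neg-as-⊖ : ∀ f → - f ≡ ⊖ f
  neg-as-⊖ f = refl

  *-at-zero : ∀ f g → (f * g) 0 ≡ f 0 ℤ.* g 0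
  *-at-zero = ⊛-zero

  *-at-suc : ∀ f g n → (f * g) (suc n) ≡ f 0 ℤ.* g (suc n) ℤ.+ (tail f * g) n
  *-at-suc = ⊛-suc

  *-at-cong : ∀ n {f f′ g g′} → (∀ i → i ≤ n → f i ≡ f′ i) → (∀ i → i ≤ n → g i ≡ g′ i) →
              (f * g) n ≡ (f′ * g′) n
  *-at-cong = ⊛-cong-≤

  const-at-zero : ∀ c → const c 0 ≡ c
  const-at-zero c = refl

  const-at-suc : ∀ c n → const c (suc n) ≡ 0ℤ
  const-at-suc c n = refl

opaque
  unfolding _*_

  const-*-at : ∀ c f n → (const c * f) n ≡ c ℤ.* f n
  const-*-at c f n = trans (⊛-congˡ f n const≡scaled) (trans (⊛-scaleˡ c one f n) (cong (c ℤ.*_) (⊛-identityˡ f n)))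
    where
    const≡scaled : ∀ i → const c i ≡ c ℤ.* one i
    const≡scaled zero    = sym (ℤₚ.*-identityʳ c)
    const≡scaled (suc i) = sym (ℤₚ.*-zeroʳ c)

  FPS-isCommutativeRing : IsCommutativeRing _≈_ _+_ _*_ -_ (const 0ℤ) (const 1ℤ)
  FPS-isCommutativeRing = record
    { isRing = record
      { +-isAbelianGroup = record
        { isGroup = record
          { isMonoid = record
            { isSemigroup = record
              { isMagma = record
                { isEquivalence = record
                  { refl = coeffs (λ _ → refl)
                  ; sym = λ p → coeffs (sym ∘ at p)
                  ; trans = λ p r → coeffs (λ n → trans (at p n) (at r n)) }
                ; ∙-cong = λ p r → coeffs (λ n → cong₂ ℤ._+_ (at p n) (at r n)) }
              ; assoc = λ f g h → coeffs (λ n → ℤₚ.+-assoc (f n) (g n) (h n)) }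
            ; identity = (λ f → coeffs λ { zero → ℤₚ.+-identityˡ _ ; (suc n) → ℤₚ.+-identityˡ _ })
                       , (λ f → coeffs λ { zero → ℤₚ.+-identityʳ _ ; (suc n) → ℤₚ.+-identityʳ _ }) }
          ; inverse = (λ f → coeffs λ { zero → ℤₚ.+-inverseˡ (f 0) ; (suc n) → ℤₚ.+-inverseˡ (f (suc n)) })
                    , (λ f → coeffs λ { zero → ℤₚ.+-inverseʳ (f 0) ; (suc n) → ℤₚ.+-inverseʳ (f (suc n)) })
          ; ⁻¹-cong = λ p → coeffs (λ n → cong ℤ.-_ (at p n)) }
        ; comm = λ f g → coeffs (λ n → ℤₚ.+-comm (f n) (g n)) }
      ; *-cong = λ p r → coeffs (λ n → ⊛-cong-≤ n (λ i _ → at p i) (λ i _ → at r i))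
      ; *-assoc = λ f g h → coeffs (⊛-assoc f g h)
      ; *-identity = (λ f → coeffs (λ n → trans (const-*-at 1ℤ f n) (ℤₚ.*-identityˡ (f n))))
                   , (λ f → coeffs (λ n → trans (⊛-comm f (const 1ℤ) n) (trans (const-*-at 1ℤ f n) (ℤₚ.*-identityˡ (f n)))))
      ; distrib = (λ f g h → coeffs (λ n → trans (⊛-comm f (g ⊕ h) n) (trans (⊛-distribʳ f g h n)
                    (cong₂ ℤ._+_ (⊛-comm g f n) (⊛-comm h f n)))))
                , (λ f g h → coeffs (⊛-distribʳ f g h)) }
    ; *-comm = λ f g → coeffs (⊛-comm f g) }

FPS-ring : CommutativeRing _ _
FPS-ring = record { isCommutativeRing = FPS-isCommutativeRing }

open CommutativeRing FPS-ring public
  using (_-_; +-cong; +-congˡ; +-congʳ; *-cong; *-congˡ; *-congʳ; -‿cong; +-comm; *-comm; +-assoc; *-assoc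
        ; +-identityˡ; +-identityʳ; *-identityˡ; *-identityʳ; zeroˡ; zeroʳ; distribˡ; distribʳ; -‿inverseʳ)
  renaming (refl to ≈-refl; sym to ≈-sym; trans to ≈-trans; setoid to ≈-setoid; reflexive to ≡⇒≈)
open Exp (CommutativeRing.semiring FPS-ring) public using (_^_; ^-congˡ)
module ≈-Reasoning = SetoidReasoning ≈-setoid

0# 1# : FPS
0# = const 0ℤ
1# = const 1ℤ

opaque
  unfolding _*_

  const-+ : ∀ a b → const (a ℤ.+ b) ≈ const a + const b
  const-+ a b = coeffs λ { zero → refl ; (suc n) → refl }

  const-* : ∀ a b → const (a ℤ.* b) ≈ const a * const b
  const-* a b = coeffs λ { zero    → sym (const-*-at a (const b) 0)
                         ; (suc n) → sym (trans (const-*-at a (const b) (suc n)) (ℤₚ.*-zeroʳ a)) }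

  const-neg : ∀ a → const (ℤ.- a) ≈ - const a
  const-neg a = coeffs λ { zero → refl ; (suc n) → refl }

-- The solver draws its coefficients from ℤ through `const`, so that polynomial identities with
-- integer coefficients are settled by normalisation.
const-morphism : CommutativeRing.rawRing ℤₚ.+-*-commutativeRing -Raw-AlmostCommutative⟶ fromCommutativeRing FPS-ring
const-morphism = record
  { ⟦_⟧ = const ; +-homo = const-+ ; *-homo = const-* ; -‿homo = const-neg ; 0-homo = ≈-refl ; 1-homo = ≈-refl }

const-≟ : ∀ a b → Maybe (const a ≈ const b)
const-≟ a b with a ℤₚ.≟ b
... | yes refl = just ≈-refl
... | no  _    = nothing

module FPS-Solver = RingSolver (CommutativeRing.rawRing ℤₚ.+-*-commutativeRing) (fromCommutativeRing FPS-ring) const-morphism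
  const-≟

0#-at : ∀ n → 0# n ≡ 0ℤ
0#-at zero    = const-at-zero 0ℤ
0#-at (suc n) = const-at-suc 0ℤ n

one≈1# : one ≈ 1#
one≈1# = coeffs λ { zero → sym (const-at-zero 1ℤ) ; (suc n) → sym (const-at-suc 1ℤ n) }

-- Congruences modulo q^M

≈⇒≈[] : ∀ {f g M} → f ≈ g → f ≈[ M ] g
≈⇒≈[] p = coeffs< (λ n _ → at p n)

≈[]⇒≈ : ∀ {f g} → (∀ M → f ≈[ M ] g) → f ≈ g
≈[]⇒≈ p = coeffs (λ n → at< (p (suc n)) n ℕₚ.≤-refl)

≈[]-weaken : ∀ {f g M N} → M ≤ N → f ≈[ N ] g → f ≈[ M ] g
≈[]-weaken M≤N p = coeffs< (λ n n<M → at< p n (ℕₚ.<-≤-trans n<M M≤N))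

≈[]-setoid : ℕ → Setoid _ _
≈[]-setoid M = record
  { Carrier = FPS ; _≈_ = _≈[ M ]_
  ; isEquivalence = record
    { refl = coeffs< (λ _ _ → refl)
    ; sym = λ p → coeffs< (λ n n<M → sym (at< p n n<M))
    ; trans = λ p r → coeffs< (λ n n<M → trans (at< p n n<M) (at< r n n<M)) } }

module _ {M : ℕ} where
  open Setoid (≈[]-setoid M) public using () renaming (refl to ≈[]-refl; sym to ≈[]-sym; trans to ≈[]-trans)

module ≈[]-Reasoning (M : ℕ) = SetoidReasoning (≈[]-setoid M)

+-cong[] : ∀ {M f f′ g g′} → f ≈[ M ] f′ → g ≈[ M ] g′ → f + g ≈[ M ] f′ + g′
+-cong[] {f = f} {f′} {g} {g′} p r = coeffs< (λ n n<M → trans (+-at f g n) (trans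
  (cong₂ ℤ._+_ (at< p n n<M) (at< r n n<M)) (sym (+-at f′ g′ n))))

*-cong[] : ∀ {M f f′ g g′} → f ≈[ M ] f′ → g ≈[ M ] g′ → f * g ≈[ M ] f′ * g′
*-cong[] p r = coeffs< (λ n n<M → *-at-cong n (λ i i≤n → at< p i (ℕₚ.≤-<-trans i≤n n<M))
                                              (λ i i≤n → at< r i (ℕₚ.≤-<-trans i≤n n<M)))

neg-cong[] : ∀ {M f f′} → f ≈[ M ] f′ → - f ≈[ M ] - f′
neg-cong[] {f = f} {f′} p = coeffs< (λ n n<M → trans (neg-at f n) (trans (cong ℤ.-_ (at< p n n<M)) (sym (neg-at f′ n))))

^-cong[] : ∀ {M f g} k → f ≈[ M ] g → f ^ k ≈[ M ] g ^ k
^-cong[] zero    p = ≈[]-refl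
^-cong[] (suc k) p = *-cong[] p (^-cong[] k p)

-- Series with constant term 1 and their inverses

Unit : FPS → Set
Unit f = f 0 ≡ 1ℤ

Unit-1# : Unit 1#
Unit-1# = const-at-zero 1ℤ

Unit-* : ∀ {f g} → Unit f → Unit g → Unit (f * g)
Unit-* {f} {g} p r = trans (*-at-zero f g) (cong₂ ℤ._*_ p r)

Unit-≈ : ∀ {f g} → f ≈ g → Unit f → Unit g
Unit-≈ p u = trans (sym (at p 0)) u

Unit-^ : ∀ {f} k → Unit f → Unit (f ^ k)
Unit-^ zero    u = Unit-1#
Unit-^ {f} (suc k) u = Unit-* {f} {f ^ k} u (Unit-^ k u)

opaque
  unfolding _*_

  -- `invList` stores coefficients in descending order, so pairing it with an ascending list is a
  -- convolution. The left factor `h` is arbitrary because the induction shifts it.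
  invList-sum : ∀ a h n → sumℤ (zipWith ℤ._*_ (applyUpTo h (suc n)) (invList a n)) ≡ (h ⊛ inv a) n
  invList-sum a h zero    = refl
  invList-sum a h (suc n) = trans (cong (λ x → h 0 ℤ.* inv a (suc n) ℤ.+ x) (invList-sum a (h ∘ suc) n))
                                  (sym (⊛-suc h (inv a) n))

  *-inv : ∀ f → Unit f → f * inv f ≈ 1#
  *-inv f f0≡1 = coeffs λ
    { zero    → trans (⊛-zero f (inv f)) (trans (cong (ℤ._* 1ℤ) f0≡1) refl)
    ; (suc n) → trans (⊛-suc f (inv f) n) (trans
        (cong₂ (λ x y → x ℤ.* y ℤ.+ (tail f ⊛ inv f) n) f0≡1 (cong ℤ.-_ (invList-sum f (tail f) n))) (trans
        (cong (ℤ._+ (tail f ⊛ inv f) n) (ℤₚ.*-identityˡ (ℤ.- (tail f ⊛ inv f) n)))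
        (ℤₚ.+-inverseˡ ((tail f ⊛ inv f) n)))) }

*-cancelˡ[] : ∀ {M f g h} → Unit f → f * g ≈[ M ] f * h → g ≈[ M ] h
*-cancelˡ[] {M} {f} {g} {h} u p = begin
  g               ≈⟨ ≈⇒≈[] (regroup g) ⟩
  inv f * (f * g) ≈⟨ *-cong[] ≈[]-refl p ⟩
  inv f * (f * h) ≈⟨ ≈⇒≈[] (regroup h) ⟨
  h               ∎
  where
  open ≈[]-Reasoning M
  regroup : ∀ g → g ≈ inv f * (f * g)
  regroup g = ≈-trans (≈-sym (*-identityˡ g)) (≈-trans (*-congʳ (≈-sym (≈-trans (*-comm (inv f) f) (*-inv f u)))) (*-assoc (inv f) f g))

*-cancelˡ : ∀ {f g h} → Unit f → f * g ≈ f * h → g ≈ h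
*-cancelˡ u p = ≈[]⇒≈ (λ M → *-cancelˡ[] u (≈⇒≈[] p))

inv-unique : ∀ {f g} → Unit f → f * g ≈ 1# → g ≈ inv f
inv-unique {f} u p = *-cancelˡ u (≈-trans p (≈-sym (*-inv f u)))

inv-cong[] : ∀ {M f g} → Unit f → Unit g → f ≈[ M ] g → inv f ≈[ M ] inv g
inv-cong[] {M} {f} {g} u w p = *-cancelˡ[] {f = f} u (begin
  f * inv f ≈⟨ ≈⇒≈[] (≈-trans (*-inv f u) (≈-sym (*-inv g w))) ⟩
  g * inv g ≈⟨ *-cong[] p ≈[]-refl ⟨
  f * inv g ∎)
  where open ≈[]-Reasoning M

inv-cong : ∀ {f g} → Unit f → f ≈ g → inv f ≈ inv g
inv-cong u p = ≈[]⇒≈ (λ M → inv-cong[] u (Unit-≈ p u) (≈⇒≈[] p))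

inv-* : ∀ {f g} → Unit f → Unit g → inv (f * g) ≈ inv f * inv g
inv-* {f} {g} u w = ≈-sym (inv-unique (Unit-* {f} {g} u w) (begin
  f * g * (inv f * inv g)   ≈⟨ solve 4 (λ a b c d → a :* b :* (c :* d) := a :* c :* (b :* d)) ≈-refl f g (inv f) (inv g) ⟩
  f * inv f * (g * inv g)   ≈⟨ *-cong (*-inv f u) (*-inv g w) ⟩
  1# * 1#                   ≈⟨ *-identityˡ 1# ⟩
  1#                        ∎))
  where open ≈-Reasoning
        open FPS-Solver

mono-zero : mono 0 ≈ 1#
mono-zero = coeffs λ { zero → sym (const-at-zero 1ℤ) ; (suc n) → sym (const-at-suc 1ℤ n) }

mono-suc-*-zero : ∀ m g → (mono (suc m) * g) 0 ≡ 0ℤ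
mono-suc-*-zero m g = *-at-zero (mono (suc m)) g

mono-suc-*-suc : ∀ m g n → (mono (suc m) * g) (suc n) ≡ (mono m * g) n
mono-suc-*-suc m g n = trans (*-at-suc (mono (suc m)) g n) (ℤₚ.+-identityˡ _)

mono-+ : ∀ a b → mono (a ℕ.+ b) ≈ mono a * mono b
mono-+ zero    b = ≈-sym (≈-trans (*-congʳ mono-zero) (*-identityˡ (mono b)))
mono-+ (suc a) b = coeffs λ
  { zero    → sym (mono-suc-*-zero a (mono b))
  ; (suc n) → trans (at (mono-+ a b) n) (sym (mono-suc-*-suc a (mono b) n)) }

mono-large : ∀ {m M} → M ≤ m → mono m ≈[ M ] 0#
mono-large {m} {M} M≤m = coeffs< (λ n n<M → trans (below m n (ℕₚ.<-≤-trans n<M M≤m)) (sym (0#-at n)))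
  where
  below : ∀ m n → n ℕ.< m → mono m n ≡ 0ℤ
  below (suc m) zero    _         = refl
  below (suc m) (suc n) (s≤s n<m) = below m n n<m

mono-cancelˡ : ∀ m {f g} → mono m * f ≈ mono m * g → f ≈ g
mono-cancelˡ zero    {f} {g} p = ≈-trans (≈-sym (unit f)) (≈-trans p (unit g))
  where
  unit : ∀ f → mono 0 * f ≈ f
  unit f = ≈-trans (*-congʳ mono-zero) (*-identityˡ f)
mono-cancelˡ (suc m) {f} {g} p = mono-cancelˡ m (coeffs (λ n →
  trans (sym (mono-suc-*-suc m f n)) (trans (at p (suc n)) (mono-suc-*-suc m g n))))

-- Finite and infinite products

fprod : (ℕ → FPS) → ℕ → FPS
fprod f zero    = 1#
fprod f (suc n) = fprod f n * f n

fprod-cong : ∀ {f g} n → (∀ k → f k ≈ g k) → fprod f n ≈ fprod g n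
fprod-cong zero    p = ≈-refl
fprod-cong (suc n) p = *-cong (fprod-cong n p) (p n)

fprod-* : ∀ f g n → fprod (λ k → f k * g k) n ≈ fprod f n * fprod g n
fprod-* f g zero    = ≈-sym (*-identityˡ 1#)
fprod-* f g (suc n) = ≈-trans (*-congʳ (fprod-* f g n))
  (solve 4 (λ a b c d → a :* b :* (c :* d) := a :* c :* (b :* d)) ≈-refl (fprod f n) (fprod g n) (f n) (g n))
  where open FPS-Solver

Unit-fprod : ∀ {f} n → (∀ k → Unit (f k)) → Unit (fprod f n)
Unit-fprod zero    u = Unit-1#
Unit-fprod {f} (suc n) u = Unit-* {fprod f n} {f n} (Unit-fprod n u) (u n)

inv-fprod : ∀ {f} n → (∀ k → Unit (f k)) → inv (fprod f n) ≈ fprod (inv ∘ f) n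
inv-fprod zero    u = ≈-sym (inv-unique Unit-1# (*-identityˡ 1#))
inv-fprod {f} (suc n) u = ≈-trans (inv-* {fprod f n} {f n} (Unit-fprod n u) (u n)) (*-congʳ (inv-fprod n u))

-- The fold brackets to the right and `fprod` to the left; the seed `e` absorbs the last factor at
-- each step of the induction.
foldr-fprod : ∀ f n e → List.foldr _⊛_ e (map f (upTo n)) ≈ fprod f n * e
foldr-fprod f zero    e = ≈-sym (*-identityˡ e)
foldr-fprod f (suc n) e = begin
  List.foldr _⊛_ e (map f (upTo (suc n)))        ≡⟨ cong (List.foldr _⊛_ e ∘ map f) (Listₚ.upTo-∷ʳ n) ⟨
  List.foldr _⊛_ e (map f (upTo n List.∷ʳ n))    ≡⟨ cong (List.foldr _⊛_ e) (Listₚ.map-++ f (upTo n) (n ∷ [])) ⟩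
  List.foldr _⊛_ e (map f (upTo n) List.∷ʳ f n)  ≡⟨ Listₚ.foldr-∷ʳ _⊛_ e (f n) (map f (upTo n)) ⟩
  List.foldr _⊛_ (f n ⊛ e) (map f (upTo n))      ≈⟨ foldr-fprod f n (f n ⊛ e) ⟩
  fprod f n * (f n ⊛ e)                          ≡⟨ cong (fprod f n *_) (*-as-⊛ (f n) e) ⟨
  fprod f n * (f n * e)                          ≈⟨ *-assoc (fprod f n) (f n) e ⟨
  fprod f n * f n * e                            ∎
  where open ≈-Reasoning

fprod-stable : ∀ {f M} → (∀ k → f k ≈[ suc k ] 1#) → ∀ d → fprod f (M ℕ.+ d) ≈[ M ] fprod f M
fprod-stable {f} {M} p zero    rewrite ℕₚ.+-identityʳ M = ≈[]-refl
fprod-stable {f} {M} p (suc d) rewrite ℕₚ.+-suc M d = ≈[]-trans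
  (*-cong[] (fprod-stable p d) (≈[]-weaken (ℕₚ.m≤n⇒m≤1+n (ℕₚ.m≤m+n M d)) (p (M ℕ.+ d))))
  (≈⇒≈[] (*-identityʳ (fprod f M)))

-- `prodInf` takes each coefficient from a different finite product. Modulo q^M a single product of
-- any length at least `M` serves for all of them, and later arguments see only such truncations.
prodInf-approx : ∀ {f M N} → (∀ k → f k ≈[ suc k ] 1#) → M ≤ N → prodInf f ≈[ M ] fprod f N
prodInf-approx {f} {M} {N} p M≤N = coeffs< λ n n<M → let 1+n≤N = ℕₚ.≤-trans n<M M≤N in trans
  (trans (at (foldr-fprod f (suc n) one) n) (at (≈-trans (*-congˡ one≈1#) (*-identityʳ _)) n))
  (sym (trans (cong (λ k → fprod f k n) (sym (ℕₚ.m+[n∸m]≡n 1+n≤N)))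
              (at< (fprod-stable {f} {suc n} p (N ℕ.∸ suc n)) n ℕₚ.≤-refl)))

-- Dilation, sections and logarithmic derivatives

-- The substitution q ↦ q⁵.
dil : FPS → FPS
dil f 0 = f 0
dil f 1 = 0ℤ
dil f 2 = 0ℤ
dil f 3 = 0ℤ
dil f 4 = 0ℤ
dil f (suc (suc (suc (suc (suc n))))) = dil (tail f) n

-- The section collecting the exponents congruent to `r` modulo 5. With the index in the form
-- `n * 5 + r`, a successor of `n` unfolds to five successors and meets the last clause of `dil`.
sec : ℕ → FPS → FPS
sec r f n = f (n ℕ.* 5 ℕ.+ r)

dil-*-unroll : ∀ f g n → (dil f * g) (5 ℕ.+ n) ≡ f 0 ℤ.* g (5 ℕ.+ n) ℤ.+ (dil (tail f) * g) n
dil-*-unroll f g n = trans (*-at-suc (dil f) g (4 ℕ.+ n)) (cong (λ x → f 0 ℤ.* g (5 ℕ.+ n) ℤ.+ x)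
  (trans (skip (λ k → dil f (1 ℕ.+ k)) refl (3 ℕ.+ n))
  (trans (skip (λ k → dil f (2 ℕ.+ k)) refl (2 ℕ.+ n))
  (trans (skip (λ k → dil f (3 ℕ.+ k)) refl (1 ℕ.+ n))
         (skip (λ k → dil f (4 ℕ.+ k)) refl n)))))
  where
  skip : ∀ h → h 0 ≡ 0ℤ → ∀ k → (h * g) (suc k) ≡ (tail h * g) k
  skip h h0≡0 k = trans (*-at-suc h g k) (trans (cong (λ c → c ℤ.* g (suc k) ℤ.+ (tail h * g) k) h0≡0)
                                                (ℤₚ.+-identityˡ _))

dil-*-small : ∀ f g r → r ℕ.< 5 → (dil f * g) r ≡ f 0 ℤ.* g r
dil-*-small f g r r<5 = trans (*-at-cong r {dil f} {const (f 0)} {g} {g} (λ i i≤r → small i (ℕₚ.≤-<-trans i≤r r<5)) (λ _ _ → refl))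
                              (const-*-at (f 0) g r)
  where
  small : ∀ i → i ℕ.< 5 → dil f i ≡ const (f 0) i
  small 0 _ = sym (const-at-zero _)
  small 1 _ = sym (const-at-suc _ _)
  small 2 _ = sym (const-at-suc _ _)
  small 3 _ = sym (const-at-suc _ _)
  small 4 _ = sym (const-at-suc _ _)
  small (suc (suc (suc (suc (suc i))))) (s≤s (s≤s (s≤s (s≤s (s≤s ())))))

-- A series in q⁵ shifts exponents by multiples of 5 only, so it behaves as a scalar for every
-- section.
sec-dil-* : ∀ {r} → r ℕ.< 5 → ∀ f g → sec r (dil f * g) ≈ f * sec r g
sec-dil-* {r} r<5 f g = coeffs (go f)
  where
  go : ∀ f n → sec r (dil f * g) n ≡ (f * sec r g) n
  go f zero    = trans (dil-*-small f g r r<5) (sym (*-at-zero f (sec r g)))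
  go f (suc n) = trans (dil-*-unroll f g (n ℕ.* 5 ℕ.+ r)) (trans
    (cong (λ x → f 0 ℤ.* sec r g (suc n) ℤ.+ x) (go (tail f) n)) (sym (*-at-suc f (sec r g) n)))

sec-cong : ∀ r {f g} → f ≈ g → sec r f ≈ sec r g
sec-cong r p = coeffs (λ n → at p (n ℕ.* 5 ℕ.+ r))

sec-cong[] : ∀ {r M f g} → f ≈[ M ℕ.* 5 ℕ.+ r ] g → sec r f ≈[ M ] sec r g
sec-cong[] {r} p = coeffs< (λ n n<M → at< p _ (ℕₚ.+-monoˡ-< r (ℕₚ.*-monoˡ-< 5 n<M)))

sec-+ : ∀ r f g → sec r (f + g) ≈ sec r f + sec r g
sec-+ r f g = coeffs (λ n → trans (+-at f g _) (sym (+-at (sec r f) (sec r g) n)))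

sec-neg : ∀ r f → sec r (- f) ≈ - sec r f
sec-neg r f = coeffs (λ n → trans (neg-at f _) (sym (neg-at (sec r f) n)))

sec-const-* : ∀ r c f → sec r (const c * f) ≈ const c * sec r f
sec-const-* r c f = coeffs (λ n → trans (const-*-at c f _) (sym (const-*-at c (sec r f) n)))

sec-ext : ∀ {f g} → (∀ r → r ℕ.< 5 → sec r f ≈ sec r g) → f ≈ g
sec-ext {f} {g} p = coeffs (λ n → let n≡ = trans (ℕDM.m≡m%n+[m/n]*n n 5) (ℕₚ.+-comm (n ℕDM.% 5) _) in
  trans (cong f n≡) (trans (at (p (n ℕDM.% 5) (ℕDM.m%n<n n 5)) (n ℕDM./ 5)) (cong g (sym n≡))))

sec₀-dil : ∀ f → sec 0 (dil f) ≈ f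
sec₀-dil f = coeffs (go f)
  where
  go : ∀ f n → dil f (n ℕ.* 5 ℕ.+ 0) ≡ f n
  go f zero    = refl
  go f (suc n) = go (tail f) n

sec-dil : ∀ {r} f → 0 ℕ.< r → r ℕ.< 5 → sec r (dil f) ≈ 0#
sec-dil {r} f 0<r r<5 = coeffs (λ n → trans (go f n) (sym (0#-at n)))
  where
  base : ∀ f r → 0 ℕ.< r → r ℕ.< 5 → dil f r ≡ 0ℤ
  base f 1 _ _ = refl
  base f 2 _ _ = refl
  base f 3 _ _ = refl
  base f 4 _ _ = refl
  base f (suc (suc (suc (suc (suc r))))) _ (s≤s (s≤s (s≤s (s≤s (s≤s ())))))
  go : ∀ f n → dil f (n ℕ.* 5 ℕ.+ r) ≡ 0ℤ
  go f zero    = base f r 0<r r<5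
  go f (suc n) = go (tail f) n

-- A dilation is recognised by its sections; the homomorphism properties of `dil` follow by looking
-- at section 0.
dil-ext : ∀ {f} g → sec 0 g ≈ f → (∀ r → 0 ℕ.< r → r ℕ.< 5 → sec r g ≈ 0#) → dil f ≈ g
dil-ext {f} g p z = sec-ext λ
  { zero    _   → ≈-trans (sec₀-dil f) (≈-sym p)
  ; (suc r) r<5 → ≈-trans (sec-dil f (s≤s z≤n) r<5) (≈-sym (z (suc r) (s≤s z≤n) r<5)) }

dil-cong : ∀ {f g} → f ≈ g → dil f ≈ dil g
dil-cong {f} {g} p = dil-ext (dil g) (≈-trans (sec₀-dil g) (≈-sym p)) (λ r 0<r r<5 → sec-dil g 0<r r<5)

dil-* : ∀ f g → dil (f * g) ≈ dil f * dil g
dil-* f g = dil-ext (dil f * dil g)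
  (≈-trans (sec-dil-* (s≤s z≤n) f (dil g)) (*-congˡ (sec₀-dil g)))
  (λ r 0<r r<5 → ≈-trans (sec-dil-* r<5 f (dil g)) (≈-trans (*-congˡ (sec-dil g 0<r r<5)) (zeroʳ f)))

dil-+ : ∀ f g → dil (f + g) ≈ dil f + dil g
dil-+ f g = dil-ext (dil f + dil g)
  (≈-trans (sec-+ 0 (dil f) (dil g)) (+-cong (sec₀-dil f) (sec₀-dil g)))
  (λ r 0<r r<5 → ≈-trans (sec-+ r (dil f) (dil g)) (≈-trans (+-cong (sec-dil f 0<r r<5) (sec-dil g 0<r r<5)) (+-identityˡ 0#)))

dil-neg : ∀ f → dil (- f) ≈ - dil f
dil-neg f = dil-ext (- dil f)
  (≈-trans (sec-neg 0 (dil f)) (-‿cong (sec₀-dil f)))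
  (λ r 0<r r<5 → ≈-trans (sec-neg r (dil f)) (≈-trans (-‿cong (sec-dil f 0<r r<5)) -0≈0))
  where
  open FPS-Solver
  -0≈0 : - 0# ≈ 0#
  -0≈0 = solve 0 (:- con 0ℤ := con 0ℤ) ≈-refl

dil-const : ∀ c → dil (const c) ≈ const c
dil-const c = dil-ext (const c) (coeffs λ { zero → refl ; (suc n) → trans (const-at-suc c _) (sym (const-at-suc c n)) })
  (λ { (suc r) _ _ → coeffs (λ n → trans (cong (const c) (ℕₚ.+-suc (n ℕ.* 5) r)) (trans (const-at-suc c _) (sym (0#-at n)))) })

dil-^ : ∀ f k → dil (f ^ k) ≈ dil f ^ k
dil-^ f zero    = dil-const 1ℤ
dil-^ f (suc k) = ≈-trans (dil-* f (f ^ k)) (*-congˡ (dil-^ f k))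

dil-mono : ∀ m → dil (mono m) ≈ mono (m ℕ.* 5)
dil-mono m = coeffs (go m)
  where
  dil-zero : ∀ n → dil (λ _ → 0ℤ) n ≡ 0ℤ
  dil-zero 0 = refl
  dil-zero 1 = refl
  dil-zero 2 = refl
  dil-zero 3 = refl
  dil-zero 4 = refl
  dil-zero (suc (suc (suc (suc (suc n))))) = dil-zero n
  go : ∀ m n → dil (mono m) n ≡ mono (m ℕ.* 5) n
  go zero    0 = refl
  go zero    1 = refl
  go zero    2 = refl
  go zero    3 = refl
  go zero    4 = refl
  go zero    (suc (suc (suc (suc (suc n))))) = dil-zero n
  go (suc m) 0 = refl
  go (suc m) 1 = refl
  go (suc m) 2 = refl
  go (suc m) 3 = refl
  go (suc m) 4 = refl
  go (suc m) (suc (suc (suc (suc (suc n))))) = go m n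

dil-inv : ∀ {f} → Unit f → dil (inv f) ≈ inv (dil f)
dil-inv {f} u = inv-unique u (≈-trans (≈-sym (dil-* f (inv f))) (≈-trans (dil-cong (*-inv f u)) (dil-const 1ℤ)))

dil-cong[] : ∀ {M f g} → f ≈[ M ] g → dil f ≈[ M ] dil g
dil-cong[] {M} {f} {g} p = coeffs< (λ n → go n f g (at< p))
  where
  go : ∀ {M} n f g → (∀ i → i ℕ.< M → f i ≡ g i) → n ℕ.< M → dil f n ≡ dil g n
  go 0 f g p 0<M = p 0 0<M
  go 1 f g p _ = refl
  go 2 f g p _ = refl
  go 3 f g p _ = refl
  go 4 f g p _ = refl
  go {suc M} (suc (suc (suc (suc (suc n))))) f g p (s≤s n<M) = go {M} n (tail f) (tail g) (λ i i<M → p (suc i) (s≤s i<M))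
    (ℕₚ.≤-trans (ℕₚ.m≤n+m (suc n) 4) n<M)

sec-mono : ∀ r m → sec r (mono (m ℕ.* 5 ℕ.+ r)) ≈ mono m
sec-mono r m = coeffs (go m)
  where
  self : ∀ r k → mono (k ℕ.+ r) r ≡ mono k 0
  self zero    k rewrite ℕₚ.+-identityʳ k = refl
  self (suc r) k rewrite ℕₚ.+-suc k r = self r k
  below : ∀ r n → mono r (suc n ℕ.+ r) ≡ 0ℤ
  below zero    n = refl
  below (suc r) n rewrite ℕₚ.+-suc n r = below r n
  go : ∀ m n → mono (m ℕ.* 5 ℕ.+ r) (n ℕ.* 5 ℕ.+ r) ≡ mono m n
  go zero    zero    = self r 0
  go zero    (suc n) = below r (4 ℕ.+ n ℕ.* 5)
  go (suc m) zero    = self r (5 ℕ.+ m ℕ.* 5)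
  go (suc m) (suc n) = go m n

sec-mono-other : ∀ {r s} m → r ℕ.< 5 → s ℕ.< 5 → ¬ r ≡ s → sec s (mono (m ℕ.* 5 ℕ.+ r)) ≈ 0#
sec-mono-other {r} {s} m r<5 s<5 r≢s = coeffs (λ n → trans (other (λ eq → r≢s (residue m n eq))) (sym (0#-at n)))
  where
  other : ∀ {a b} → ¬ a ≡ b → mono a b ≡ 0ℤ
  other {zero}  {zero}  a≢b = contradiction refl a≢b
  other {zero}  {suc b} a≢b = refl
  other {suc a} {zero}  a≢b = refl
  other {suc a} {suc b} a≢b = other {a} {b} (a≢b ∘ cong suc)
  mod : ∀ k t → t ℕ.< 5 → (k ℕ.* 5 ℕ.+ t) ℕDM.% 5 ≡ t
  mod k t t<5 = trans (cong (ℕDM._% 5) (ℕₚ.+-comm (k ℕ.* 5) t)) (trans (ℕDM.[m+kn]%n≡m%n t k 5) (ℕDM.m<n⇒m%n≡m t<5))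
  residue : ∀ m n → m ℕ.* 5 ℕ.+ r ≡ n ℕ.* 5 ℕ.+ s → r ≡ s
  residue m n eq = trans (sym (mod m r r<5)) (trans (cong (ℕDM._% 5) eq) (mod n s s<5))

-- The derivation q d/dq and the corresponding logarithmic derivative.
θ : FPS → FPS
θ f n = + n ℤ.* f n

Λ : FPS → FPS
Λ f = θ f * inv f

θ-cong[] : ∀ {M f g} → f ≈[ M ] g → θ f ≈[ M ] θ g
θ-cong[] p = coeffs< (λ n n<M → cong (+ n ℤ.*_) (at< p n n<M))

θ-cong : ∀ {f g} → f ≈ g → θ f ≈ θ g
θ-cong p = coeffs (λ n → cong (+ n ℤ.*_) (at p n))

θ-+ : ∀ f g → θ (f + g) ≈ θ f + θ g
θ-+ f g = coeffs (λ n → trans (cong (+ n ℤ.*_) (+-at f g n)) (trans (ℤₚ.*-distribˡ-+ (+ n) (f n) (g n)) (sym (+-at (θ f) (θ g) n))))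

θ-neg : ∀ f → θ (- f) ≈ - θ f
θ-neg f = coeffs (λ n → trans (cong (+ n ℤ.*_) (neg-at f n)) (trans (sym (ℤₚ.neg-distribʳ-* (+ n) (f n))) (sym (neg-at (θ f) n))))

θ-const : ∀ c → θ (const c) ≈ 0#
θ-const c = coeffs λ
  { zero    → sym (0#-at 0)
  ; (suc n) → trans (cong (+ suc n ℤ.*_) (const-at-suc c n)) (trans (ℤₚ.*-zeroʳ (+ suc n)) (sym (0#-at (suc n)))) }

θ-mono : ∀ m → θ (mono m) ≈ const (+ m) * mono m
θ-mono m = coeffs (λ n → trans (go m n) (sym (const-*-at (+ m) (mono m) n)))
  where
  go : ∀ m n → + n ℤ.* mono m n ≡ + m ℤ.* mono m n
  go zero    zero    = refl
  go zero    (suc n) = ℤₚ.*-zeroʳ (+ suc n)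
  go (suc m) zero    = sym (ℤₚ.*-zeroʳ (+ suc m))
  go (suc m) (suc n) = trans (ℤₚ.suc-* (+ n) (mono m n)) (trans (cong (λ x → mono m n ℤ.+ x) (go m n)) (sym (ℤₚ.suc-* (+ m) (mono m n))))

-- In degree `suc n` the weight splits as 1 + n. The part n is the induction hypothesis for
-- `tail f`; the part 1 makes up the difference between θ (tail f) and the tail of θ f.
θ-* : ∀ f g → θ (f * g) ≈ θ f * g + f * θ g
θ-* f g = coeffs (λ n → trans (go f n) (sym (+-at (θ f * g) (f * θ g) n)))
  where
  go : ∀ f n → + n ℤ.* (f * g) n ≡ (θ f * g) n ℤ.+ (f * θ g) n
  go f zero = sym (cong₂ ℤ._+_ (*-at-zero (θ f) g) (trans (*-at-zero f (θ g)) (ℤₚ.*-zeroʳ (f 0))))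
  go f (suc n) = begin
    + suc n ℤ.* (f * g) (suc n)
      ≡⟨ cong (+ suc n ℤ.*_) (*-at-suc f g n) ⟩
    + suc n ℤ.* (f 0 ℤ.* g (suc n) ℤ.+ (tail f * g) n)
      ≡⟨ solve 4 (λ a b c d → (con 1ℤ :+ a) :* (b :* c :+ d) := (d :+ a :* d) :+ b :* ((con 1ℤ :+ a) :* c)) refl
           (+ n) (f 0) (g (suc n)) ((tail f * g) n) ⟩
    ((tail f * g) n ℤ.+ + n ℤ.* (tail f * g) n) ℤ.+ f 0 ℤ.* θ g (suc n)
      ≡⟨ cong (λ x → ((tail f * g) n ℤ.+ x) ℤ.+ f 0 ℤ.* θ g (suc n)) (go (tail f) n) ⟩
    ((tail f * g) n ℤ.+ ((θ (tail f) * g) n ℤ.+ (tail f * θ g) n)) ℤ.+ f 0 ℤ.* θ g (suc n)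
      ≡⟨ solve 4 (λ a b c d → (a :+ (b :+ c)) :+ d := (a :+ b) :+ (d :+ c)) refl
           ((tail f * g) n) ((θ (tail f) * g) n) ((tail f * θ g) n) (f 0 ℤ.* θ g (suc n)) ⟩
    ((tail f * g) n ℤ.+ (θ (tail f) * g) n) ℤ.+ (f 0 ℤ.* θ g (suc n) ℤ.+ (tail f * θ g) n)
      ≡⟨ cong₂ ℤ._+_ tail-θ (sym (*-at-suc f (θ g) n)) ⟩
    (θ f * g) (suc n) ℤ.+ (f * θ g) (suc n) ∎
    where
    open ≡.≡-Reasoning
    open ℤSolver.+-*-Solver
    tail-θ : (tail f * g) n ℤ.+ (θ (tail f) * g) n ≡ (θ f * g) (suc n)
    tail-θ = trans (sym (+-at (tail f * g) (θ (tail f) * g) n)) (trans (sym (at (distribʳ g (tail f) (θ (tail f))) n)) (trans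
      (at (*-congʳ {g} (coeffs (λ i → trans (+-at (tail f) (θ (tail f)) i) (sym (ℤₚ.suc-* (+ i) (f (suc i))))))) n)
      (sym (trans (*-at-suc (θ f) g n) (ℤₚ.+-identityˡ _)))))

Λ-cong[] : ∀ {M f g} → Unit f → Unit g → f ≈[ M ] g → Λ f ≈[ M ] Λ g
Λ-cong[] u w p = *-cong[] (θ-cong[] p) (inv-cong[] u w p)

Λ-cong : ∀ {f g} → Unit f → f ≈ g → Λ f ≈ Λ g
Λ-cong u p = *-cong (θ-cong p) (inv-cong u p)

Λ-unique : ∀ {f h} → Unit f → θ f ≈ h * f → Λ f ≈ h
Λ-unique {f} {h} u p = ≈-trans (*-congʳ p) (≈-trans (*-assoc h f (inv f)) (≈-trans (*-congˡ (*-inv f u)) (*-identityʳ h)))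

θ≈Λ* : ∀ {f} → Unit f → θ f ≈ Λ f * f
θ≈Λ* {f} u = ≈-sym (≈-trans (*-assoc (θ f) (inv f) f) (≈-trans (*-congˡ (≈-trans (*-comm (inv f) f) (*-inv f u))) (*-identityʳ (θ f))))

Λ-* : ∀ {f g} → Unit f → Unit g → Λ (f * g) ≈ Λ f + Λ g
Λ-* {f} {g} u w = Λ-unique (Unit-* {f} {g} u w) (begin
  θ (f * g)                     ≈⟨ θ-* f g ⟩
  θ f * g + f * θ g             ≈⟨ +-cong (*-congʳ (θ≈Λ* u)) (*-congˡ (θ≈Λ* w)) ⟩
  Λ f * f * g + f * (Λ g * g)   ≈⟨ solve 4 (λ a b x y → a :* x :* y :+ x :* (b :* y) := (a :+ b) :* (x :* y)) ≈-refl (Λ f) (Λ g) f g ⟩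
  (Λ f + Λ g) * (f * g)         ∎)
  where open ≈-Reasoning
        open FPS-Solver

Λ-^ : ∀ {f} k → Unit f → Λ (f ^ k) ≈ const (+ k) * Λ f
Λ-^ {f} zero    u = ≈-trans (*-congʳ (θ-const 1ℤ)) (≈-trans (zeroˡ _) (≈-sym (zeroˡ (Λ f))))
Λ-^ {f} (suc k) u = ≈-trans (Λ-* {f} {f ^ k} u (Unit-^ k u)) (≈-trans (+-congˡ (Λ-^ k u)) (≈-trans
  (solve 2 (λ c x → x :+ c :* x := (con 1ℤ :+ c) :* x) ≈-refl (const (+ k)) (Λ f))
  (*-congʳ (≈-sym (const-+ 1ℤ (+ k))))))
  where open FPS-Solver

-- The quotient h = f / g has θ h = 0, that is n h_n = 0 for all n. In ℤ this kills every
-- coefficient except the constant term, which is 1.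
Λ-injective : ∀ {f g} → Unit f → Unit g → Λ f ≈ Λ g → f ≈ g
Λ-injective {f} {g} u w p = ≈-trans f≈hg (≈-trans (*-congʳ h≈1) (*-identityˡ g))
  where
  open FPS-Solver
  h = f * inv g
  f≈hg : f ≈ h * g
  f≈hg = ≈-sym (≈-trans (*-assoc f (inv g) g) (≈-trans (*-congˡ (≈-trans (*-comm (inv g) g) (*-inv g w))) (*-identityʳ f)))
  Unit-h : Unit h
  -- Every `inv g` has constant term 1 by computation, hence `refl`.
  Unit-h = Unit-* {f} {inv g} u refl
  Λh≈0 : Λ h ≈ 0#
  Λh≈0 = ≈-trans (solve 2 (λ a b → a := (a :+ b) :- b) ≈-refl (Λ h) (Λ g))
    (≈-trans (+-congʳ (≈-trans (≈-sym (Λ-* {h} {g} Unit-h w)) (≈-trans (Λ-cong (Unit-≈ f≈hg u) (≈-sym f≈hg)) p))) (-‿inverseʳ (Λ g)))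
  θh≈0 : θ h ≈ 0#
  θh≈0 = ≈-trans (θ≈Λ* Unit-h) (≈-trans (*-congʳ Λh≈0) (zeroˡ h))
  h≈1 : h ≈ 1#
  h≈1 = coeffs λ
    { zero    → trans Unit-h (sym Unit-1#)
    ; (suc n) → trans (ℤₚ.*-cancelˡ-≡ (+ suc n) (h (suc n)) 0ℤ (trans (at θh≈0 (suc n)) (trans (0#-at (suc n)) (sym (ℤₚ.*-zeroʳ (+ suc n))))))
                      (sym (const-at-suc 1ℤ n)) }

θ-dil : ∀ f → θ (dil f) ≈ const (+ 5) * dil (θ f)
θ-dil f = ≈-sym (≈-trans (≈-sym (≈-trans (dil-* (const (+ 5)) (θ f)) (*-congʳ (dil-const (+ 5)))))
  (dil-ext (θ (dil f)) (coeffs sec₀) secᵣ))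
  where
  open ℤSolver.+-*-Solver
  sec₀ : ∀ n → + (n ℕ.* 5 ℕ.+ 0) ℤ.* dil f (n ℕ.* 5 ℕ.+ 0) ≡ (const (+ 5) * θ f) n
  sec₀ n = trans (cong₂ ℤ._*_ (trans (cong +_ (ℕₚ.+-identityʳ (n ℕ.* 5))) (ℤₚ.pos-* n 5)) (at (sec₀-dil f) n)) (trans
    (solve 2 (λ n x → n :* con (+ 5) :* x := con (+ 5) :* (n :* x)) refl (+ n) (f n))
    (sym (const-*-at (+ 5) (θ f) n)))
  secᵣ : ∀ r → 0 ℕ.< r → r ℕ.< 5 → sec r (θ (dil f)) ≈ 0#
  secᵣ r 0<r r<5 = coeffs (λ n → trans (cong (+ (n ℕ.* 5 ℕ.+ r) ℤ.*_) (trans (at (sec-dil f 0<r r<5) n) (0#-at n)))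
    (trans (ℤₚ.*-zeroʳ (+ (n ℕ.* 5 ℕ.+ r))) (sym (0#-at n))))

Λ-dil : ∀ {f} → Unit f → Λ (dil f) ≈ const (+ 5) * dil (Λ f)
Λ-dil {f} u = ≈-trans (*-cong (θ-dil f) (≈-sym (dil-inv u))) (≈-trans (*-assoc _ _ _) (*-congˡ (≈-sym (dil-* (θ f) (inv f)))))

-- The products (q^r ; q^d)_∞

opaque
  fac : ℕ → ℕ → ℕ → FPS
  fac d r k = one ⊕ (⊖ mono (d ℕ.* k ℕ.+ r))

  -- (q^r ; q^d)_∞
  poch : ℕ → ℕ → FPS
  poch d r = prodInf (fac d r)

  poch5≡poch : ∀ r → poch5 r ≡ poch 5 r
  poch5≡poch r = refl

  fac≈ : ∀ d r k → fac d r k ≈ 1# - mono (d ℕ.* k ℕ.+ r)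
  fac≈ d r k = ≈-trans (≈-trans (≡⇒≈ (sym (+-as-⊕ one _))) (+-congˡ (≡⇒≈ (sym (neg-as-⊖ _))))) (+-congʳ one≈1#)

  Unit-fac : ∀ d r k → Unit (fac d (suc r) k)
  Unit-fac d r k rewrite ℕₚ.+-suc (d ℕ.* k) r = refl

fac-approx : ∀ d r k → fac (suc d) (suc r) k ≈[ suc k ] 1#
fac-approx d r k = ≈[]-trans (≈⇒≈[] (fac≈ (suc d) (suc r) k)) (≈[]-trans
  (+-cong[] ≈[]-refl (neg-cong[] (mono-large (subst (suc k ≤_) (sym (ℕₚ.+-suc (suc d ℕ.* k) r))
      (s≤s (ℕₚ.≤-trans (ℕₚ.m≤n*m k (suc d)) (ℕₚ.m≤m+n _ r)))))))
  (≈⇒≈[] (solve 0 (con 1ℤ :- con 0ℤ := con 1ℤ) ≈-refl)))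
  where open FPS-Solver

opaque
  unfolding poch

  poch-approx : ∀ d r {M N} → M ≤ N → poch (suc d) (suc r) ≈[ M ] fprod (fac (suc d) (suc r)) N
  poch-approx d r = prodInf-approx (fac-approx d r)

Unit-poch : ∀ d r → Unit (poch (suc d) (suc r))
Unit-poch d r = trans (at< (poch-approx d r {1} {1} ℕₚ.≤-refl) 0 (s≤s z≤n)) (Unit-fprod {fac (suc d) (suc r)} 1 (Unit-fac (suc d) r))

dil-fprod : ∀ f n → dil (fprod f n) ≈ fprod (dil ∘ f) n
dil-fprod f zero    = dil-const 1ℤ
dil-fprod f (suc n) = ≈-trans (dil-* (fprod f n) (f n)) (*-congʳ (dil-fprod f n))

dil-fac : ∀ d r k → dil (fac d r k) ≈ fac (d ℕ.* 5) (r ℕ.* 5) k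
dil-fac d r k = begin
  dil (fac d r k)                       ≈⟨ dil-cong (fac≈ d r k) ⟩
  dil (1# - mono (d ℕ.* k ℕ.+ r))       ≈⟨ ≈-trans (dil-+ 1# _) (+-cong (dil-const 1ℤ) (≈-trans (dil-neg _) (-‿cong (dil-mono (d ℕ.* k ℕ.+ r))))) ⟩
  1# - mono ((d ℕ.* k ℕ.+ r) ℕ.* 5)     ≡⟨ cong (λ e → 1# - mono e) exponent ⟩
  1# - mono (d ℕ.* 5 ℕ.* k ℕ.+ r ℕ.* 5) ≈⟨ fac≈ (d ℕ.* 5) (r ℕ.* 5) k ⟨
  fac (d ℕ.* 5) (r ℕ.* 5) k             ∎
  where
  open ≈-Reasoning
  exponent : (d ℕ.* k ℕ.+ r) ℕ.* 5 ≡ d ℕ.* 5 ℕ.* k ℕ.+ r ℕ.* 5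
  exponent = solve 3 (λ d k r → (d :* k :+ r) :* con 5 := d :* con 5 :* k :+ r :* con 5) refl d k r
    where open +-*-Solver

dil-poch : ∀ d r → dil (poch (suc d) (suc r)) ≈ poch (suc d ℕ.* 5) (suc r ℕ.* 5)
dil-poch d r = ≈[]⇒≈ λ M → begin
  dil (poch (suc d) (suc r))                      ≈⟨ dil-cong[] (poch-approx d r {M} ℕₚ.≤-refl) ⟩
  dil (fprod (fac (suc d) (suc r)) M)             ≈⟨ ≈⇒≈[] (≈-trans (dil-fprod _ M) (fprod-cong M (dil-fac (suc d) (suc r)))) ⟩
  fprod (fac (suc d ℕ.* 5) (suc r ℕ.* 5)) M       ≈⟨ poch-approx (4 ℕ.+ d ℕ.* 5) (4 ℕ.+ r ℕ.* 5) {M} ℕₚ.≤-refl ⟨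
  poch (suc d ℕ.* 5) (suc r ℕ.* 5)                ∎
  where open module Rsn {M} = ≈[]-Reasoning M

-- Formally summable families

-- Merging and comparing finite supports requires deciding equality of indices.
record Discrete (I : Set) : Set where
  field _≟_ : DecidableEquality I
open Discrete {{...}}

instance
  discrete-ℤ : Discrete ℤ
  discrete-ℤ = record { _≟_ = ℤₚ._≟_ }

  discrete-× : ∀ {I J} → {{Discrete I}} → {{Discrete J}} → Discrete (I × J)
  discrete-× = record { _≟_ = ≡-dec _≟_ _≟_ }

  discrete-⊎ : ∀ {I J} → {{Discrete I}} → {{Discrete J}} → Discrete (I ⊎ J)
  discrete-⊎ = record { _≟_ = Sumₚ.≡-dec _≟_ _≟_ }

  discrete-Fin : ∀ {n} → Discrete (Fin n)
  discrete-Fin = record { _≟_ = Finₚ._≟_ }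

private variable
  I J : Set
  M : ℕ

sumL : (I → FPS) → List I → FPS
sumL t []       = 0#
sumL t (i ∷ is) = t i + sumL t is

sumL-cong[] : {t u : I → FPS} → (∀ i → t i ≈[ M ] u i) → ∀ is → sumL t is ≈[ M ] sumL u is
sumL-cong[] p []       = ≈[]-refl
sumL-cong[] p (i ∷ is) = +-cong[] (p i) (sumL-cong[] p is)

sumL-cong : {t u : I → FPS} → (∀ i → t i ≈ u i) → ∀ is → sumL t is ≈ sumL u is
sumL-cong p []       = ≈-refl
sumL-cong p (i ∷ is) = +-cong (p i) (sumL-cong p is)

sumL-map : ∀ (t : I → FPS) (φ : J → I) js → sumL t (map φ js) ≡ sumL (t ∘ φ) js
sumL-map t φ []       = refl
sumL-map t φ (j ∷ js) = cong (λ x → t (φ j) + x) (sumL-map t φ js)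

sumL-++ : ∀ (t : I → FPS) is js → sumL t (is ++ js) ≈ sumL t is + sumL t js
sumL-++ t []       js = ≈-sym (+-identityˡ _)
sumL-++ t (i ∷ is) js = ≈-trans (+-congˡ (sumL-++ t is js)) (≈-sym (+-assoc (t i) _ _))

sumL-↭ : ∀ (t : I → FPS) {is js} → is ↭ js → sumL t is ≈ sumL t js
sumL-↭ t Perm.refl         = ≈-refl
sumL-↭ t (Perm.prep i p)   = +-congˡ (sumL-↭ t p)
sumL-↭ t (Perm.swap i j p) = ≈-trans (≈-sym (+-assoc (t i) (t j) _)) (≈-trans (+-cong (+-comm (t i) (t j)) (sumL-↭ t p)) (+-assoc (t j) (t i) _))
sumL-↭ t (Perm.trans p r)  = ≈-trans (sumL-↭ t p) (sumL-↭ t r)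

sumL-zero : ∀ (t : I → FPS) is → (∀ i → i ∈ is → t i ≈[ M ] 0#) → sumL t is ≈[ M ] 0#
sumL-zero t []       z = ≈[]-refl
sumL-zero t (i ∷ is) z = ≈[]-trans (+-cong[] (z i (here refl)) (sumL-zero t is (λ j → z j ∘ there))) (≈⇒≈[] (+-identityˡ 0#))

extract : {i : I} {is : List I} → i ∈ is → ∃ λ js → is ↭ i ∷ js
extract {i = i} i∈is with js , ks , refl ← ∈ₚ.∈-∃++ i∈is = js ++ ks , Permₚ.shift i js ks

-- This makes a sum independent of the chosen support. Each index of the first list is either
-- removed from the second by a permutation or contributes nothing modulo q^M.
sumL-unique : {{Discrete I}} → ∀ (t : I → FPS) {is js} → Unique is → Unique js →
              (∀ i → i ∈ is → i ∉ js → t i ≈[ M ] 0#) → (∀ i → i ∈ js → i ∉ is → t i ≈[ M ] 0#) →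
              sumL t is ≈[ M ] sumL t js
sumL-unique t {[]} {js} _ _ _ z = ≈[]-sym (sumL-zero t js (λ i i∈js → z i i∈js (λ ())))
sumL-unique {I} {M} t {i ∷ is} {js} (i∉is ∷ u) w y z with DecMembership._∈?_ _≟_ i js
... | no i∉js = ≈[]-trans
  (+-cong[] (y i (here refl) i∉js) (sumL-unique t u w (λ k → y k ∘ there) (λ k k∈js k∉is → z k k∈js λ
    { (here refl) → i∉js k∈js ; (there k∈is) → k∉is k∈is })))
  (≈⇒≈[] (+-identityˡ _))
... | yes i∈js with ks , js↭ ← extract i∈js
    with i∉ks ∷ w′ ← PermSetoidₚ.Unique-resp-↭ (≡.setoid I) (Perm.↭⇒↭ₛ js↭) w = ≈[]-trans
  (+-cong[] ≈[]-refl (sumL-unique t {is} {ks} u w′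
    (λ k k∈is k∉ks → y k (there k∈is) (λ k∈js → case (Permₚ.∈-resp-↭ js↭ k∈js) k∈is k∉ks))
    (λ k k∈ks k∉is → z k (Permₚ.∈-resp-↭ (Perm.↭-sym js↭) (there k∈ks)) λ
      { (here refl) → All.lookup i∉ks k∈ks refl ; (there k∈is) → k∉is k∈is })))
  (≈⇒≈[] (≈-sym (sumL-↭ t js↭)))
  where
  case : ∀ {k ks} → k ∈ i ∷ ks → k ∈ is → ¬ k ∉ ks
  case (here refl)  k∈is _    = All.lookup i∉is k∈is refl
  case (there k∈ks) _    k∉ks = k∉ks k∈ks

-- The support may depend on M: this is unconditional summability in the q-adic topology.
record HasSum[_] (M : ℕ) {I : Set} (t : I → FPS) (f : FPS) : Set where
  constructor hasSum
  field
    support : List I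
    unique  : Unique support
    vanish  : ∀ i → i ∉ support → t i ≈[ M ] 0#
    total   : sumL t support ≈[ M ] f
open HasSum[_]

HasSum : {I : Set} → (I → FPS) → FPS → Set
HasSum t f = ∀ M → HasSum[ M ] t f

HasSum-unique : ∀ {f g} → {{Discrete I}} → {t : I → FPS} → HasSum t f → HasSum t g → f ≈ g
HasSum-unique {t = t} S T = ≈[]⇒≈ λ M → ≈[]-trans (≈[]-sym (total (S M))) (≈[]-trans
  (sumL-unique t (unique (S M)) (unique (T M)) (λ i _ → vanish (T M) i) (λ i _ → vanish (S M) i))
  (total (T M)))

HasSum[]-cong : ∀ {f g} → {t u : I → FPS} → (∀ i → t i ≈[ M ] u i) → f ≈[ M ] g → HasSum[ M ] t f → HasSum[ M ] u g
HasSum[]-cong t≈u f≈g (hasSum is un va to) = hasSum is un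
  (λ i i∉is → ≈[]-trans (≈[]-sym (t≈u i)) (va i i∉is))
  (≈[]-trans (≈[]-sym (sumL-cong[] t≈u is)) (≈[]-trans to f≈g))

HasSum-cong : ∀ {f g} → {t u : I → FPS} → (∀ i → t i ≈ u i) → f ≈ g → HasSum t f → HasSum u g
HasSum-cong t≈u f≈g S M = HasSum[]-cong (λ i → ≈⇒≈[] (t≈u i)) (≈⇒≈[] f≈g) (S M)

HasSum-reindex : ∀ {f} → {t : I → FPS} (φ : J → I) (ψ : I → J) → (∀ i → φ (ψ i) ≡ i) → (∀ j → ψ (φ j) ≡ j) →
                 HasSum t f → HasSum (t ∘ φ) f
HasSum-reindex {t = t} φ ψ φψ ψφ S M with hasSum is un va to ← S M = hasSum (map ψ is)
  (Uniqueₚ.map⁺ (λ {i} {j} eq → trans (sym (φψ i)) (trans (cong φ eq) (φψ j))) un)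
  (λ j j∉ → va (φ j) (λ φj∈is → j∉ (subst (_∈ map ψ is) (ψφ j) (∈ₚ.∈-map⁺ ψ φj∈is))))
  (≈[]-trans (≈⇒≈[] (≈-trans (≡⇒≈ (sumL-map (t ∘ φ) ψ is)) (sumL-cong (λ i → ≡⇒≈ (cong t (φψ i))) is))) to)

HasSum-zero : ∀ {f} → {t : I → FPS} → (∀ i → t i ≈ 0#) → HasSum t f → f ≈ 0#
HasSum-zero {t = t} t≈0 S = ≈[]⇒≈ λ M → ≈[]-trans (≈[]-sym (total (S M))) (sumL-zero t (support (S M)) (λ i _ → ≈⇒≈[] (t≈0 i)))

HasSum-+ : ∀ {f g} → {{Discrete I}} → {t u : I → FPS} → HasSum t f → HasSum u g → HasSum (λ i → t i + u i) (f + g)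
HasSum-+ {t = t} {u} S T M with hasSum is un va to ← S M | hasSum js un′ va′ to′ ← T M = hasSum ks unique-ks
  (λ i i∉ks → ≈[]-trans (+-cong[] (va i (i∉ks ∘ left)) (va′ i (i∉ks ∘ right))) (≈⇒≈[] (+-identityˡ 0#)))
  (≈[]-trans (≈⇒≈[] (split ks)) (+-cong[]
    (≈[]-trans (sumL-unique t unique-ks un (λ i _ → va i) (λ i i∈is i∉ks → contradiction (left i∈is) i∉ks)) to)
    (≈[]-trans (sumL-unique u unique-ks un′ (λ i _ → va′ i) (λ i i∈js i∉ks → contradiction (right i∈js) i∉ks)) to′)))
  where
  ks = deduplicate _≟_ (is ++ js)
  unique-ks = DecUniqueₚ.deduplicate-! _≟_ (is ++ js)
  left : ∀ {i} → i ∈ is → i ∈ ks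
  left i∈is = ∈ₚ.∈-deduplicate⁺ _≟_ (∈ₚ.∈-++⁺ˡ i∈is)
  right : ∀ {i} → i ∈ js → i ∈ ks
  right i∈js = ∈ₚ.∈-deduplicate⁺ _≟_ (∈ₚ.∈-++⁺ʳ is i∈js)
  split : ∀ is → sumL (λ i → t i + u i) is ≈ sumL t is + sumL u is
  split []       = ≈-sym (+-identityˡ 0#)
  split (i ∷ is) = ≈-trans (+-congˡ (split is))
    (solve 4 (λ a b c d → (a :+ b) :+ (c :+ d) := (a :+ c) :+ (b :+ d)) ≈-refl (t i) (u i) (sumL t is) (sumL u is))
    where open FPS-Solver

-- Additive maps that are continuous in the q-adic topology: `modulus M` is the precision of the
-- argument that fixes the image modulo q^M. For `sec r` it is 5 M + r.
record Additive (F : FPS → FPS) : Set where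
  field
    F-zero : F 0# ≈ 0#
    F-+    : ∀ f g → F (f + g) ≈ F f + F g
    modulus : ℕ → ℕ
    F-cong : ∀ {M f g} → f ≈[ modulus M ] g → F f ≈[ M ] F g

HasSum-map : ∀ {f F} → Additive F → {t : I → FPS} → HasSum t f → HasSum (F ∘ t) (F f)
HasSum-map {F = F} additive {t} S M with hasSum is un va to ← S (Additive.modulus additive M) =
  hasSum is un (λ i i∉is → ≈[]-trans (F-cong (va i i∉is)) (≈⇒≈[] F-zero)) (≈[]-trans (≈⇒≈[] (F-sum is)) (F-cong to))
  where
  open Additive additive
  F-sum : ∀ is → sumL (F ∘ t) is ≈ F (sumL t is)
  F-sum []       = ≈-sym F-zero
  F-sum (i ∷ is) = ≈-trans (+-congˡ (F-sum is)) (≈-sym (F-+ (t i) (sumL t is)))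

additive-* : ∀ c → Additive (c *_)
additive-* c = record { F-zero = zeroʳ c ; F-+ = distribˡ c ; modulus = id ; F-cong = *-cong[] ≈[]-refl }

additive-sec : ∀ r → Additive (sec r)
additive-sec r = record
  { F-zero = coeffs (λ n → trans (0#-at _) (sym (0#-at n))) ; F-+ = sec-+ r
  ; modulus = λ M → M ℕ.* 5 ℕ.+ r ; F-cong = sec-cong[] }

additive-dil : Additive dil
additive-dil = record { F-zero = dil-const 0ℤ ; F-+ = dil-+ ; modulus = id ; F-cong = dil-cong[] }

HasSum-× : ∀ {f g} → {{Discrete I}} → {{Discrete J}} → {t : I → FPS} {u : J → FPS} →
           HasSum t f → HasSum u g → HasSum (λ (i , j) → t i * u j) (f * g)
HasSum-× {t = t} {u} S T M with hasSum is un va to ← S M | hasSum js un′ va′ to′ ← T M =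
  hasSum (cartesianProduct is js) (Uniqueₚ.cartesianProduct⁺ un un′) vanish-×
    (≈[]-trans (≈⇒≈[] (sum-× is)) (*-cong[] to to′))
  where
  vanish-× : ∀ ij → ij ∉ cartesianProduct is js → t (proj₁ ij) * u (proj₂ ij) ≈[ M ] 0#
  vanish-× (i , j) ij∉ with DecMembership._∈?_ _≟_ i is
  ... | no  i∉is = ≈[]-trans (*-cong[] (va i i∉is) ≈[]-refl) (≈⇒≈[] (zeroˡ _))
  ... | yes i∈is = ≈[]-trans (*-cong[] ≈[]-refl (va′ j (λ j∈js → ij∉ (∈ₚ.∈-cartesianProduct⁺ i∈is j∈js)))) (≈⇒≈[] (zeroʳ _))
  row : ∀ i js → sumL (λ (i , j) → t i * u j) (map (i ,_) js) ≈ t i * sumL u js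
  row i []       = ≈-sym (zeroʳ (t i))
  row i (j ∷ js) = ≈-trans (+-congˡ (row i js)) (≈-sym (distribˡ (t i) (u j) (sumL u js)))
  sum-× : ∀ is → sumL (λ (i , j) → t i * u j) (cartesianProduct is js) ≈ sumL t is * sumL u js
  sum-× []       = ≈-sym (zeroˡ _)
  sum-× (i ∷ is) = ≈-trans (sumL-++ _ (map (i ,_) js) _) (≈-trans (+-cong (row i js) (sum-× is)) (≈-sym (distribʳ (sumL u js) (t i) (sumL t is))))

lefts : List (I ⊎ J) → List I
lefts []            = []
lefts (inj₁ i ∷ xs) = i ∷ lefts xs
lefts (inj₂ j ∷ xs) = lefts xs

∈-lefts⁻ : ∀ {i : I} {xs : List (I ⊎ J)} → i ∈ lefts xs → inj₁ i ∈ xs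
∈-lefts⁻ {xs = inj₁ _ ∷ xs} (here refl) = here refl
∈-lefts⁻ {xs = inj₁ _ ∷ xs} (there p)   = there (∈-lefts⁻ p)
∈-lefts⁻ {xs = inj₂ _ ∷ xs} p           = there (∈-lefts⁻ p)

∈-lefts⁺ : ∀ {i : I} {xs : List (I ⊎ J)} → inj₁ i ∈ xs → i ∈ lefts xs
∈-lefts⁺ {xs = inj₁ _ ∷ xs} (here refl) = here refl
∈-lefts⁺ {xs = inj₁ _ ∷ xs} (there p)   = there (∈-lefts⁺ p)
∈-lefts⁺ {xs = inj₂ _ ∷ xs} (there p)   = ∈-lefts⁺ p

lefts-unique : ∀ {xs : List (I ⊎ J)} → Unique xs → Unique (lefts xs)
lefts-unique {xs = []}          _         = []
lefts-unique {xs = inj₁ _ ∷ xs} (x∉ ∷ un) = All.tabulate (λ i∈ → λ { refl → All.lookup x∉ (∈-lefts⁻ i∈) refl }) ∷ lefts-unique un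
lefts-unique {xs = inj₂ _ ∷ xs} (x∉ ∷ un) = lefts-unique un

Summable : {I : Set} → (I → FPS) → Set
Summable {I} t = ∀ M → ∃ λ (is : List I) → Unique is × (∀ i → i ∉ is → t i ≈[ M ] 0#)

-- Completeness: the coefficient of q^n is read off the finite sum that suffices modulo q^(n+1). It
-- supplies sums for subfamilies, whose values are not known in advance.
summable⇒HasSum : {{Discrete I}} → {t : I → FPS} → Summable t → ∃ λ f → HasSum t f
summable⇒HasSum {t = t} S = (λ n → sumL t (proj₁ (S (suc n))) n) , λ M → hasSum (proj₁ (S M)) (proj₁ (proj₂ (S M))) (proj₂ (proj₂ (S M)))
  (coeffs< (λ n n<M → at< (sumL-unique {M = suc n} t (proj₁ (proj₂ (S M))) (proj₁ (proj₂ (S (suc n))))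
    (λ i _ → proj₂ (proj₂ (S (suc n))) i)
    (λ i _ i∉ → ≈[]-weaken n<M (proj₂ (proj₂ (S M)) i i∉))) n ℕₚ.≤-refl))

HasSum-left : ∀ {f} → {{Discrete I}} → {t : I ⊎ J → FPS} → HasSum t f → ∃ λ g → HasSum (t ∘ inj₁) g
HasSum-left S = summable⇒HasSum λ M → lefts (support (S M)) , lefts-unique (unique (S M)) ,
  λ i i∉ → vanish (S M) (inj₁ i) (i∉ ∘ ∈-lefts⁺)

HasSum-⊎ : ∀ {f g} → {t : I ⊎ J → FPS} → HasSum (t ∘ inj₁) f → HasSum (t ∘ inj₂) g → HasSum t (f + g)
HasSum-⊎ {t = t} S T M with hasSum is un va to ← S M | hasSum js un′ va′ to′ ← T M = hasSum (map inj₁ is ++ map inj₂ js)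
  (Uniqueₚ.++⁺ (Uniqueₚ.map⁺ (λ { refl → refl }) un) (Uniqueₚ.map⁺ (λ { refl → refl }) un′)
    (λ (p , r) → disjoint (∈ₚ.∈-map⁻ inj₁ p) (∈ₚ.∈-map⁻ inj₂ r)))
  (λ { (inj₁ i) i∉ → va i (i∉ ∘ ∈ₚ.∈-++⁺ˡ ∘ ∈ₚ.∈-map⁺ inj₁)
     ; (inj₂ j) j∉ → va′ j (j∉ ∘ ∈ₚ.∈-++⁺ʳ (map inj₁ is) ∘ ∈ₚ.∈-map⁺ inj₂) })
  (≈[]-trans (≈⇒≈[] (≈-trans (sumL-++ t (map inj₁ is) (map inj₂ js)) (+-cong (≡⇒≈ (sumL-map t inj₁ is)) (≡⇒≈ (sumL-map t inj₂ js)))))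
    (+-cong[] to to′))
  where
  disjoint : ∀ {x} → (∃ λ i → i ∈ is × x ≡ inj₁ i) → ¬ (∃ λ j → j ∈ js × x ≡ inj₂ j)
  disjoint (_ , _ , refl) (_ , _ , ())

HasSum-split : ∀ {f} → {{Discrete I}} → {{Discrete J}} → {t : I ⊎ J → FPS} → HasSum t f →
               ∃ λ g → ∃ λ h → HasSum (t ∘ inj₁) g × HasSum (t ∘ inj₂) h × f ≈ g + h
HasSum-split S with g , G ← HasSum-left S
  with h , H ← HasSum-left (HasSum-reindex Sum.swap Sum.swap Sumₚ.swap-involutive Sumₚ.swap-involutive S) =
  g , h , G , H , HasSum-unique S (HasSum-⊎ G H)

sumFin : ∀ {d} → (Fin d → FPS) → FPS
sumFin {zero}  F = 0#
sumFin {suc d} F = F Fin.zero + sumFin (F ∘ Fin.suc)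

-- The fibres are split off one at a time, each being a subfamily and therefore summable.
HasSum-fibres : ∀ {f} → {{Discrete I}} → ∀ {d} {t : Fin d × I → FPS} → HasSum t f →
                ∃ λ (F : Fin d → FPS) → (∀ r → HasSum (λ i → t (r , i)) (F r)) × f ≈ sumFin F
HasSum-fibres {d = zero}  S = (λ ()) , (λ ()) , HasSum-zero (λ ()) S
HasSum-fibres {I} {d = suc d} S = (λ { Fin.zero → proj₁ halves ; (Fin.suc r) → proj₁ rest r })
  , (λ { Fin.zero → proj₁ (proj₂ (proj₂ halves)) ; (Fin.suc r) → proj₁ (proj₂ rest) r })
  , ≈-trans (proj₂ (proj₂ (proj₂ (proj₂ halves)))) (+-congˡ (proj₂ (proj₂ rest)))
  where
  join : I ⊎ Fin d × I → Fin (suc d) × I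
  join (inj₁ i)       = Fin.zero , i
  join (inj₂ (r , i)) = Fin.suc r , i
  unjoin : Fin (suc d) × I → I ⊎ Fin d × I
  unjoin (Fin.zero , i)  = inj₁ i
  unjoin (Fin.suc r , i) = inj₂ (r , i)
  join-unjoin : ∀ x → join (unjoin x) ≡ x
  join-unjoin (Fin.zero , i)  = refl
  join-unjoin (Fin.suc r , i) = refl
  unjoin-join : ∀ x → unjoin (join x) ≡ x
  unjoin-join (inj₁ i)       = refl
  unjoin-join (inj₂ (r , i)) = refl
  halves = HasSum-split (HasSum-reindex join unjoin join-unjoin unjoin-join S)
  rest   = HasSum-fibres (proj₁ (proj₂ (proj₂ (proj₂ halves))))

-- Division with remainder as a bijection of index sets

module Residues (d : ℕ) {{_ : ℕ.NonZero d}} where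

  combine : Fin d × ℤ → ℤ
  combine (r , m) = + toℕ r ℤ.+ m ℤ.* + d

  divide : ℤ → Fin d × ℤ
  divide n = fromℕ< (ℤDM.n%ℕd<d n d) , n ℤDM./ℕ d

  combine-divide : ∀ n → combine (divide n) ≡ n
  combine-divide n = trans (cong (λ r → + r ℤ.+ n ℤDM./ℕ d ℤ.* + d) (Finₚ.toℕ-fromℕ< (ℤDM.n%ℕd<d n d)))
                           (sym (ℤDM.a≡a%ℕn+[a/ℕn]*n n d))

  -- The difference of two remainders is a multiple of `d` of absolute value less than `d`.
  combine-injective : ∀ x y → combine x ≡ combine y → x ≡ y
  combine-injective (r , m) (s , k) eq = cong₂ _,_ (Finₚ.toℕ-injective (ℤₚ.+-injective r≡s)) m≡k
    where
    open ℤSolver.+-*-Solver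
    difference : + toℕ r ℤ.- + toℕ s ≡ (k ℤ.- m) ℤ.* + d
    difference = trans (solve 4 (λ r s m d → r :- s := (r :+ m :* d) :- (s :+ m :* d)) refl (+ toℕ r) (+ toℕ s) m (+ d)) (trans
      (cong (ℤ._- (+ toℕ s ℤ.+ m ℤ.* + d)) eq)
      (solve 4 (λ s m k d → (s :+ k :* d) :- (s :+ m :* d) := (k :- m) :* d) refl (+ toℕ s) m k (+ d)))
    small : ℤ.∣ k ℤ.- m ∣ ℕ.* d ℕ.< d
    small = subst (ℕ._< d) (trans (cong ℤ.∣_∣ (trans (sym (ℤₚ.m-n≡m⊖n (toℕ r) (toℕ s))) difference)) (ℤₚ.abs-* (k ℤ.- m) (+ d)))
      (ℕₚ.≤-<-trans (ℤₚ.∣m⊝n∣≤m⊔n (toℕ r) (toℕ s)) (ℕₚ.⊔-lub (Finₚ.toℕ<n r) (Finₚ.toℕ<n s)))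
    zero-multiple : ∀ a → a ℕ.* d ℕ.< d → a ≡ 0
    zero-multiple zero    _  = refl
    zero-multiple (suc a) lt = contradiction (ℕₚ.m≤m+n d (a ℕ.* d)) (ℕₚ.<⇒≱ lt)
    k-m≡0 : k ℤ.- m ≡ 0ℤ
    k-m≡0 = ℤₚ.∣i∣≡0⇒i≡0 (zero-multiple ℤ.∣ k ℤ.- m ∣ small)
    m≡k : m ≡ k
    m≡k = sym (ℤₚ.i-j≡0⇒i≡j k m k-m≡0)
    r≡s : + toℕ r ≡ + toℕ s
    r≡s = ℤₚ.i-j≡0⇒i≡j (+ toℕ r) (+ toℕ s) (trans difference (cong (ℤ._* + d) k-m≡0))

  divide-combine : ∀ x → divide (combine x) ≡ x
  divide-combine x = combine-injective _ x (combine-divide (combine x))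

-- Jacobi's triple product

-- This is (-1)^j, not the sign of j.
sgn : ℤ → ℤ
sgn (+ zero)       = 1ℤ
sgn (+ suc n)      = ℤ.- sgn (+ n)
sgn -[1+ zero ]    = ℤ.- 1ℤ
sgn -[1+ suc n ]   = ℤ.- sgn -[1+ n ]

sgn-suc : ∀ j → sgn (1ℤ ℤ.+ j) ≡ ℤ.- sgn j
sgn-suc (+ n)        = refl
sgn-suc -[1+ zero ]  = refl
sgn-suc -[1+ suc n ] = sym (ℤₚ.neg-involutive (sgn -[1+ n ]))

sgn-pred : ∀ j → sgn (ℤ.- 1ℤ ℤ.+ j) ≡ ℤ.- sgn j
sgn-pred j = trans (sym (ℤₚ.neg-involutive _)) (cong ℤ.-_ (trans (sym (sgn-suc (ℤ.- 1ℤ ℤ.+ j)))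
  (cong sgn (trans (sym (ℤₚ.+-assoc 1ℤ (ℤ.- 1ℤ) j)) (ℤₚ.+-identityˡ j)))))

sgn-+ : ∀ i j → sgn (i ℤ.+ j) ≡ sgn i ℤ.* sgn j
sgn-+ (+ zero) j = trans (cong sgn (ℤₚ.+-identityˡ j)) (sym (ℤₚ.*-identityˡ (sgn j)))
sgn-+ (+ suc n) j = trans (cong sgn (ℤₚ.+-assoc 1ℤ (+ n) j)) (trans (sgn-suc (+ n ℤ.+ j)) (trans
  (cong ℤ.-_ (sgn-+ (+ n) j)) (ℤₚ.neg-distribˡ-* (sgn (+ n)) (sgn j))))
sgn-+ -[1+ zero ] j = trans (sgn-pred j) (sym (ℤₚ.-1*i≡-i (sgn j)))
sgn-+ -[1+ suc n ] j = trans (cong sgn (ℤₚ.+-assoc (ℤ.- 1ℤ) -[1+ n ] j)) (trans (sgn-pred (-[1+ n ] ℤ.+ j)) (trans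
  (cong ℤ.-_ (sgn-+ -[1+ n ] j)) (ℤₚ.neg-distribˡ-* (sgn -[1+ n ]) (sgn j))))

sgn² : ∀ j → sgn j ℤ.* sgn j ≡ 1ℤ
sgn² (+ zero)       = refl
sgn² (+ suc n)      = trans (sym (ℤₚ.neg-distribˡ-* (sgn (+ n)) (ℤ.- sgn (+ n))))
    (trans (cong ℤ.-_ (sym (ℤₚ.neg-distribʳ-* (sgn (+ n)) (sgn (+ n))))) (trans (ℤₚ.neg-involutive _) (sgn² (+ n))))
sgn² -[1+ zero ]    = refl
sgn² -[1+ suc n ]   = trans (sym (ℤₚ.neg-distribˡ-* (sgn -[1+ n ]) (ℤ.- sgn -[1+ n ])))
    (trans (cong ℤ.-_ (sym (ℤₚ.neg-distribʳ-* (sgn -[1+ n ]) (sgn -[1+ n ])))) (trans (ℤₚ.neg-involutive _) (sgn² -[1+ n ])))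

-- j (j - 1) / 2, a natural number for negative j as well.
tri : ℤ → ℕ
tri (+ zero)       = 0
tri (+ suc n)      = n ℕ.+ tri (+ n)
tri -[1+ zero ]    = 1
tri -[1+ suc n ]   = suc (suc n) ℕ.+ tri -[1+ n ]

-- Exponents are compared after doubling and in ℤ. There they are polynomials, and the ring solver
-- applies.
2*tri : ∀ j → + 2 ℤ.* + tri j ≡ j ℤ.* (j ℤ.- 1ℤ)
2*tri (+ zero)     = refl
2*tri (+ suc n)    = trans (solve 2 (λ n t → con (+ 2) :* (n :+ t) := con (+ 2) :* n :+ con (+ 2) :* t) refl (+ n) (+ tri (+ n)))
  (trans (cong (λ x → + 2 ℤ.* + n ℤ.+ x) (2*tri (+ n)))
  (solve 1 (λ n → con (+ 2) :* n :+ n :* (n :- con 1ℤ) := (con 1ℤ :+ n) :* ((con 1ℤ :+ n) :- con 1ℤ)) refl (+ n)))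
  where open ℤSolver.+-*-Solver
2*tri -[1+ zero ]  = refl
2*tri -[1+ suc n ] = trans (solve 2 (λ n t → con (+ 2) :* ((con (+ 2) :+ n) :+ t) := con (+ 2) :* (con (+ 2) :+ n) :+ con (+ 2) :* t) refl
    (+ n) (+ tri -[1+ n ]))
  (trans (cong (λ x → + 2 ℤ.* (+ 2 ℤ.+ + n) ℤ.+ x) (2*tri -[1+ n ]))
  (solve 1 (λ n → con (+ 2) :* (con (+ 2) :+ n) :+ :- (con 1ℤ :+ n) :* (:- (con 1ℤ :+ n) :- con 1ℤ)
                 := :- (con (+ 2) :+ n) :* (:- (con (+ 2) :+ n) :- con 1ℤ)) refl (+ n)))
  where open ℤSolver.+-*-Solver

opaque
  -- a j (j + 1) / 2 + b j (j - 1) / 2, the exponents of Ramanujan's f(-q^a , -q^b).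
  quad : ℕ → ℕ → ℤ → ℕ
  quad a b j = a ℕ.* tri (1ℤ ℤ.+ j) ℕ.+ b ℕ.* tri j

  quad≡ : ∀ a b j → quad a b j ≡ a ℕ.* tri (1ℤ ℤ.+ j) ℕ.+ b ℕ.* tri j
  quad≡ a b j = refl

2*quad : ∀ a b j → + 2 ℤ.* + quad a b j ≡ + a ℤ.* ((1ℤ ℤ.+ j) ℤ.* j) ℤ.+ + b ℤ.* (j ℤ.* (j ℤ.- 1ℤ))
2*quad a b j = begin
  + 2 ℤ.* + quad a b j
    ≡⟨ cong (λ e → + 2 ℤ.* + e) (quad≡ a b j) ⟩
  + 2 ℤ.* + (a ℕ.* s ℕ.+ b ℕ.* t)
    ≡⟨ cong (+ 2 ℤ.*_) (trans (ℤₚ.pos-+ (a ℕ.* s) (b ℕ.* t)) (cong₂ ℤ._+_ (ℤₚ.pos-* a s) (ℤₚ.pos-* b t))) ⟩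
  + 2 ℤ.* (+ a ℤ.* + s ℤ.+ + b ℤ.* + t)
    ≡⟨ solve 4 (λ a s b t → con (+ 2) :* (a :* s :+ b :* t) := a :* (con (+ 2) :* s) :+ b :* (con (+ 2) :* t)) refl (+ a) (+ s) (+ b) (+ t) ⟩
  + a ℤ.* (+ 2 ℤ.* + s) ℤ.+ + b ℤ.* (+ 2 ℤ.* + t)
    ≡⟨ cong₂ (λ x y → + a ℤ.* x ℤ.+ + b ℤ.* y) (trans (2*tri (1ℤ ℤ.+ j)) (cong ((1ℤ ℤ.+ j) ℤ.*_)
         (solve 1 (λ j → (con 1ℤ :+ j) :- con 1ℤ := j) refl j))) (2*tri j) ⟩
  + a ℤ.* ((1ℤ ℤ.+ j) ℤ.* j) ℤ.+ + b ℤ.* (j ℤ.* (j ℤ.- 1ℤ)) ∎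
  where
  open ≡.≡-Reasoning
  open ℤSolver.+-*-Solver
  s = tri (1ℤ ℤ.+ j)
  t = tri j

-- Theta terms with ∣j∣ at least M vanish modulo q^M, which leaves finitely many.
∣j∣≤quad : ∀ a b j → ℤ.∣ j ∣ ≤ quad (suc a) (suc b) j
∣j∣≤quad a b j@(+ n) rewrite quad≡ (suc a) (suc b) j = ℕₚ.≤-trans (ℕₚ.m≤m+n n (tri (+ n))) (ℕₚ.≤-trans (ℕₚ.m≤m+n _ _) (ℕₚ.m≤m+n _ _))
∣j∣≤quad a b j@(-[1+ n ]) rewrite quad≡ (suc a) (suc b) j = ℕₚ.≤-trans (bound n)
    (ℕₚ.≤-trans (ℕₚ.m≤m+n (tri j) (b ℕ.* tri j)) (ℕₚ.m≤n+m _ (suc a ℕ.* tri (1ℤ ℤ.+ j))))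
  where
  bound : ∀ n → suc n ≤ tri -[1+ n ]
  bound zero    = ℕₚ.≤-refl
  bound (suc n) = ℕₚ.m≤m+n (suc (suc n)) _

quad-zero : ∀ a b → quad a b 0ℤ ≡ 0
quad-zero a b = trans (quad≡ a b 0ℤ) (cong₂ ℕ._+_ (ℕₚ.*-zeroʳ a) (ℕₚ.*-zeroʳ b))

double-injective : ∀ {m n} → + 2 ℤ.* + m ≡ + 2 ℤ.* + n → m ≡ n
double-injective {m} {n} eq = ℤₚ.+-injective (ℤₚ.*-cancelˡ-≡ (+ 2) (+ m) (+ n) eq)

τ : ℕ → ℕ → ℤ → FPS
τ a b j = const (sgn j) * mono (quad a b j)

-- In the limit n = m = 2M, both n - j and m + j must reach M for every j that counts modulo q^M.
2M+j≥M : ∀ {M} j → ℤ.∣ j ∣ ℕ.< M → ∃ λ k → + (M ℕ.+ M) ℤ.+ j ≡ + k × M ≤ k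
2M+j≥M {M} (+ n)    _   = M ℕ.+ M ℕ.+ n , refl , ℕₚ.≤-trans (ℕₚ.m≤m+n M M) (ℕₚ.m≤m+n (M ℕ.+ M) n)
2M+j≥M {M} -[1+ n ] n<M = M ℕ.+ M ℕ.∸ suc n , ℤₚ.⊖-≥ (ℕₚ.≤-trans (ℕₚ.<⇒≤ n<M) (ℕₚ.m≤m+n M M)) ,
  subst (M ≤_) (sym (ℕₚ.+-∸-assoc M (ℕₚ.<⇒≤ n<M))) (ℕₚ.m≤m+n M _)

2M-j≥M : ∀ {M} j → ℤ.∣ j ∣ ℕ.< M → ∃ λ k → + (M ℕ.+ M) ℤ.- j ≡ + k × M ≤ k
2M-j≥M {M} j ∣j∣<M = 2M+j≥M (ℤ.- j) (subst (ℕ._< M) (sym (ℤₚ.∣-i∣≡∣i∣ j)) ∣j∣<M)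

-- The q-Pascal rule (1 - x) + x (1 - y) = 1 - x y, with x = `Pᵤ` and y = `Pᵥ`. `U` and `W` stand
-- for reciprocal q-factorials. The hypotheses carry them as factors because the monomial identities
-- behind them are meaningful only at nonnegative indices, and elsewhere `U` or `W` is zero.
step-algebra : ∀ T T′ Q K U W Pᵤ Pᵥ Z → Q * T′ * U ≈ - (Pᵤ * T * U) → Pᵤ * Pᵥ * (U * W) ≈ Z * (U * W) →
  T * (K * ((1# - Pᵤ) * U) * W) + (- Q) * (T′ * (K * U * ((1# - Pᵥ) * W))) ≈ T * (K * (1# - Z) * U * W)
step-algebra T T′ Q K U W Pᵤ Pᵥ Z hypA hypB = begin
  T * (K * ((1# - Pᵤ) * U) * W) + (- Q) * (T′ * (K * U * ((1# - Pᵥ) * W)))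
    ≈⟨ solve 8 (λ T T′ Q K U W Pᵤ Pᵥ →
         T :* (K :* ((con 1ℤ :- Pᵤ) :* U) :* W) :+ (:- Q) :* (T′ :* (K :* U :* ((con 1ℤ :- Pᵥ) :* W)))
         := T :* (K :* ((con 1ℤ :- Pᵤ) :* U) :* W) :- Q :* T′ :* U :* (K :* ((con 1ℤ :- Pᵥ) :* W))) ≈-refl T T′ Q K U W Pᵤ Pᵥ ⟩
  T * (K * ((1# - Pᵤ) * U) * W) - Q * T′ * U * (K * ((1# - Pᵥ) * W))
    ≈⟨ +-congˡ (-‿cong (*-congʳ hypA)) ⟩
  T * (K * ((1# - Pᵤ) * U) * W) - (- (Pᵤ * T * U)) * (K * ((1# - Pᵥ) * W))
    ≈⟨ solve 6 (λ T K U W Pᵤ Pᵥ →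
         T :* (K :* ((con 1ℤ :- Pᵤ) :* U) :* W) :- (:- (Pᵤ :* T :* U)) :* (K :* ((con 1ℤ :- Pᵥ) :* W))
         := T :* K :* (U :* W) :- T :* K :* (Pᵤ :* Pᵥ :* (U :* W))) ≈-refl T K U W Pᵤ Pᵥ ⟩
  T * K * (U * W) - T * K * (Pᵤ * Pᵥ * (U * W))
    ≈⟨ +-congˡ (-‿cong (*-congˡ hypB)) ⟩
  T * K * (U * W) - T * K * (Z * (U * W))
    ≈⟨ solve 5 (λ T K U W Z → T :* K :* (U :* W) :- T :* K :* (Z :* (U :* W)) := T :* (K :* (con 1ℤ :- Z) :* U :* W)) ≈-refl T K U W Z ⟩
  T * (K * (1# - Z) * U * W) ∎
  where open ≈-Reasoning
        open FPS-Solver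

-- The finite form Π_{k<n} (1 - q^(pk+a)) Π_{k<m} (1 - q^(pk+b)) = Σ_j (-1)^j q^(quad a b j) [n+m choose m+j]
-- in base q^p, p = a + b, is proved by induction on n and m and then n = m → ∞.
module JacobiTriple (a₀ b₀ : ℕ) where
  a = suc a₀
  b = suc b₀
  p = a ℕ.+ b

  T : ℤ → FPS
  T = τ a b

  P : ℕ → FPS
  P k = mono (p ℕ.* k)

  pochₚ : ℕ → FPS
  pochₚ = fprod (fac p p)

  Unit-pochₚ : ∀ n → Unit (pochₚ n)
  Unit-pochₚ n = Unit-fprod n (Unit-fac p (a₀ ℕ.+ b))

  pochₚ-suc : ∀ n → pochₚ (suc n) ≈ pochₚ n * (1# - P (suc n))
  pochₚ-suc n = *-congˡ (≈-trans (fac≈ p p n) (≡⇒≈ (cong (λ e → 1# - mono e) (trans (ℕₚ.+-comm (p ℕ.* n) p) (sym (ℕₚ.*-suc p n))))))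

  -- 1 / (q^p ; q^p)_n, extended by zero to negative n.
  ip : ℤ → FPS
  ip (+ n)    = inv (pochₚ n)
  ip -[1+ n ] = 0#

  -- At u = 0 the factor 1 - P 0 vanishes, in agreement with the extension by zero, so the recursion
  -- of the q-factorial holds on all of ℤ.
  ip-pred : ∀ u → ip (ℤ.- 1ℤ ℤ.+ u) ≈ (1# - P ℤ.∣ u ∣) * ip u
  ip-pred (+ zero) = ≈-sym (≈-trans (*-congʳ (≈-trans (+-congˡ (-‿cong P0≈1)) (-‿inverseʳ 1#))) (zeroˡ _))
    where
    P0≈1 : P 0 ≈ 1#
    P0≈1 = ≈-trans (≡⇒≈ (cong mono (ℕₚ.*-zeroʳ p))) mono-zero
  ip-pred (+ suc n) = *-cancelˡ (Unit-pochₚ n) (begin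
    pochₚ n * inv (pochₚ n)                                 ≈⟨ *-inv (pochₚ n) (Unit-pochₚ n) ⟩
    1#                                                      ≈⟨ *-inv (pochₚ (suc n)) (Unit-pochₚ (suc n)) ⟨
    pochₚ (suc n) * inv (pochₚ (suc n))                     ≈⟨ *-congʳ (pochₚ-suc n) ⟩
    pochₚ n * (1# - P (suc n)) * inv (pochₚ (suc n))        ≈⟨ *-assoc (pochₚ n) _ _ ⟩
    pochₚ n * ((1# - P (suc n)) * inv (pochₚ (suc n)))      ∎)
    where open ≈-Reasoning
  ip-pred -[1+ n ] = ≈-sym (zeroʳ _)

  coefficient : ℕ → ℕ → ℤ → FPS
  coefficient n m j = pochₚ (n ℕ.+ m) * ip (+ n ℤ.- j) * ip (+ m ℤ.+ j)

  X Y : ℕ → FPS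
  X = fprod (fac p a)
  Y = fprod (fac p b)

  -- The factor `ip u * ip w` annihilates both sides when an index is negative; otherwise the
  -- absolute values are the indices themselves and the exponents add.
  P-product : ∀ N u w → u ℤ.+ w ≡ + suc N → P ℤ.∣ u ∣ * P ℤ.∣ w ∣ * (ip u * ip w) ≈ P (suc N) * (ip u * ip w)
  P-product N (+ k) (+ l) eq = *-congʳ (≈-trans (≈-sym (mono-+ (p ℕ.* k) (p ℕ.* l)))
    (≡⇒≈ (cong mono (trans (sym (ℕₚ.*-distribˡ-+ p k l)) (cong (p ℕ.*_) (ℤₚ.+-injective eq))))))
  P-product N -[1+ k ] w eq = ≈-trans (≈-trans (*-congˡ (zeroˡ _)) (zeroʳ _)) (≈-sym (≈-trans (*-congˡ (zeroˡ _)) (zeroʳ _)))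
  P-product N u@(+ _) -[1+ l ] eq = ≈-trans (≈-trans (*-congˡ (zeroʳ _)) (zeroʳ _)) (≈-sym (≈-trans (*-congˡ (zeroʳ _)) (zeroʳ _)))

  shift-term : ∀ e i j u → sgn i ≡ ℤ.- sgn j → (∀ k → u ≡ + k → e ℕ.+ quad a b i ≡ p ℕ.* k ℕ.+ quad a b j) →
               mono e * T i * ip u ≈ - (P ℤ.∣ u ∣ * T j * ip u)
  shift-term e i j -[1+ k ] s eq = ≈-trans (zeroʳ _) (≈-sym (≈-trans (-‿cong (zeroʳ _)) (solve 0 (:- con 0ℤ := con 0ℤ) ≈-refl)))
    where open FPS-Solver
  shift-term e i j (+ k) s eq = ≈-trans (*-congʳ term) (solve 2 (λ x y → (:- x) :* y := :- (x :* y)) ≈-refl (P k * T j) (ip (+ k)))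
    where
    open FPS-Solver
    open ≈-Reasoning
    term : mono e * T i ≈ - (P k * T j)
    term = begin
      mono e * (const (sgn i) * mono (quad a b i))
        ≈⟨ solve 3 (λ x c y → x :* (c :* y) := c :* (x :* y)) ≈-refl (mono e) (const (sgn i)) (mono (quad a b i)) ⟩
      const (sgn i) * (mono e * mono (quad a b i))
        ≈⟨ *-cong (≈-trans (≡⇒≈ (cong const s)) (const-neg (sgn j))) (≈-trans (≈-sym (mono-+ e _))
            (≈-trans (≡⇒≈ (cong mono (eq k refl))) (mono-+ (p ℕ.* k) (quad a b j)))) ⟩
      - const (sgn j) * (P k * mono (quad a b j))
        ≈⟨ solve 3 (λ x c y → (:- c) :* (x :* y) := :- (x :* (c :* y))) ≈-refl (P k) (const (sgn j)) (mono (quad a b j)) ⟩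
      - (P k * T j) ∎

  fac-expand : ∀ r n f → f * fac p r n ≈ f + (- mono (p ℕ.* n ℕ.+ r)) * f
  fac-expand r n f = ≈-trans (*-congˡ (fac≈ p r n)) (solve 2 (λ f x → f :* (con 1ℤ :- x) := f :+ (:- x) :* f) ≈-refl f _)
    where open FPS-Solver

  exponentˣ : ∀ n j k → 1ℤ ℤ.+ + n ℤ.- j ≡ + k →
              (p ℕ.* n ℕ.+ a) ℕ.+ quad a b (ℤ.- 1ℤ ℤ.+ j) ≡ p ℕ.* k ℕ.+ quad a b j
  exponentˣ n j k eq = double-injective (begin
    + 2 ℤ.* + ((p ℕ.* n ℕ.+ a) ℕ.+ quad a b (ℤ.- 1ℤ ℤ.+ j))
      ≡⟨ ℤₚ.*-distribˡ-+ (+ 2) (+ (p ℕ.* n ℕ.+ a)) (+ quad a b (ℤ.- 1ℤ ℤ.+ j)) ⟩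
    + 2 ℤ.* + (p ℕ.* n ℕ.+ a) ℤ.+ + 2 ℤ.* + quad a b (ℤ.- 1ℤ ℤ.+ j)
      ≡⟨ cong₂ (λ x y → + 2 ℤ.* (x ℤ.+ + a) ℤ.+ y) (ℤₚ.pos-* p n) (2*quad a b (ℤ.- 1ℤ ℤ.+ j)) ⟩
    + 2 ℤ.* ((+ a ℤ.+ + b) ℤ.* + n ℤ.+ + a) ℤ.+ (+ a ℤ.* ((1ℤ ℤ.+ (ℤ.- 1ℤ ℤ.+ j)) ℤ.* (ℤ.- 1ℤ ℤ.+ j)) ℤ.+ + b ℤ.*
        ((ℤ.- 1ℤ ℤ.+ j) ℤ.* ((ℤ.- 1ℤ ℤ.+ j) ℤ.- 1ℤ)))
      ≡⟨ solve 4 (λ a b n j → con (+ 2) :* ((a :+ b) :* n :+ a) :+ (a :* ((con 1ℤ :+ (con (ℤ.- 1ℤ) :+ j)) :* (con (ℤ.- 1ℤ) :+ j)) :+ b :*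
          ((con (ℤ.- 1ℤ) :+ j) :* ((con (ℤ.- 1ℤ) :+ j) :- con 1ℤ)))
           := con (+ 2) :* ((a :+ b) :* ((con 1ℤ :+ n) :- j)) :+ (a :* ((con 1ℤ :+ j) :* j) :+ b :* (j :* (j :- con 1ℤ)))) refl (+ a) (+ b) (+ n) j ⟩
    + 2 ℤ.* ((+ a ℤ.+ + b) ℤ.* (1ℤ ℤ.+ + n ℤ.- j)) ℤ.+ (+ a ℤ.* ((1ℤ ℤ.+ j) ℤ.* j) ℤ.+ + b ℤ.* (j ℤ.* (j ℤ.- 1ℤ)))
      ≡⟨ cong₂ (λ x y → + 2 ℤ.* x ℤ.+ y) (trans (cong (+ p ℤ.*_) eq) (sym (ℤₚ.pos-* p k))) (sym (2*quad a b j)) ⟩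
    + 2 ℤ.* + (p ℕ.* k) ℤ.+ + 2 ℤ.* + quad a b j
      ≡⟨ ℤₚ.*-distribˡ-+ (+ 2) (+ (p ℕ.* k)) (+ quad a b j) ⟨
    + 2 ℤ.* + (p ℕ.* k ℕ.+ quad a b j) ∎)
    where open ≡.≡-Reasoning
          open ℤSolver.+-*-Solver

  exponentʸ : ∀ m j k → 1ℤ ℤ.+ + m ℤ.+ j ≡ + k →
              (p ℕ.* m ℕ.+ b) ℕ.+ quad a b (1ℤ ℤ.+ j) ≡ p ℕ.* k ℕ.+ quad a b j
  exponentʸ m j k eq = double-injective (begin
    + 2 ℤ.* + ((p ℕ.* m ℕ.+ b) ℕ.+ quad a b (1ℤ ℤ.+ j))
      ≡⟨ ℤₚ.*-distribˡ-+ (+ 2) (+ (p ℕ.* m ℕ.+ b)) (+ quad a b (1ℤ ℤ.+ j)) ⟩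
    + 2 ℤ.* + (p ℕ.* m ℕ.+ b) ℤ.+ + 2 ℤ.* + quad a b (1ℤ ℤ.+ j)
      ≡⟨ cong₂ (λ x y → + 2 ℤ.* (x ℤ.+ + b) ℤ.+ y) (ℤₚ.pos-* p m) (2*quad a b (1ℤ ℤ.+ j)) ⟩
    + 2 ℤ.* ((+ a ℤ.+ + b) ℤ.* + m ℤ.+ + b) ℤ.+ (+ a ℤ.* ((1ℤ ℤ.+ (1ℤ ℤ.+ j)) ℤ.* (1ℤ ℤ.+ j)) ℤ.+ + b ℤ.* ((1ℤ ℤ.+ j) ℤ.* ((1ℤ ℤ.+ j) ℤ.- 1ℤ)))
      ≡⟨ solve 4 (λ a b m j → con (+ 2) :* ((a :+ b) :* m :+ b) :+ (a :* ((con 1ℤ :+ (con 1ℤ :+ j)) :* (con 1ℤ :+ j)) :+ b :*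
          ((con 1ℤ :+ j) :* ((con 1ℤ :+ j) :- con 1ℤ)))
           := con (+ 2) :* ((a :+ b) :* ((con 1ℤ :+ m) :+ j)) :+ (a :* ((con 1ℤ :+ j) :* j) :+ b :* (j :* (j :- con 1ℤ)))) refl (+ a) (+ b) (+ m) j ⟩
    + 2 ℤ.* ((+ a ℤ.+ + b) ℤ.* (1ℤ ℤ.+ + m ℤ.+ j)) ℤ.+ (+ a ℤ.* ((1ℤ ℤ.+ j) ℤ.* j) ℤ.+ + b ℤ.* (j ℤ.* (j ℤ.- 1ℤ)))
      ≡⟨ cong₂ (λ x y → + 2 ℤ.* x ℤ.+ y) (trans (cong (+ p ℤ.*_) eq) (sym (ℤₚ.pos-* p k))) (sym (2*quad a b j)) ⟩
    + 2 ℤ.* + (p ℕ.* k) ℤ.+ + 2 ℤ.* + quad a b j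
      ≡⟨ ℤₚ.*-distribˡ-+ (+ 2) (+ (p ℕ.* k)) (+ quad a b j) ⟨
    + 2 ℤ.* + (p ℕ.* k ℕ.+ quad a b j) ∎)
    where open ≡.≡-Reasoning
          open ℤSolver.+-*-Solver

  -- Multiplication by the next factor of `X` adds a multiple of the term at j - 1 to the term at j.
  -- Both q-binomials are rewritten over the larger indices `u` and `w`, where `step-algebra`
  -- applies.
  recursionˣ : ∀ n m j →
    T j * coefficient n m j + (- mono (p ℕ.* n ℕ.+ a)) * (T (ℤ.- 1ℤ ℤ.+ j) * coefficient n m (ℤ.- 1ℤ ℤ.+ j))
    ≈ T j * coefficient (suc n) m j
  recursionˣ n m j = ≈-trans
    (+-cong
      (*-congˡ (*-congʳ (*-congˡ (≈-trans (≡⇒≈ (cong ip (solve 2 (λ n j → n :- j := con (ℤ.- 1ℤ) :+ (con 1ℤ :+ n :- j)) refl (+ n) j)))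
          (ip-pred u)))))
      (*-congˡ (*-congˡ (*-cong (*-congˡ (≡⇒≈ (cong ip (solve 2 (λ n j → n :- (con (ℤ.- 1ℤ) :+ j) := con 1ℤ :+ n :- j) refl (+ n) j))))
        (≈-trans (≡⇒≈ (cong ip (solve 2 (λ m j → m :+ (con (ℤ.- 1ℤ) :+ j) := con (ℤ.- 1ℤ) :+ (m :+ j)) refl (+ m) j))) (ip-pred w))))))
    (≈-trans (step-algebra (T j) (T (ℤ.- 1ℤ ℤ.+ j)) (mono (p ℕ.* n ℕ.+ a)) (pochₚ (n ℕ.+ m)) (ip u) (ip w) (P ℤ.∣ u ∣) (P ℤ.∣ w ∣) (P (suc (n ℕ.+ m)))
      (shift-term (p ℕ.* n ℕ.+ a) (ℤ.- 1ℤ ℤ.+ j) j u (sgn-pred j) (exponentˣ n j))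
      (P-product (n ℕ.+ m) u w (solve 3 (λ n m j → con 1ℤ :+ n :- j :+ (m :+ j) := con 1ℤ :+ (n :+ m)) refl (+ n) (+ m) j)))
    (*-congˡ (*-congʳ (*-congʳ (≈-sym (pochₚ-suc (n ℕ.+ m)))))))
    where
    open ℤSolver.+-*-Solver
    u = 1ℤ ℤ.+ + n ℤ.- j
    w = + m ℤ.+ j

  recursionʸ : ∀ n m j →
    T j * coefficient n m j + (- mono (p ℕ.* m ℕ.+ b)) * (T (1ℤ ℤ.+ j) * coefficient n m (1ℤ ℤ.+ j))
    ≈ T j * coefficient n (suc m) j
  recursionʸ n m j = ≈-trans
    (+-cong
      (*-congˡ (≈-trans (swap _ _ _) (*-congʳ (*-congˡ (≈-trans (≡⇒≈ (cong ip
          (solve 2 (λ m j → m :+ j := con (ℤ.- 1ℤ) :+ (con 1ℤ :+ m :+ j)) refl (+ m) j))) (ip-pred w))))))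
      (*-congˡ (*-congˡ (≈-trans (swap _ _ _) (*-cong (*-congˡ (≡⇒≈ (cong ip
          (solve 2 (λ m j → m :+ (con 1ℤ :+ j) := con 1ℤ :+ m :+ j) refl (+ m) j))))
        (≈-trans (≡⇒≈ (cong ip (solve 2 (λ n j → n :- (con 1ℤ :+ j) := con (ℤ.- 1ℤ) :+ (n :- j)) refl (+ n) j))) (ip-pred u)))))))
    (≈-trans (step-algebra (T j) (T (1ℤ ℤ.+ j)) (mono (p ℕ.* m ℕ.+ b)) (pochₚ (n ℕ.+ m)) (ip w) (ip u) (P ℤ.∣ w ∣) (P ℤ.∣ u ∣) (P (suc (n ℕ.+ m)))
      (shift-term (p ℕ.* m ℕ.+ b) (1ℤ ℤ.+ j) j w (sgn-suc j) (exponentʸ m j))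
      (P-product (n ℕ.+ m) w u (solve 3 (λ n m j → con 1ℤ :+ m :+ j :+ (n :- j) := con 1ℤ :+ (n :+ m)) refl (+ n) (+ m) j)))
    (*-congˡ (≈-trans (swap _ _ _) (*-congʳ (*-congʳ (≈-trans (≈-sym (pochₚ-suc (n ℕ.+ m))) (≡⇒≈ (cong pochₚ (sym (ℕₚ.+-suc n m))))))))))
    where
    open ℤSolver.+-*-Solver
    u = + n ℤ.- j
    w = 1ℤ ℤ.+ + m ℤ.+ j
    swap : ∀ x y z → x * y * z ≈ x * z * y
    swap x y z = F.solve 3 (λ x y z → x F.:* y F.:* z F.:= x F.:* z F.:* y) ≈-refl x y z
      where module F = FPS-Solver

  finite-base : HasSum (λ j → T j * coefficient 0 0 j) (1# * 1#)
  finite-base M = record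
    { support = 0ℤ ∷ [] ; unique = [] ∷ [] ; vanish = λ j j∉ → ≈⇒≈[] (vanishes j j∉)
    ; total = ≈⇒≈[] (≈-trans (+-identityʳ _) (*-cong T0≈1 c0≈1)) }
    where
    vanishes : ∀ j → j ∉ 0ℤ ∷ [] → T j * coefficient 0 0 j ≈ 0#
    vanishes (+ zero)  j∉ = contradiction (here refl) j∉
    vanishes (+ suc n) j∉ = ≈-trans (*-congˡ (≈-trans (*-congʳ (zeroʳ _)) (zeroˡ _))) (zeroʳ _)
    vanishes -[1+ n ]  j∉ = ≈-trans (*-congˡ (zeroʳ _)) (zeroʳ _)
    T0≈1 : T 0ℤ ≈ 1#
    T0≈1 = ≈-trans (*-identityˡ _) (≈-trans (≡⇒≈ (cong mono (quad-zero a b))) mono-zero)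
    c0≈1 : coefficient 0 0 0ℤ ≈ 1#
    c0≈1 = ≈-trans (*-cong (≈-trans (*-identityˡ _) i1) i1) (*-identityˡ 1#)
      where
      i1 : inv 1# ≈ 1#
      i1 = ≈-sym (inv-unique Unit-1# (*-identityˡ 1#))

  finite : ∀ n m → HasSum (λ j → T j * coefficient n m j) (X n * Y m)
  finite zero    zero    = finite-base
  finite zero    (suc m) = HasSum-cong (recursionʸ 0 m)
    (≈-trans (≈-sym (fac-expand b m _)) (*-assoc _ _ _))
    (HasSum-+ (finite 0 m) (HasSum-map (additive-* _) (HasSum-reindex (λ j → 1ℤ ℤ.+ j) (λ j → ℤ.- 1ℤ ℤ.+ j) suc-pred pred-suc (finite 0 m))))
    where
    open ℤSolver.+-*-Solver
    suc-pred : ∀ j → 1ℤ ℤ.+ (ℤ.- 1ℤ ℤ.+ j) ≡ j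
    suc-pred = solve 1 (λ j → con 1ℤ :+ (con (ℤ.- 1ℤ) :+ j) := j) refl
    pred-suc : ∀ j → ℤ.- 1ℤ ℤ.+ (1ℤ ℤ.+ j) ≡ j
    pred-suc = solve 1 (λ j → con (ℤ.- 1ℤ) :+ (con 1ℤ :+ j) := j) refl
  finite (suc n) m = HasSum-cong (recursionˣ n m)
    (≈-trans (≈-sym (fac-expand a n _)) (F.solve 3 (λ x y z → x F.:* y F.:* z F.:= x F.:* z F.:* y) ≈-refl (X n) (Y m) _))
    (HasSum-+ (finite n m) (HasSum-map (additive-* _) (HasSum-reindex (λ j → ℤ.- 1ℤ ℤ.+ j) (λ j → 1ℤ ℤ.+ j) pred-suc suc-pred (finite n m))))
    where
    open ℤSolver.+-*-Solver
    module F = FPS-Solver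
    suc-pred : ∀ j → 1ℤ ℤ.+ (ℤ.- 1ℤ ℤ.+ j) ≡ j
    suc-pred = solve 1 (λ j → con 1ℤ :+ (con (ℤ.- 1ℤ) :+ j) := j) refl
    pred-suc : ∀ j → ℤ.- 1ℤ ℤ.+ (1ℤ ℤ.+ j) ≡ j
    pred-suc = solve 1 (λ j → con (ℤ.- 1ℤ) :+ (con 1ℤ :+ j) := j) refl

  ip-limit : ∀ {M} u k → u ≡ + k → M ≤ k → poch p p * ip u ≈[ M ] 1#
  ip-limit {M} u k refl M≤k = ≈[]-trans (*-cong[] (poch-approx (a₀ ℕ.+ b) (a₀ ℕ.+ b) M≤k) ≈[]-refl) (≈⇒≈[] (*-inv (pochₚ k) (Unit-pochₚ k)))

  -- For large ∣j∣ both sides vanish. Otherwise all three q-factorials of the q-binomial agree with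
  -- (q^p ; q^p)_∞ modulo q^M, so the q-binomial tends to the reciprocal of that product, which the
  -- prefactor cancels.
  term-limit : ∀ M j → poch p p * (T j * coefficient (M ℕ.+ M) (M ℕ.+ M) j) ≈[ M ] T j
  term-limit M j with ℕₚ.≤-<-connex M ℤ.∣ j ∣
  ... | inj₁ M≤∣j∣ = ≈[]-trans (*-cong[] ≈[]-refl (*-cong[] Tj≈0 ≈[]-refl)) (≈[]-trans (≈⇒≈[] (≈-trans (*-congˡ (zeroˡ _)) (zeroʳ _))) (≈[]-sym Tj≈0))
    where
    Tj≈0 : T j ≈[ M ] 0#
    Tj≈0 = ≈[]-trans (*-cong[] ≈[]-refl (mono-large (ℕₚ.≤-trans M≤∣j∣ (∣j∣≤quad a₀ b₀ j)))) (≈⇒≈[] (zeroʳ _))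
  ... | inj₂ ∣j∣<M with k , u≡ , M≤k ← 2M-j≥M j ∣j∣<M | l , w≡ , M≤l ← 2M+j≥M j ∣j∣<M = begin
    poch p p * (T j * (pochₚ (N ℕ.+ N) * ip u * ip w))   ≈⟨ *-cong[] ≈[]-refl
        (*-cong[] ≈[]-refl (*-cong[] (*-cong[] (poch-approx (a₀ ℕ.+ b) (a₀ ℕ.+ b) (ℕₚ.≤-trans (ℕₚ.m≤m+n M M) (ℕₚ.m≤m+n N N))) ≈[]-refl) ≈[]-refl)) ⟨
    poch p p * (T j * (poch p p * ip u * ip w))          ≈⟨ ≈⇒≈[] (solve 4
        (λ z t u w → z :* (t :* (z :* u :* w)) := t :* ((z :* u) :* (z :* w))) ≈-refl (poch p p) (T j) (ip u) (ip w)) ⟩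
    T j * ((poch p p * ip u) * (poch p p * ip w))        ≈⟨ *-cong[] ≈[]-refl (*-cong[] (ip-limit u k u≡ M≤k) (ip-limit w l w≡ M≤l)) ⟩
    T j * (1# * 1#)                                      ≈⟨ ≈⇒≈[] (solve 1 (λ t → t :* (con 1ℤ :* con 1ℤ) := t) ≈-refl (T j)) ⟩
    T j                                                  ∎
    where
    open ≈[]-Reasoning M
    open FPS-Solver
    N = M ℕ.+ M
    u = + N ℤ.- j
    w = + N ℤ.+ j

  tripleProduct : HasSum (τ a b) (poch p a * poch p b * poch p p)
  tripleProduct M = HasSum[]-cong (term-limit M)
    (≈[]-trans (*-cong[] ≈[]-refl (*-cong[] (≈[]-sym (poch-approx (a₀ ℕ.+ b) a₀ (ℕₚ.m≤m+n M M)))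
        (≈[]-sym (poch-approx (a₀ ℕ.+ b) b₀ (ℕₚ.m≤m+n M M)))))
      (≈⇒≈[] (*-comm (poch p p) _)))
    (HasSum-map (additive-* (poch p p)) (finite (M ℕ.+ M) (M ℕ.+ M)) M)

open JacobiTriple public using (tripleProduct)

-- The 5-dissection of Euler's product

fprod-+ : ∀ f m n → fprod f (m ℕ.+ n) ≈ fprod f m * fprod (λ k → f (m ℕ.+ k)) n
fprod-+ f m zero    = ≈-trans (≡⇒≈ (cong (fprod f) (ℕₚ.+-identityʳ m))) (≈-sym (*-identityʳ _))
fprod-+ f m (suc n) = ≈-trans (≡⇒≈ (cong (fprod f) (ℕₚ.+-suc m n))) (≈-trans (*-congʳ (fprod-+ f m n)) (*-assoc _ _ _))

fprod-residues : ∀ d n → fprod (fac 1 1) (n ℕ.* d) ≈ fprod (λ r → fprod (fac d (suc r)) n) d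
fprod-residues d zero    = ≈-sym (ones d)
  where
  ones : ∀ k → fprod (λ _ → 1#) k ≈ 1#
  ones zero    = ≈-refl
  ones (suc k) = ≈-trans (*-identityʳ _) (ones k)
fprod-residues d (suc n) = begin
  fprod (fac 1 1) (d ℕ.+ n ℕ.* d)
    ≡⟨ cong (fprod (fac 1 1)) (ℕₚ.+-comm d (n ℕ.* d)) ⟩
  fprod (fac 1 1) (n ℕ.* d ℕ.+ d)
    ≈⟨ fprod-+ (fac 1 1) (n ℕ.* d) d ⟩
  fprod (fac 1 1) (n ℕ.* d) * fprod (λ r → fac 1 1 (n ℕ.* d ℕ.+ r)) d
    ≈⟨ *-cong (fprod-residues d n) (fprod-cong d (λ r → ≈-trans (fac≈ 1 1 _)
        (≈-trans (≡⇒≈ (cong (λ e → 1# - mono e) (exponent r))) (≈-sym (fac≈ d (suc r) n))))) ⟩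
  fprod (λ r → fprod (fac d (suc r)) n) d * fprod (λ r → fac d (suc r) n) d
    ≈⟨ fprod-* (λ r → fprod (fac d (suc r)) n) (λ r → fac d (suc r) n) d ⟨
  fprod (λ r → fprod (fac d (suc r)) (suc n)) d ∎
  where
  open ≈-Reasoning
  exponent : ∀ r → 1 ℕ.* (n ℕ.* d ℕ.+ r) ℕ.+ 1 ≡ d ℕ.* n ℕ.+ suc r
  exponent r = solve 3 (λ n d r → con 1 :* (n :* d :+ r) :+ con 1 := d :* n :+ (con 1 :+ r)) refl n d r
    where open +-*-Solver

fprod-cong[] : ∀ {M f g} n → (∀ k → f k ≈[ M ] g k) → fprod f n ≈[ M ] fprod g n
fprod-cong[] zero    p = ≈[]-refl
fprod-cong[] (suc n) p = *-cong[] (fprod-cong[] n p) (p n)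

E : FPS
E = poch 1 1

-- The factors 1 - q^n are sorted by n modulo d + 1.
E-residues : ∀ d → E ≈ fprod (λ r → poch (suc d) (suc r)) (suc d)
E-residues d = ≈[]⇒≈ λ M → ≈[]-trans (poch-approx 0 0 {M} {M ℕ.* suc d} (ℕₚ.m≤m*n M (suc d))) (≈[]-trans
  (≈⇒≈[] (fprod-residues (suc d) M))
  (fprod-cong[] (suc d) (λ r → ≈[]-sym (poch-approx d r {M} {M} ℕₚ.≤-refl))))

A C E₅ : FPS
A  = poch 5 1 * poch 5 4
C  = poch 5 2 * poch 5 3
E₅ = poch 5 5

Unit-A : Unit A
Unit-A = Unit-* {poch 5 1} {poch 5 4} (Unit-poch 4 0) (Unit-poch 4 3)

Unit-C : Unit C
Unit-C = Unit-* {poch 5 2} {poch 5 3} (Unit-poch 4 1) (Unit-poch 4 2)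

E≈ACE₅ : E ≈ A * C * E₅
E≈ACE₅ = ≈-trans (E-residues 4)
  (solve 5 (λ a b c d e → con 1ℤ :* a :* b :* c :* d :* e := a :* d :* (b :* c) :* e) ≈-refl
    (poch 5 1) (poch 5 2) (poch 5 3) (poch 5 4) (poch 5 5))
  where open FPS-Solver

dil-E : dil E ≈ E₅
dil-E = dil-poch 0 0

-- Euler's pentagonal number theorem: sorted modulo 3, the factors of `E` form the triple product
-- with a = 1 and b = 2.
HasSum-E : HasSum (τ 1 2) E
HasSum-E = HasSum-cong (λ _ → ≈-refl)
  (≈-sym (≈-trans (E-residues 2) (solve 3 (λ a b c → con 1ℤ :* a :* b :* c := a :* b :* c) ≈-refl (poch 3 1) (poch 3 2) (poch 3 3))))
  (tripleProduct 0 1)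
  where open FPS-Solver

-- In Ramanujan's notation `A * E₅` is f(-q, -q⁴), and `C * E₅` below is f(-q², -q³).
HasSum-AE₅ : HasSum (τ 1 4) (A * E₅)
HasSum-AE₅ = tripleProduct 0 3

HasSum-CE₅ : HasSum (τ 2 3) (C * E₅)
HasSum-CE₅ = tripleProduct 1 2

smono : ℤ → ℕ → FPS
smono s e = const s * mono e

smono-* : ∀ s e s′ e′ → smono s e * smono s′ e′ ≈ smono (s ℤ.* s′) (e ℕ.+ e′)
smono-* s e s′ e′ = ≈-trans
  (solve 4 (λ s e s′ e′ → s :* e :* (s′ :* e′) := s :* s′ :* (e :* e′)) ≈-refl (const s) (mono e) (const s′) (mono e′))
  (*-cong (≈-sym (const-* s s′)) (≈-sym (mono-+ e e′)))
  where open FPS-Solver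

smono-≡ : ∀ {s s′ e e′} → s ≡ s′ → e ≡ e′ → smono s e ≈ smono s′ e′
smono-≡ s≡ e≡ = ≡⇒≈ (cong₂ smono s≡ e≡)

smono-sign : ∀ {s s′} e → s ≡ s′ → smono s e ≈ smono s′ e
smono-sign e s≡ = ≡⇒≈ (cong (λ s → smono s e) s≡)

dil-smono : ∀ s e → dil (smono s e) ≈ smono s (e ℕ.* 5)
dil-smono s e = ≈-trans (dil-* (const s) (mono e)) (*-cong (dil-const s) (dil-mono e))

sgn-even : ∀ j k → sgn (j ℤ.+ (k ℤ.+ k)) ≡ sgn j
sgn-even j k = trans (sgn-+ j (k ℤ.+ k)) (trans (cong (sgn j ℤ.*_) (trans (sgn-+ k k) (sgn² k))) (ℤₚ.*-identityʳ (sgn j)))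

sgn-neg : ∀ j → sgn (ℤ.- j) ≡ sgn j
sgn-neg j = trans (cong sgn (solve 1 (λ j → :- j := j :+ (:- j :+ :- j)) refl j)) (sgn-even j (ℤ.- j))
  where open ℤSolver.+-*-Solver

module Five = Residues 5

2*[e*5+r] : ∀ e r x → + 2 ℤ.* + e ≡ x → + 2 ℤ.* + (e ℕ.* 5 ℕ.+ r) ≡ x ℤ.* + 5 ℤ.+ + 2 ℤ.* + r
2*[e*5+r] e r x refl = trans (cong (λ y → + 2 ℤ.* (y ℤ.+ + r)) (ℤₚ.pos-* e 5))
  (solve 2 (λ e r → con (+ 2) :* (e :* con (+ 5) :+ r) := con (+ 2) :* e :* con (+ 5) :+ con (+ 2) :* r) refl (+ e) (+ r))
  where open ℤSolver.+-*-Solver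

2*suc : ∀ e x → + 2 ℤ.* + e ≡ x → + 2 ℤ.* + suc e ≡ + 2 ℤ.+ x
2*suc e x refl = ℤₚ.*-distribˡ-+ (+ 2) 1ℤ (+ e)

module _ where
  open ℤSolver.+-*-Solver

  quadᵖ : ∀ {n} → ℕ → ℕ → Polynomial n → Polynomial n
  quadᵖ a b j = con (+ a) :* ((con 1ℤ :+ j) :* j) :+ con (+ b) :* (j :* (j :- con 1ℤ))

-- For j = 5 m + r the pentagonal exponent j (3 j - 1) / 2 is 5 * residueExponent r m + residueClass r.
residueSign : Fin 5 → ℤ → ℤ
residueSign 0F m = sgn m
residueSign 1F m = ℤ.- sgn m
residueSign 2F m = sgn m
residueSign 3F m = sgn (1ℤ ℤ.+ m)
residueSign 4F m = ℤ.- sgn (1ℤ ℤ.+ m)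

residueExponent : Fin 5 → ℤ → ℕ
residueExponent 0F m = quad 7 8 m
residueExponent 1F m = quad 10 5 m
residueExponent 2F m = suc (quad 13 2 m)
residueExponent 3F m = suc (quad 1 14 (1ℤ ℤ.+ m))
residueExponent 4F m = quad 4 11 (1ℤ ℤ.+ m)

residueClass : Fin 5 → ℕ
residueClass 0F = 0
residueClass 1F = 1
residueClass 2F = 0
residueClass 3F = 2
residueClass 4F = 2

residueClass<5 : ∀ r → residueClass r ℕ.< 5
residueClass<5 0F = s≤s z≤n
residueClass<5 1F = s≤s (s≤s z≤n)
residueClass<5 2F = s≤s z≤n
residueClass<5 3F = s≤s (s≤s (s≤s z≤n))
residueClass<5 4F = s≤s (s≤s (s≤s z≤n))

residue-sign : ∀ r m → sgn (Five.combine (r , m)) ≡ residueSign r m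
residue-sign 0F m = trans (cong sgn (solve 1 (λ m → con 0ℤ :+ m :* con (+ 5) := m :+ (con (+ 2) :* m :+ con (+ 2) :* m)) refl m))
    (sgn-even m (+ 2 ℤ.* m))
  where open ℤSolver.+-*-Solver
residue-sign 1F m = trans (cong sgn (solve 1 (λ m → con 1ℤ :+ m :* con (+ 5) := (con 1ℤ :+ m) :+
    (con (+ 2) :* m :+ con (+ 2) :* m)) refl m)) (trans (sgn-even (1ℤ ℤ.+ m) (+ 2 ℤ.* m)) (sgn-suc m))
  where open ℤSolver.+-*-Solver
residue-sign 2F m = trans (cong sgn (solve 1 (λ m → con (+ 2) :+ m :* con (+ 5) := m :+
    ((con 1ℤ :+ con (+ 2) :* m) :+ (con 1ℤ :+ con (+ 2) :* m))) refl m)) (sgn-even m (1ℤ ℤ.+ + 2 ℤ.* m))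
  where open ℤSolver.+-*-Solver
residue-sign 3F m = trans (cong sgn (solve 1 (λ m → con (+ 3) :+ m :* con (+ 5) := (con 1ℤ :+ m) :+
    ((con 1ℤ :+ con (+ 2) :* m) :+ (con 1ℤ :+ con (+ 2) :* m))) refl m)) (sgn-even (1ℤ ℤ.+ m) (1ℤ ℤ.+ + 2 ℤ.* m))
  where open ℤSolver.+-*-Solver
residue-sign 4F m = trans (cong sgn (solve 1 (λ m → con (+ 4) :+ m :* con (+ 5) := (con 1ℤ :+ (con 1ℤ :+ m)) :+
    ((con 1ℤ :+ con (+ 2) :* m) :+ (con 1ℤ :+ con (+ 2) :* m))) refl m))
        (trans (sgn-even (1ℤ ℤ.+ (1ℤ ℤ.+ m)) (1ℤ ℤ.+ + 2 ℤ.* m)) (sgn-suc (1ℤ ℤ.+ m)))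
  where open ℤSolver.+-*-Solver

residue-exponent : ∀ r m → quad 1 2 (Five.combine (r , m)) ≡ residueExponent r m ℕ.* 5 ℕ.+ residueClass r
residue-exponent r m = double-injective (trans (2*quad 1 2 (Five.combine (r , m))) (sym (go r)))
  where
  open ℤSolver.+-*-Solver
  go : ∀ r → + 2 ℤ.* + (residueExponent r m ℕ.* 5 ℕ.+ residueClass r)
           ≡ 1ℤ ℤ.* ((1ℤ ℤ.+ Five.combine (r , m)) ℤ.* Five.combine (r , m)) ℤ.+ + 2 ℤ.* (Five.combine (r , m) ℤ.* (Five.combine (r , m) ℤ.- 1ℤ))
  go 0F = trans (2*[e*5+r] (quad 7 8 m) 0 _ (2*quad 7 8 m))
    (solve 1 (λ m → quadᵖ 7 8 m :* con (+ 5) :+ con (+ 2) :* con (+ 0) := quadᵖ 1 2 (con (+ 0) :+ m :* con (+ 5))) refl m)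
  go 1F = trans (2*[e*5+r] (quad 10 5 m) 1 _ (2*quad 10 5 m))
    (solve 1 (λ m → quadᵖ 10 5 m :* con (+ 5) :+ con (+ 2) :* con (+ 1) := quadᵖ 1 2 (con (+ 1) :+ m :* con (+ 5))) refl m)
  go 2F = trans (2*[e*5+r] (suc (quad 13 2 m)) 0 _ (2*suc (quad 13 2 m) _ (2*quad 13 2 m)))
    (solve 1 (λ m → (con (+ 2) :+ quadᵖ 13 2 m) :* con (+ 5) :+ con (+ 2) :* con (+ 0) := quadᵖ 1 2 (con (+ 2) :+ m :* con (+ 5))) refl m)
  go 3F = trans (2*[e*5+r] (suc (quad 1 14 (1ℤ ℤ.+ m))) 2 _ (2*suc (quad 1 14 (1ℤ ℤ.+ m)) _ (2*quad 1 14 (1ℤ ℤ.+ m))))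
    (solve 1 (λ m → (con (+ 2) :+ quadᵖ 1 14 (con 1ℤ :+ m)) :* con (+ 5) :+ con (+ 2) :* con (+ 2) := quadᵖ 1 2 (con (+ 3) :+ m :* con (+ 5))) refl m)
  go 4F = trans (2*[e*5+r] (quad 4 11 (1ℤ ℤ.+ m)) 2 _ (2*quad 4 11 (1ℤ ℤ.+ m)))
    (solve 1 (λ m → quadᵖ 4 11 (con 1ℤ :+ m) :* con (+ 5) :+ con (+ 2) :* con (+ 2) := quadᵖ 1 2 (con (+ 4) :+ m :* con (+ 5))) refl m)

sec-residue : ∀ r m → sec (residueClass r) (τ 1 2 (Five.combine (r , m))) ≈ smono (residueSign r m) (residueExponent r m)
sec-residue r m = begin
  sec (residueClass r) (τ 1 2 (Five.combine (r , m)))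
    ≈⟨ sec-cong (residueClass r) (smono-≡ (residue-sign r m) (residue-exponent r m)) ⟩
  sec (residueClass r) (smono (residueSign r m) (residueExponent r m ℕ.* 5 ℕ.+ residueClass r))
    ≈⟨ sec-const-* (residueClass r) (residueSign r m) _ ⟩
  const (residueSign r m) * sec (residueClass r) (mono (residueExponent r m ℕ.* 5 ℕ.+ residueClass r))
    ≈⟨ *-congˡ (sec-mono (residueClass r) (residueExponent r m)) ⟩
  smono (residueSign r m) (residueExponent r m) ∎
  where open ≈-Reasoning

sec-residue-other : ∀ {s} r m → s ℕ.< 5 → ¬ residueClass r ≡ s → sec s (τ 1 2 (Five.combine (r , m))) ≈ 0#
sec-residue-other {s} r m s<5 r≢s = begin
  sec s (τ 1 2 (Five.combine (r , m)))
    ≈⟨ sec-cong s (smono-≡ (residue-sign r m) (residue-exponent r m)) ⟩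
  sec s (smono (residueSign r m) (residueExponent r m ℕ.* 5 ℕ.+ residueClass r))
    ≈⟨ sec-const-* s (residueSign r m) _ ⟩
  const (residueSign r m) * sec s (mono (residueExponent r m ℕ.* 5 ℕ.+ residueClass r))
    ≈⟨ *-congˡ (sec-mono-other (residueExponent r m) (residueClass<5 r) s<5 r≢s) ⟩
  const (residueSign r m) * 0#
    ≈⟨ zeroʳ _ ⟩
  0# ∎
  where open ≈-Reasoning

opaque
  sec-E : ∀ s → ∃ λ (F : Fin 5 → FPS) → (∀ r → HasSum (λ m → sec s (τ 1 2 (Five.combine (r , m)))) (F r)) × sec s E ≈ sumFin F
  sec-E s = HasSum-fibres {f = sec s E} {t = sec s ∘ τ 1 2 ∘ Five.combine}
    (HasSum-reindex {f = sec s E} {t = sec s ∘ τ 1 2} Five.combine Five.divide Five.combine-divide Five.divide-combine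
      (HasSum-map {f = E} (additive-sec s) {τ 1 2} HasSum-E))

sec-E-vanishes : ∀ {s} → s ℕ.< 5 → (∀ r → ¬ residueClass r ≡ s) → sec s E ≈ 0#
sec-E-vanishes {s} s<5 other with F , S , E≈ ← sec-E s = ≈-trans E≈ (zeros F (λ r → HasSum-zero (λ m → sec-residue-other r m s<5 (other r)) (S r)))
  where
  zeros : ∀ {d} (F : Fin d → FPS) → (∀ r → F r ≈ 0#) → sumFin F ≈ 0#
  zeros {zero}  F z = ≈-refl
  zeros {suc d} F z = ≈-trans (+-cong (z Fin.zero) (zeros (F ∘ Fin.suc) (z ∘ Fin.suc))) (+-identityˡ 0#)

-- The pentagonal numbers are congruent to 0, 1 or 2 modulo 5.
sec₃-E : sec 3 E ≈ 0#
sec₃-E = sec-E-vanishes (s≤s (s≤s (s≤s (s≤s z≤n)))) λ { 0F () ; 1F () ; 2F () ; 3F () ; 4F () }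

sec₄-E : sec 4 E ≈ 0#
sec₄-E = sec-E-vanishes ℕₚ.≤-refl λ { 0F () ; 1F () ; 2F () ; 3F () ; 4F () }

HasSum-E₅ : HasSum (λ k → smono (sgn k) (quad 5 10 k)) E₅
HasSum-E₅ = HasSum-cong (λ k → ≈-trans (dil-smono (sgn k) (quad 1 2 k)) (smono-≡ refl (exponent k))) dil-E (HasSum-map additive-dil HasSum-E)
  where
  exponent : ∀ k → quad 1 2 k ℕ.* 5 ≡ quad 5 10 k
  exponent k = double-injective (trans (cong (+ 2 ℤ.*_) (ℤₚ.pos-* (quad 1 2 k) 5)) (trans
    (trans (sym (ℤₚ.*-assoc (+ 2) (+ quad 1 2 k) (+ 5))) (cong (ℤ._* + 5) (2*quad 1 2 k))) (trans
    (solve 1 (λ k → quadᵖ 1 2 k :* con (+ 5) := quadᵖ 5 10 k) refl k) (sym (2*quad 5 10 k)))))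
    where open ℤSolver.+-*-Solver

-- Only j = 5m + 1 contributes, and m ↦ -m turns its series into the negative of the pentagonal
-- series at q⁵.
sec₁-E : sec 1 E ≈ - E₅
sec₁-E with F , S , E≈ ← sec-E 1 = begin
  sec 1 E                                            ≈⟨ E≈ ⟩
  F 0F + (F 1F + (F 2F + (F 3F + (F 4F + 0#))))      ≈⟨ +-cong (z 0F (λ ()))
      (+-cong F1≈ (+-cong (z 2F (λ ())) (+-cong (z 3F (λ ())) (+-congʳ (z 4F (λ ())))))) ⟩
  0# + (- E₅ + (0# + (0# + (0# + 0#))))              ≈⟨ solve 1 (λ e → con 0ℤ :+ (:- e :+ (con 0ℤ :+ (con 0ℤ :+ (con 0ℤ :+ con 0ℤ))))
      := :- e) ≈-refl E₅ ⟩
  - E₅                                               ∎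
  where
  open ≈-Reasoning
  open FPS-Solver
  z : ∀ r → ¬ residueClass r ≡ 1 → F r ≈ 0#
  z r r≢1 = HasSum-zero (λ m → sec-residue-other r m (s≤s (s≤s z≤n)) r≢1) (S r)
  exponent : ∀ m → quad 5 10 (ℤ.- m) ≡ quad 10 5 m
  exponent m = double-injective (trans (2*quad 5 10 (ℤ.- m)) (trans (solve′ m) (sym (2*quad 10 5 m))))
    where
    solve′ = let module Z = ℤSolver.+-*-Solver in Z.solve 1 (λ m → quadᵖ 5 10 (Z.:- m) Z.:= quadᵖ 10 5 m) refl
  F1≈ : F 1F ≈ - E₅
  F1≈ = HasSum-unique (HasSum-cong (sec-residue 1F) ≈-refl (S 1F)) (HasSum-cong
    (λ m → ≈-trans (*-congˡ (smono-≡ (sgn-neg m) (exponent m)))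
      (≈-trans (≈-sym (*-assoc _ _ _)) (*-congʳ (≈-trans (≈-sym (const-* (ℤ.- 1ℤ) (sgn m))) (≡⇒≈ (cong const (ℤₚ.-1*i≡-i (sgn m))))))))
    (≈-trans (*-congʳ (const-neg 1ℤ)) (solve 1 (λ e → (:- con 1ℤ) :* e := :- e) ≈-refl E₅))
    (HasSum-map (additive-* (const (ℤ.- 1ℤ))) (HasSum-reindex ℤ.-_ ℤ.-_ ℤₚ.neg-involutive ℤₚ.neg-involutive HasSum-E₅)))

-- Sums over ℤ² and the quintuple product identity

module Two = Residues 2

-- Sorts the points (m, n) by the parity r of m + n; the new coordinate k satisfies m + n = 2k + r.
parity : Fin 2 × (ℤ × ℤ) → ℤ × ℤ
parity (r , m , k) = m , Two.combine (r , k) ℤ.- m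

unparity : ℤ × ℤ → Fin 2 × (ℤ × ℤ)
unparity (m , n) = proj₁ (Two.divide (n ℤ.+ m)) , m , proj₂ (Two.divide (n ℤ.+ m))

parity-unparity : ∀ x → parity (unparity x) ≡ x
parity-unparity (m , n) = cong (m ,_) (trans (cong (ℤ._- m) (Two.combine-divide (n ℤ.+ m)))
  (solve 2 (λ m n → n :+ m :- m := n) refl m n))
  where open ℤSolver.+-*-Solver

unparity-parity : ∀ x → unparity (parity x) ≡ x
unparity-parity (r , m , k) = cong (λ (s , l) → s , m , l) (trans
  (cong Two.divide (solve 2 (λ m c → c :- m :+ m := c) refl m (Two.combine (r , k)))) (Two.divide-combine (r , k)))
  where open ℤSolver.+-*-Solver

opaque
  HasSum-parity : ∀ {f} {t : ℤ × ℤ → FPS} → HasSum t f →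
    ∃ λ g → ∃ λ h → HasSum (λ x → t (parity (0F , x))) g × HasSum (λ x → t (parity (1F , x))) h × f ≈ g + h
  HasSum-parity {f} {t} S = fst 0F , fst 1F , snd 0F , snd 1F , ≈-trans (proj₂ (proj₂ fibres)) (+-congˡ (+-identityʳ _))
    where
    fibres : ∃ λ (F : Fin 2 → FPS) → (∀ r → HasSum (λ x → t (parity (r , x))) (F r)) × f ≈ sumFin F
    fibres = HasSum-fibres {t = t ∘ parity} (HasSum-reindex {t = t} parity unparity parity-unparity unparity-parity S)
    fst : Fin 2 → FPS
    fst = proj₁ fibres
    snd : ∀ r → HasSum (λ x → t (parity (r , x))) (fst r)
    snd = proj₁ (proj₂ fibres)

record LatticeIso : Set where
  field
    to from : ℤ × ℤ → ℤ × ℤ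
    to-from : ∀ x → to (from x) ≡ x
    from-to : ∀ x → from (to x) ≡ x

HasSum-match : ∀ {f g} {t u : ℤ × ℤ → FPS} ε (φ : LatticeIso) → HasSum t f → HasSum u g →
               (∀ x → t (LatticeIso.to φ x) ≈ const ε * u x) → f ≈ const ε * g
HasSum-match {t = t} {u} ε φ S T t≈u = HasSum-unique {t = t ∘ to} (HasSum-reindex {t = t} to from to-from from-to S)
  (HasSum-cong {t = λ x → const ε * u x} {u = t ∘ to} (λ x → ≈-sym (t≈u x)) ≈-refl (HasSum-map (additive-* (const ε)) {t = u} T))
  where open LatticeIso φ

-- The general term of ε q^o f(-q^a, -q^b) f(-q^c, -q^d).
term : ℤ → ℕ → ℕ → ℕ → ℕ → ℕ → ℤ × ℤ → FPS
term ε o a b c d (m , n) = smono (ε ℤ.* sgn (m ℤ.+ n)) (o ℕ.+ (quad a b m ℕ.+ quad c d n))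

2*exponent : ∀ o a b c d m n → + 2 ℤ.* + (o ℕ.+ (quad a b m ℕ.+ quad c d n)) ≡
  + 2 ℤ.* + o ℤ.+ ((+ a ℤ.* ((1ℤ ℤ.+ m) ℤ.* m) ℤ.+ + b ℤ.* (m ℤ.* (m ℤ.- 1ℤ))) ℤ.+ (+ c ℤ.* ((1ℤ ℤ.+ n) ℤ.* n) ℤ.+ + d ℤ.* (n ℤ.* (n ℤ.- 1ℤ))))
2*exponent o a b c d m n = trans (ℤₚ.*-distribˡ-+ (+ 2) (+ o) (+ quad a b m ℤ.+ + quad c d n)) (cong (λ x → + 2 ℤ.* + o ℤ.+ x)
  (trans (ℤₚ.*-distribˡ-+ (+ 2) (+ quad a b m) (+ quad c d n)) (cong₂ ℤ._+_ (2*quad a b m) (2*quad c d n))))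

HasSum-product : ∀ {f g} {t u : ℤ → FPS} ε o a b c d → HasSum t f → HasSum u g →
  (∀ m → t m ≈ smono (ε ℤ.* sgn m) (o ℕ.+ quad a b m)) → (∀ n → u n ≈ smono (sgn n) (quad c d n)) →
  HasSum (term ε o a b c d) (f * g)
HasSum-product {t = t} {u} ε o a b c d S T t≈ u≈ = HasSum-cong {t = λ (m , n) → t m * u n} (λ (m , n) → ≈-trans (*-cong (t≈ m) (u≈ n))
  (≈-trans (smono-* (ε ℤ.* sgn m) (o ℕ.+ quad a b m) (sgn n) (quad c d n))
      (smono-≡ (trans (ℤₚ.*-assoc ε (sgn m) (sgn n)) (cong (ε ℤ.*_) (sym (sgn-+ m n)))) (ℕₚ.+-assoc o (quad a b m) (quad c d n)))))
  ≈-refl (HasSum-× {t = t} {u = u} S T)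

exponentᵖ : ∀ {n} → ℕ → ℕ → ℕ → ℕ → ℕ → ℤSolver.+-*-Solver.Polynomial n → ℤSolver.+-*-Solver.Polynomial n → ℤSolver.+-*-Solver.Polynomial n
exponentᵖ o a b c d m n = con (+ 2) :* con (+ o) :+ (quadᵖ a b m :+ quadᵖ c d n)
  where open ℤSolver.+-*-Solver

-- Reduces the comparison of two terms to a sign and to an identity of doubled exponents, which is
-- polynomial in the lattice coordinates.
term-match : ∀ δ ε o a b c d ε′ o′ a′ b′ c′ d′ m n m′ n′ →
  ε ℤ.* sgn (m ℤ.+ n) ≡ δ ℤ.* (ε′ ℤ.* sgn (m′ ℤ.+ n′)) →
  + 2 ℤ.* + o ℤ.+ ((+ a ℤ.* ((1ℤ ℤ.+ m) ℤ.* m) ℤ.+ + b ℤ.* (m ℤ.* (m ℤ.- 1ℤ))) ℤ.+ (+ c ℤ.* ((1ℤ ℤ.+ n) ℤ.* n) ℤ.+ + d ℤ.* (n ℤ.* (n ℤ.- 1ℤ)))) ≡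
  + 2 ℤ.* + o′ ℤ.+ ((+ a′ ℤ.* ((1ℤ ℤ.+ m′) ℤ.* m′) ℤ.+ + b′ ℤ.* (m′ ℤ.* (m′ ℤ.- 1ℤ))) ℤ.+
      (+ c′ ℤ.* ((1ℤ ℤ.+ n′) ℤ.* n′) ℤ.+ + d′ ℤ.* (n′ ℤ.* (n′ ℤ.- 1ℤ)))) →
  term ε o a b c d (m , n) ≈ const δ * term ε′ o′ a′ b′ c′ d′ (m′ , n′)
term-match δ ε o a b c d ε′ o′ a′ b′ c′ d′ m n m′ n′ signs exponents = ≈-trans
  (smono-≡ {e = o ℕ.+ (quad a b m ℕ.+ quad c d n)} {e′ = o′ ℕ.+ (quad a′ b′ m′ ℕ.+ quad c′ d′ n′)} signs
      (double-injective (trans (2*exponent o a b c d m n) (trans exponents (sym (2*exponent o′ a′ b′ c′ d′ m′ n′))))))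
  (≈-trans (*-congʳ (const-* δ (ε′ ℤ.* sgn (m′ ℤ.+ n′)))) (*-assoc _ _ _))

-- The halves `lo` and `le′` are not met by `r`; the last hypothesis makes them cancel in `l + l′`.
halves-cancel : ∀ {r l l′ re ro le lo le′ lo′} δ → r ≈ re + ro → l ≈ le + lo → l′ ≈ le′ + lo′ →
  re ≈ const δ * le → ro ≈ const δ * lo′ → le′ ≈ const (ℤ.- 1ℤ) * lo → r ≈ const δ * (l + l′)
halves-cancel {r} {l} {l′} {re} {ro} {le} {lo} {le′} {lo′} δ r≈ l≈ l′≈ p q s = begin
  r                                                ≈⟨ ≈-trans r≈ (+-cong p q) ⟩
  const δ * le + const δ * lo′                     ≈⟨ solve 4 (λ d x y z → d :* x :+ d :* z := d :*
      ((x :+ y) :+ (con (ℤ.- 1ℤ) :* y :+ z))) ≈-refl (const δ) le lo lo′ ⟩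
  const δ * ((le + lo) + (const (ℤ.- 1ℤ) * lo + lo′)) ≈⟨ *-congˡ (+-cong (≈-sym l≈) (≈-trans (+-congʳ (≈-sym s)) (≈-sym l′≈))) ⟩
  const δ * (l + l′)                               ∎
  where open ≈-Reasoning
        open FPS-Solver

module _ where
  open ℤSolver.+-*-Solver

  sgn-same : ∀ i j k → i ≡ j ℤ.+ (k ℤ.+ k) → sgn i ≡ sgn j
  sgn-same i j k eq = trans (cong sgn eq) (sgn-even j k)

  sgn-opposite : ∀ i j k → i ≡ 1ℤ ℤ.+ (j ℤ.+ (k ℤ.+ k)) → sgn i ≡ ℤ.- sgn j
  sgn-opposite i j k eq = trans (cong sgn eq) (trans (sgn-suc (j ℤ.+ (k ℤ.+ k))) (cong ℤ.-_ (sgn-even j k)))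

  -- In the coordinates (m, k) of `parity` the quadratic part 3m² + n² becomes 4 (m² - mk + k²). The
  -- linear part of each map preserves this hexagonal form, and the translations adjust the linear
  -- terms of the exponents.
  evens₁ odds₁ cancelling₁ evens₂ odds₂ cancelling₂ : LatticeIso
  evens₁ = record
    { to = λ (m , y) → y , y ℤ.- m ; from = λ (k , x) → k ℤ.- x , k
    ; to-from = λ (k , x) → cong (k ,_) (solve 2 (λ k x → k :- (k :- x) := x) refl k x)
    ; from-to = λ (m , y) → cong (_, y) (solve 2 (λ m y → y :- (y :- m) := m) refl m y) }
  odds₁ = record
    { to = λ (m , y) → m ℤ.- y , m ; from = λ (k , x) → x , x ℤ.- k
    ; to-from = λ (k , x) → cong (_, x) (solve 2 (λ k x → x :- (x :- k) := k) refl k x)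
    ; from-to = λ (m , y) → cong (m ,_) (solve 2 (λ m y → m :- (m :- y) := y) refl m y) }
  cancelling₁ = record
    { to = λ (m , x) → x ℤ.- m , ℤ.- m ; from = λ (m , y) → ℤ.- y , m ℤ.- y
    ; to-from = λ (m , y) → cong₂ _,_ (solve 2 (λ m y → m :- y :- (:- y) := m) refl m y) (ℤₚ.neg-involutive y)
    ; from-to = λ (m , x) → cong₂ _,_ (ℤₚ.neg-involutive m) (solve 2 (λ m x → x :- m :- (:- m) := x) refl m x) }
  evens₂ = record { to = λ (m , y) → y , m ; from = λ (m , y) → y , m ; to-from = λ _ → refl ; from-to = λ _ → refl }
  odds₂ = record
    { to = λ (m , y) → m ℤ.- y , ℤ.- y ; from = λ (k , x) → k ℤ.- x , ℤ.- x
    ; to-from = λ (k , x) → cong₂ _,_ (solve 2 (λ k x → k :- x :- (:- x) := k) refl k x) (ℤₚ.neg-involutive x)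
    ; from-to = λ (k , x) → cong₂ _,_ (solve 2 (λ k x → k :- x :- (:- x) := k) refl k x) (ℤₚ.neg-involutive x) }
  cancelling₂ = record
    { to = λ (m , x) → 1ℤ ℤ.- m ℤ.+ x , ℤ.- m ; from = λ (m , y) → ℤ.- y , m ℤ.- 1ℤ ℤ.- y
    ; to-from = λ (m , y) → cong₂ _,_ (solve 2 (λ m y → con 1ℤ :- (:- y) :+ (m :- con 1ℤ :- y) := m) refl m y) (ℤₚ.neg-involutive y)
    ; from-to = λ (m , x) → cong₂ _,_ (ℤₚ.neg-involutive m) (solve 2 (λ m x → con 1ℤ :- m :+ x :- con 1ℤ :- (:- m) := x) refl m x) }

  evenᵖ oddᵖ : ∀ {n} → Polynomial n → Polynomial n → Polynomial n
  evenᵖ m k = con 0ℤ :+ k :* con (+ 2) :- m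
  oddᵖ m k = con 1ℤ :+ k :* con (+ 2) :- m

  even odd : ℤ → ℤ → ℤ
  even m k = 0ℤ ℤ.+ k ℤ.* + 2 ℤ.- m
  odd m k = 1ℤ ℤ.+ k ℤ.* + 2 ℤ.- m

  -- All three lattice sums have an exponent of the shape (5/2)(3 m² + n²) + linear. A rotation by ±60° takes the
  -- halves m + n even and m + n odd of the first one to one half of the second and one half of the third;
  -- a further rotation cancels the two remaining halves.
  opaque
    quintuple₁ : ∀ {r l l′} → HasSum (term 1ℤ 0 5 10 2 3) r → HasSum (term 1ℤ 0 7 8 1 4) l → HasSum (term 1ℤ 1 13 2 1 4) l′ →
                 r ≈ const 1ℤ * (l + l′)
    quintuple₁ R L L′
      with re , ro , Re , Ro , r≈ ← HasSum-parity {t = term 1ℤ 0 5 10 2 3} R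
         | le , lo , Le , Lo , l≈ ← HasSum-parity {t = term 1ℤ 0 7 8 1 4} L
         | le′ , lo′ , Le′ , Lo′ , l′≈ ← HasSum-parity {t = term 1ℤ 1 13 2 1 4} L′ =
      halves-cancel 1ℤ r≈ l≈ l′≈
        (HasSum-match 1ℤ evens₁ Re Le λ (m , y) → term-match 1ℤ 1ℤ 0 5 10 2 3 1ℤ 0 7 8 1 4 y (even y (y ℤ.- m)) m (even m y)
          (trans (cong (1ℤ ℤ.*_) (sgn-same _ (m ℤ.+ even m y) (ℤ.- m) (solve 2
              (λ m y → y :+ evenᵖ y (y :- m) := m :+ evenᵖ m y :+ (:- m :+ :- m)) refl m y))) (sym (ℤₚ.*-identityˡ _)))
          (solve 2 (λ m y → exponentᵖ 0 5 10 2 3 y (evenᵖ y (y :- m)) := exponentᵖ 0 7 8 1 4 m (evenᵖ m y)) refl m y))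
        (HasSum-match 1ℤ odds₁ Ro Lo′ λ (m , y) → term-match 1ℤ 1ℤ 0 5 10 2 3 1ℤ 1 13 2 1 4 (m ℤ.- y) (odd (m ℤ.- y) m) m (odd m y)
          (trans (cong (1ℤ ℤ.*_) (sgn-same _ (m ℤ.+ odd m y) (m ℤ.- y)
              (solve 2 (λ m y → m :- y :+ oddᵖ (m :- y) m := m :+ oddᵖ m y :+ (m :- y :+ (m :- y))) refl m y))) (sym (ℤₚ.*-identityˡ _)))
          (solve 2 (λ m y → exponentᵖ 0 5 10 2 3 (m :- y) (oddᵖ (m :- y) m) := exponentᵖ 1 13 2 1 4 m (oddᵖ m y)) refl m y))
        (HasSum-match (ℤ.- 1ℤ) cancelling₁ Le′ Lo λ (m , x) → term-match (ℤ.- 1ℤ) 1ℤ 1 13 2 1 4 1ℤ 0 7 8 1 4 (x ℤ.- m)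
            (even (x ℤ.- m) (ℤ.- m)) m (odd m x)
          (trans (cong (1ℤ ℤ.*_) (sgn-opposite _ (m ℤ.+ odd m x) (ℤ.- (1ℤ ℤ.+ (m ℤ.+ x)))
            (solve 2 (λ m x → x :- m :+ evenᵖ (x :- m) (:- m) := con 1ℤ :+
                (m :+ oddᵖ m x :+ (:- (con 1ℤ :+ (m :+ x)) :+ :- (con 1ℤ :+ (m :+ x))))) refl m x)))
            (solve 1 (λ s → con 1ℤ :* :- s := con (ℤ.- 1ℤ) :* (con 1ℤ :* s)) refl (sgn (m ℤ.+ odd m x))))
          (solve 2 (λ m x → exponentᵖ 1 13 2 1 4 (x :- m) (evenᵖ (x :- m) (:- m)) := exponentᵖ 0 7 8 1 4 m (oddᵖ m x)) refl m x))

    quintuple₂ : ∀ {r l l′} → HasSum (term 1ℤ 0 5 10 1 4) r → HasSum (term (ℤ.- 1ℤ) 0 4 11 2 3) l → HasSum (term 1ℤ 1 1 14 2 3) l′ →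
                 r ≈ const (ℤ.- 1ℤ) * (l + l′)
    quintuple₂ R L L′
      with re , ro , Re , Ro , r≈ ← HasSum-parity {t = term 1ℤ 0 5 10 1 4} R
         | le , lo , Le , Lo , l≈ ← HasSum-parity {t = term (ℤ.- 1ℤ) 0 4 11 2 3} L
         | le′ , lo′ , Le′ , Lo′ , l′≈ ← HasSum-parity {t = term 1ℤ 1 1 14 2 3} L′ =
      -- Here the even half of the third series survives and the two odd halves cancel, so `le′` and
      -- `lo′` change places.
      halves-cancel (ℤ.- 1ℤ) r≈ l≈ (≈-trans l′≈ (+-comm le′ lo′))
        (HasSum-match (ℤ.- 1ℤ) evens₂ Re Le λ (m , y) → term-match (ℤ.- 1ℤ) 1ℤ 0 5 10 1 4 (ℤ.- 1ℤ) 0 4 11 2 3 y (even y m) m (even m y)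
          (trans (cong (1ℤ ℤ.*_) (sgn-same _ (m ℤ.+ even m y) (m ℤ.- y)
              (solve 2 (λ m y → y :+ evenᵖ y m := m :+ evenᵖ m y :+ (m :- y :+ (m :- y))) refl m y)))
            (solve 1 (λ s → con 1ℤ :* s := con (ℤ.- 1ℤ) :* (con (ℤ.- 1ℤ) :* s)) refl (sgn (m ℤ.+ even m y))))
          (solve 2 (λ m y → exponentᵖ 0 5 10 1 4 y (evenᵖ y m) := exponentᵖ 0 4 11 2 3 m (evenᵖ m y)) refl m y))
        (HasSum-match (ℤ.- 1ℤ) odds₂ Ro Le′ λ (m , y) → term-match (ℤ.- 1ℤ) 1ℤ 0 5 10 1 4 1ℤ 1 1 14 2 3 (m ℤ.- y) (odd (m ℤ.- y) (ℤ.- y)) m (even m y)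
          (trans (cong (1ℤ ℤ.*_) (sgn-opposite _ (m ℤ.+ even m y) (ℤ.- (y ℤ.+ y))
              (solve 2 (λ m y → m :- y :+ oddᵖ (m :- y) (:- y) := con 1ℤ :+ (m :+ evenᵖ m y :+ (:- (y :+ y) :+ :- (y :+ y)))) refl m y)))
            (solve 1 (λ s → con 1ℤ :* :- s := con (ℤ.- 1ℤ) :* (con 1ℤ :* s)) refl (sgn (m ℤ.+ even m y))))
          (solve 2 (λ m y → exponentᵖ 0 5 10 1 4 (m :- y) (oddᵖ (m :- y) (:- y)) := exponentᵖ 1 1 14 2 3 m (evenᵖ m y)) refl m y))
        (HasSum-match (ℤ.- 1ℤ) cancelling₂ Lo′ Lo λ (m , x) → term-match (ℤ.- 1ℤ) 1ℤ 1 1 14 2 3 (ℤ.- 1ℤ) 0 4 11 2 3 (1ℤ ℤ.- m ℤ.+ x)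
            (odd (1ℤ ℤ.- m ℤ.+ x) (ℤ.- m)) m (odd m x)
          (trans (cong (1ℤ ℤ.*_) (sgn-same _ (m ℤ.+ odd m x) (ℤ.- (m ℤ.+ x))
            (solve 2 (λ m x → con 1ℤ :- m :+ x :+ oddᵖ (con 1ℤ :- m :+ x) (:- m) := m :+ oddᵖ m x :+ (:- (m :+ x) :+ :- (m :+ x))) refl m x)))
            (solve 1 (λ s → con 1ℤ :* s := con (ℤ.- 1ℤ) :* (con (ℤ.- 1ℤ) :* s)) refl (sgn (m ℤ.+ odd m x))))
          (solve 2 (λ m x → exponentᵖ 1 1 14 2 3 (con 1ℤ :- m :+ x) (oddᵖ (con 1ℤ :- m :+ x) (:- m)) := exponentᵖ 0 4 11 2 3 m (oddᵖ m x)) refl m x))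

HasSum-E₅CE₅ : HasSum (term 1ℤ 0 5 10 2 3) (E₅ * (C * E₅))
HasSum-E₅CE₅ = HasSum-product 1ℤ 0 5 10 2 3 HasSum-E₅ HasSum-CE₅ (λ k → smono-sign (quad 5 10 k) (sym (ℤₚ.*-identityˡ (sgn k)))) (λ _ → ≈-refl)

HasSum-E₅AE₅ : HasSum (term 1ℤ 0 5 10 1 4) (E₅ * (A * E₅))
HasSum-E₅AE₅ = HasSum-product 1ℤ 0 5 10 1 4 HasSum-E₅ HasSum-AE₅ (λ k → smono-sign (quad 5 10 k) (sym (ℤₚ.*-identityˡ (sgn k)))) (λ _ → ≈-refl)

-- This is sec 0 E = E₅ / R. After multiplication by `E₅` both sides consist of products of two
-- theta series, which `quintuple₁` compares.
sec₀-E : sec 0 E * A ≈ E₅ * C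
sec₀-E with F , S , E≈ ← sec-E 0 = *-cancelˡ {E₅} (Unit-poch 4 4) (begin
  E₅ * (sec 0 E * A)
    ≈⟨ *-congˡ (*-congʳ (≈-trans E≈ (+-congˡ (+-cong (z 1F (λ ())) (+-congˡ (+-cong (z 3F (λ ())) (+-congʳ (z 4F (λ ()))))))))) ⟩
  E₅ * ((F 0F + (0# + (F 2F + (0# + (0# + 0#))))) * A)
    ≈⟨ solve 4 (λ e x y a → e :* ((x :+ (con 0ℤ :+ (y :+ (con 0ℤ :+ (con 0ℤ :+ con 0ℤ))))) :* a) := con 1ℤ :*
        (x :* (a :* e) :+ y :* (a :* e))) ≈-refl E₅ (F 0F) (F 2F) A ⟩
  const 1ℤ * (F 0F * (A * E₅) + F 2F * (A * E₅))
    ≈⟨ quintuple₁ HasSum-E₅CE₅ (HasSum-product 1ℤ 0 7 8 1 4 (S 0F) HasSum-AE₅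
        (λ m → ≈-trans (sec-residue 0F m) (smono-sign (quad 7 8 m) (sym (ℤₚ.*-identityˡ (sgn m))))) (λ _ → ≈-refl))
         (HasSum-product 1ℤ 1 13 2 1 4 (S 2F) HasSum-AE₅ (λ m → ≈-trans (sec-residue 2F m)
             (smono-sign (suc (quad 13 2 m)) (sym (ℤₚ.*-identityˡ (sgn m))))) (λ _ → ≈-refl)) ⟨
  E₅ * (C * E₅)
    ≈⟨ *-congˡ (*-comm C E₅) ⟩
  E₅ * (E₅ * C) ∎)
  where
  open ≈-Reasoning
  open FPS-Solver
  z : ∀ r → ¬ residueClass r ≡ 0 → F r ≈ 0#
  z r r≢ = HasSum-zero (λ m → sec-residue-other r m (s≤s z≤n) r≢) (S r)

-- The companion sec 2 E = - E₅ R, obtained in the same way from `quintuple₂`.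
sec₂-E : sec 2 E * C ≈ - (E₅ * A)
sec₂-E with F , S , E≈ ← sec-E 2 = *-cancelˡ {E₅} (Unit-poch 4 4) (begin
  E₅ * (sec 2 E * C)
    ≈⟨ *-congˡ (*-congʳ (≈-trans E≈ (+-cong (z 0F (λ ())) (+-cong (z 1F (λ ())) (+-congʳ (z 2F (λ ()))))))) ⟩
  E₅ * ((0# + (0# + (0# + (F 3F + (F 4F + 0#))))) * C)
    ≈⟨ solve 4 (λ e x y c → e :* ((con 0ℤ :+ (con 0ℤ :+ (con 0ℤ :+ (x :+ (y :+ con 0ℤ))))) :* c) := :-
        (con (ℤ.- 1ℤ) :* (y :* (c :* e) :+ x :* (c :* e)))) ≈-refl E₅ (F 3F) (F 4F) C ⟩
  - (const (ℤ.- 1ℤ) * (F 4F * (C * E₅) + F 3F * (C * E₅)))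
    ≈⟨ -‿cong (quintuple₂ HasSum-E₅AE₅
         (HasSum-product (ℤ.- 1ℤ) 0 4 11 2 3 (shift _ _ (S 4F)) HasSum-CE₅
             (shifted 4F (λ m → ℤ.- 1ℤ ℤ.* sgn m) (quad 4 11) (λ m → sym (ℤₚ.-1*i≡-i _)) (λ m → refl)) (λ _ → ≈-refl))
         (HasSum-product 1ℤ 1 1 14 2 3 (shift _ _ (S 3F)) HasSum-CE₅ (shifted 3F (λ m → 1ℤ ℤ.* sgn m) (λ m → suc (quad 1 14 m))
             (λ m → sym (ℤₚ.*-identityˡ _)) (λ m → refl)) (λ _ → ≈-refl))) ⟨
  - (E₅ * (A * E₅))
    ≈⟨ solve 2 (λ e a → :- (e :* (a :* e)) := e :* (:- (e :* a))) ≈-refl E₅ A ⟩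
  E₅ * (- (E₅ * A)) ∎)
  where
  open ≈-Reasoning
  open FPS-Solver
  z : ∀ r → ¬ residueClass r ≡ 2 → F r ≈ 0#
  z r r≢ = HasSum-zero (λ m → sec-residue-other r m (s≤s (s≤s (s≤s z≤n))) r≢) (S r)
  1-1 : ∀ m → 1ℤ ℤ.+ (m ℤ.- 1ℤ) ≡ m
  1-1 = let module Z = ℤSolver.+-*-Solver in Z.solve 1 (λ m → Z.con 1ℤ Z.:+ (m Z.:- Z.con 1ℤ) Z.:= m) refl
  -1+1 : ∀ m → 1ℤ ℤ.+ m ℤ.- 1ℤ ≡ m
  -1+1 = let module Z = ℤSolver.+-*-Solver in Z.solve 1 (λ m → Z.con 1ℤ Z.:+ m Z.:- Z.con 1ℤ Z.:= m) refl
  -- The classes 3 and 4 are expressed through 1 + m; replacing m by m - 1 brings them to the form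
  -- required by `quintuple₂`.
  shift : ∀ f (t : ℤ → FPS) → HasSum t f → HasSum (λ m → t (m ℤ.- 1ℤ)) f
  shift f t = HasSum-reindex {t = t} (λ m → m ℤ.- 1ℤ) (λ m → 1ℤ ℤ.+ m) -1+1 1-1
  shifted : ∀ r (s : ℤ → ℤ) (e : ℤ → ℕ) → (∀ m → residueSign r m ≡ s (1ℤ ℤ.+ m)) → (∀ m → residueExponent r m ≡ e (1ℤ ℤ.+ m)) →
            ∀ m → sec (residueClass r) (τ 1 2 (Five.combine (r , m ℤ.- 1ℤ))) ≈ smono (s m) (e m)
  shifted r s e s≡ e≡ m = ≈-trans (sec-residue r (m ℤ.- 1ℤ)) (smono-≡ (trans (s≡ _) (cong s (1-1 m))) (trans (e≡ _) (cong e (1-1 m))))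

-- Ramanujan's identities relating R(q) and R(q⁵)

mono-^ : ∀ m k → mono m ^ k ≈ mono (k ℕ.* m)
mono-^ m zero    = ≈-sym mono-zero
mono-^ m (suc k) = ≈-trans (*-congˡ (mono-^ m k)) (≈-sym (mono-+ m (k ℕ.* m)))

sec-mono-vanishes : ∀ n → ¬ n ℕDM.% 5 ≡ 0 → sec 0 (mono n) ≈ 0#
sec-mono-vanishes n n%5≢0 = ≈-trans
  (sec-cong 0 (≡⇒≈ (cong mono (trans (ℕDM.m≡m%n+[m/n]*n n 5) (ℕₚ.+-comm (n ℕDM.% 5) _)))))
  (sec-mono-other (n ℕDM./ 5) (ℕDM.m%n<n n 5) (s≤s z≤n) n%5≢0)

^-distrib-* : ∀ f g k → (f * g) ^ k ≈ f ^ k * g ^ k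
^-distrib-* f g zero    = ≈-sym (*-identityˡ 1#)
^-distrib-* f g (suc k) = ≈-trans (*-congˡ (^-distrib-* f g k))
  (solve 4 (λ a b c d → a :* b :* (c :* d) := a :* c :* (b :* d)) ≈-refl f g (f ^ k) (g ^ k))
  where open FPS-Solver

-- Section 0 of the logarithmic derivative computes that of the norm from ℤ[[q]] to ℤ[[q⁵]].
module _ (t : ℕ) (t-unit : ∀ i → 0 ℕ.< i → i ℕ.< 5 → ¬ (i ℕ.* suc t) ℕDM.% 5 ≡ 0) where

  sec₀-Λ-fac : ∀ k → sec 0 (Λ (fac 5 (suc t) k)) ≈ Λ (fac 5 (suc t) k)
  sec₀-Λ-fac k = ≈-trans (sec-cong 0 Λ-D) (≈-trans (sec-dil-* (s≤s z≤n) (inv D) _) (≈-trans (*-congˡ sec₀-powers) (≈-sym Λ-D′)))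
    where
    open FPS-Solver
    m = 5 ℕ.* k ℕ.+ suc t
    z = mono m
    D = fac 5 (suc t) k
    c = const (ℤ.- (+ m))
    powers = z + (z ^ 2 + (z ^ 3 + (z ^ 4 + z ^ 5)))
    U : Unit D
    U = Unit-fac 5 t k
    D≈ : D ≈ 1# - z
    D≈ = fac≈ 5 (suc t) k
    dil-D : dil D ≈ 1# - z ^ 5
    dil-D = ≈-trans (dil-cong D≈) (≈-trans (dil-+ 1# (- z)) (+-cong (dil-const 1ℤ) (≈-trans (dil-neg z) (-‿cong
      (≈-trans (dil-mono m) (≈-trans (≡⇒≈ (cong mono (ℕₚ.*-comm m 5))) (≈-sym (mono-^ m 5))))))))
    inv-D : inv D ≈ (1# + (z + (z ^ 2 + (z ^ 3 + z ^ 4)))) * dil (inv D)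
    inv-D = ≈-sym (inv-unique U (≈-trans (≈-sym (*-assoc D _ _)) (≈-trans (*-congʳ (≈-trans (*-congʳ D≈) (≈-trans
      (solve 1 (λ z → (con 1ℤ :- z) :* (con 1ℤ :+ (z :+ (z :^ 2 :+ (z :^ 3 :+ z :^ 4)))) := con 1ℤ :- z :^ 5) ≈-refl z)
      (≈-sym dil-D)))) (≈-trans (≈-sym (dil-* D (inv D))) (≈-trans (dil-cong (*-inv D U)) (dil-const 1ℤ))))))
    θ-D : θ D ≈ c * z
    θ-D = ≈-trans (θ-cong D≈) (≈-trans (θ-+ 1# (- z)) (≈-trans (+-cong (θ-const 1ℤ) (≈-trans (θ-neg z) (-‿cong (θ-mono m))))
      (≈-trans (solve 2 (λ c z → con 0ℤ :+ :- (c :* z) := (:- c) :* z) ≈-refl (const (+ m)) z) (*-congʳ (≈-sym (const-neg (+ m)))))))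
    Λ-D : Λ D ≈ dil (inv D) * (c * powers)
    Λ-D = ≈-trans (*-cong θ-D inv-D)
      (solve 3 (λ c z d → c :* z :* ((con 1ℤ :+ (z :+ (z :^ 2 :+ (z :^ 3 :+ z :^ 4)))) :* d)
                        := d :* (c :* (z :+ (z :^ 2 :+ (z :^ 3 :+ (z :^ 4 :+ z :^ 5)))))) ≈-refl c z (dil (inv D)))
    Λ-D′ : Λ D ≈ inv D * (c * z)
    Λ-D′ = ≈-trans (*-congʳ θ-D) (*-comm _ _)
    vanish-power : ∀ i → 0 ℕ.< i → i ℕ.< 5 → sec 0 (z ^ i) ≈ 0#
    vanish-power i 0<i i<5 = ≈-trans (sec-cong 0 (mono-^ m i)) (sec-mono-vanishes (i ℕ.* m) (λ eq → t-unit i 0<i i<5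
      (trans (sym (ℕDM.[m+kn]%n≡m%n (i ℕ.* suc t) (i ℕ.* k) 5)) (trans (cong (ℕDM._% 5) residue) eq))))
      where
      residue : i ℕ.* suc t ℕ.+ i ℕ.* k ℕ.* 5 ≡ i ℕ.* m
      residue = N.solve 3 (λ i t k → i N.:* t N.:+ i N.:* k N.:* N.con 5 N.:= i N.:* (N.con 5 N.:* k N.:+ t)) refl i (suc t) k
        where module N = +-*-Solver
    sec₀-powers : sec 0 (c * powers) ≈ c * z
    sec₀-powers = ≈-trans (sec-const-* 0 _ powers) (*-congˡ (≈-trans (≈-trans (sec-+ 0 z _) (+-cong
        (≈-trans (sec-cong 0 (≈-sym (*-identityʳ z))) (vanish-power 1 (s≤s z≤n) (s≤s (s≤s z≤n))))
        (≈-trans (sec-+ 0 (z ^ 2) _) (+-cong (vanish-power 2 (s≤s z≤n) (s≤s (s≤s (s≤s z≤n))))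
        (≈-trans (sec-+ 0 (z ^ 3) _) (+-cong (vanish-power 3 (s≤s z≤n) (s≤s (s≤s (s≤s (s≤s z≤n)))))
        (≈-trans (sec-+ 0 (z ^ 4) _) (+-cong (vanish-power 4 (s≤s z≤n) ℕₚ.≤-refl)
        (≈-trans (sec-cong 0 (≈-trans (mono-^ m 5) (≡⇒≈ (cong mono (trans (ℕₚ.*-comm 5 m) (sym (ℕₚ.+-identityʳ (m ℕ.* 5))))))))
            (sec-mono 0 m))))))))))
      (solve 1 (λ z → con 0ℤ :+ (con 0ℤ :+ (con 0ℤ :+ (con 0ℤ :+ z))) := z) ≈-refl z)))

  sec₀-Λ-fprod : ∀ n → sec 0 (Λ (fprod (fac 5 (suc t)) n)) ≈ Λ (fprod (fac 5 (suc t)) n)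
  sec₀-Λ-fprod zero    = ≈-trans (sec-cong 0 Λ1≈0) (≈-trans (coeffs (λ n → trans (0#-at _) (sym (0#-at n)))) (≈-sym Λ1≈0))
    where
    Λ1≈0 : Λ 1# ≈ 0#
    Λ1≈0 = ≈-trans (*-congʳ (θ-const 1ℤ)) (zeroˡ _)
  sec₀-Λ-fprod (suc n) = ≈-trans (sec-cong 0 Λ-product) (≈-trans (sec-+ 0 _ _) (≈-trans (+-cong (sec₀-Λ-fprod n) (sec₀-Λ-fac n)) (≈-sym Λ-product)))
    where
    Λ-product : Λ (fprod (fac 5 (suc t)) (suc n)) ≈ Λ (fprod (fac 5 (suc t)) n) + Λ (fac 5 (suc t) n)
    Λ-product = Λ-* {fprod (fac 5 (suc t)) n} (Unit-fprod n (Unit-fac 5 t)) (Unit-fac 5 t n)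

  sec₀-Λ-poch : sec 0 (Λ (poch 5 (suc t))) ≈ Λ (poch 5 (suc t))
  sec₀-Λ-poch = ≈[]⇒≈ λ M → ≈[]-trans (sec-cong[] (approx (M ℕ.* 5 ℕ.+ 0) (M ℕ.* 5 ℕ.+ 0) ℕₚ.≤-refl)) (≈[]-trans
    (≈⇒≈[] (sec₀-Λ-fprod (M ℕ.* 5 ℕ.+ 0))) (≈[]-sym (approx M (M ℕ.* 5 ℕ.+ 0) (ℕₚ.≤-trans (ℕₚ.m≤m*n M 5) (ℕₚ.m≤m+n _ 0)))))
    where
    approx : ∀ M N → M ≤ N → Λ (poch 5 (suc t)) ≈[ M ] Λ (fprod (fac 5 (suc t)) N)
    approx M N M≤N = Λ-cong[] (Unit-poch 4 t) (Unit-fprod N (Unit-fac 5 t)) (poch-approx 4 t M≤N)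

sec₀-Λ-A : sec 0 (Λ A) ≈ Λ A
sec₀-Λ-A = ≈-trans (sec-cong 0 Λ-A) (≈-trans (sec-+ 0 _ _) (≈-trans (+-cong
  (sec₀-Λ-poch 0 (λ { 1 _ _ () ; 2 _ _ () ; 3 _ _ () ; 4 _ _ () ; (suc (suc (suc (suc (suc i))))) _ (s≤s (s≤s (s≤s (s≤s (s≤s ()))))) }))
  (sec₀-Λ-poch 3 (λ { 1 _ _ () ; 2 _ _ () ; 3 _ _ () ; 4 _ _ () ; (suc (suc (suc (suc (suc i))))) _ (s≤s (s≤s (s≤s (s≤s (s≤s ()))))) })))
  (≈-sym Λ-A)))
  where
  Λ-A : Λ A ≈ Λ (poch 5 1) + Λ (poch 5 4)
  Λ-A = Λ-* {poch 5 1} {poch 5 4} (Unit-poch 4 0) (Unit-poch 4 3)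

sec₀-Λ-C : sec 0 (Λ C) ≈ Λ C
sec₀-Λ-C = ≈-trans (sec-cong 0 Λ-C) (≈-trans (sec-+ 0 _ _) (≈-trans (+-cong
  (sec₀-Λ-poch 1 (λ { 1 _ _ () ; 2 _ _ () ; 3 _ _ () ; 4 _ _ () ; (suc (suc (suc (suc (suc i))))) _ (s≤s (s≤s (s≤s (s≤s (s≤s ()))))) }))
  (sec₀-Λ-poch 2 (λ { 1 _ _ () ; 2 _ _ () ; 3 _ _ () ; 4 _ _ () ; (suc (suc (suc (suc (suc i))))) _ (s≤s (s≤s (s≤s (s≤s (s≤s ()))))) })))
  (≈-sym Λ-C)))
  where
  Λ-C : Λ C ≈ Λ (poch 5 2) + Λ (poch 5 3)
  Λ-C = Λ-* {poch 5 2} {poch 5 3} (Unit-poch 4 1) (Unit-poch 4 2)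

Unit-E : Unit E
Unit-E = Unit-poch 0 0

Unit-E₅ : Unit E₅
Unit-E₅ = Unit-poch 4 4

-- The norm of a series in q⁵ is its fifth power.
sec₀-Λ-dil : ∀ {f} → Unit f → sec 0 (Λ (dil f)) ≈ const (+ 5) * Λ f
sec₀-Λ-dil {f} u = ≈-trans (sec-cong 0 (Λ-dil u)) (≈-trans (sec-const-* 0 (+ 5) _) (*-congˡ (sec₀-dil (Λ f))))

-- In terms of norms: the norm of E is E(q⁵)⁶ / E(q²⁵).
sec₀-Λ-E : sec 0 (Λ E) + Λ E₅ ≈ const (+ 6) * Λ E
sec₀-Λ-E = begin
  sec 0 (Λ E) + Λ E₅                                  ≈⟨ +-congʳ (sec-cong 0 Λ-E) ⟩
  sec 0 (Λ A + Λ C + Λ E₅) + Λ E₅                     ≈⟨ +-congʳ (≈-trans (sec-+ 0 _ _)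
      (+-cong (≈-trans (sec-+ 0 _ _) (+-cong sec₀-Λ-A sec₀-Λ-C)) sec₀-Λ-E₅)) ⟩
  Λ A + Λ C + const (+ 5) * Λ E + Λ E₅                ≈⟨ solve 4 (λ a c e x → a :+ c :+ x :+ e := (a :+ c :+ e) :+ x) ≈-refl (Λ A) (Λ C)
      (Λ E₅) (const (+ 5) * Λ E) ⟩
  (Λ A + Λ C + Λ E₅) + const (+ 5) * Λ E              ≈⟨ +-congʳ (≈-sym Λ-E) ⟩
  Λ E + const (+ 5) * Λ E                             ≈⟨ solve 1 (λ e → e :+ con (+ 5) :* e := con (+ 6) :* e) ≈-refl (Λ E) ⟩
  const (+ 6) * Λ E                                   ∎
  where
  open ≈-Reasoning
  open FPS-Solver
  Λ-E : Λ E ≈ Λ A + Λ C + Λ E₅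
  Λ-E = ≈-trans (Λ-cong Unit-E E≈ACE₅) (≈-trans (Λ-* {A * C} {E₅} (Unit-* {A} {C} Unit-A Unit-C) Unit-E₅) (+-congʳ (Λ-* {A} {C} Unit-A Unit-C)))
  sec₀-Λ-E₅ : sec 0 (Λ E₅) ≈ const (+ 5) * Λ E
  sec₀-Λ-E₅ = ≈-trans (sec-cong 0 (Λ-cong Unit-E₅ (≈-sym dil-E))) (sec₀-Λ-dil Unit-E)

-- `ratio` is `R` written with the opaque product; `R≡ratio` identifies the two.
G H ratio : FPS
G = inv A
H = inv C
ratio = A * H

Unit-ratio : Unit ratio
Unit-ratio = Unit-* {A} {H} Unit-A refl

ratio*C : ratio * C ≈ A
ratio*C = ≈-trans (*-assoc A H C) (≈-trans (*-congˡ (≈-trans (*-comm H C) (*-inv C Unit-C))) (*-identityʳ A))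

opaque
  -- The full Rogers–Ramanujan continued fraction, with its factor q^(1/5), at q⁵.
  v : FPS
  v = mono 1 * dil ratio

  v≡ : v ≡ mono 1 * dil ratio
  v≡ = refl

v^ : ∀ j → v ^ j ≈ mono j * dil (ratio ^ j)
v^ j = ≈-trans (^-congˡ j (≡⇒≈ v≡)) (≈-trans (^-distrib-* (mono 1) (dil ratio) j) (*-cong
  (≈-trans (mono-^ 1 j) (≡⇒≈ (cong mono (ℕₚ.*-identityʳ j)))) (≈-sym (dil-^ ratio j))))

sec-v^ : ∀ s j → s ℕ.< 5 → sec s (v ^ j) ≈ ratio ^ j * sec s (mono j)
sec-v^ s j s<5 = ≈-trans (sec-cong s (≈-trans (v^ j) (*-comm _ _))) (sec-dil-* s<5 (ratio ^ j) (mono j))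

-- Polynomials in v and their sections

v-poly : ℕ → List ℤ → FPS
v-poly j []       = 0#
v-poly j (c ∷ cs) = const c * v ^ j + v-poly (suc j) cs

-- v^j is q^j times a series in q⁵, so section `s` keeps the powers with j congruent to `s` modulo
-- 5. On a literal list of coefficients the selection computes.
sec-poly : ℕ → ℕ → List ℤ → FPS
sec-poly s j []       = 0#
sec-poly s j (c ∷ cs) with j ℕDM.% 5 ℕₚ.≟ s
... | yes _ = const c * (ratio ^ j * mono (j ℕDM./ 5)) + sec-poly s (suc j) cs
... | no  _ = sec-poly s (suc j) cs

sec-v-poly : ∀ s j cs → s ℕ.< 5 → sec s (v-poly j cs) ≈ sec-poly s j cs
sec-v-poly s j []       s<5 = coeffs (λ n → trans (0#-at _) (sym (0#-at n)))
sec-v-poly s j (c ∷ cs) s<5 with j ℕDM.% 5 ℕₚ.≟ s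
... | yes j≡s = ≈-trans (sec-+ s _ _) (+-cong (≈-trans (sec-const-* s c _) (*-congˡ (≈-trans (sec-v^ s j s<5) (*-congˡ
    (≈-trans (sec-cong s (≡⇒≈ (cong mono (trans (ℕDM.m≡m%n+[m/n]*n j 5)
        (trans (ℕₚ.+-comm (j ℕDM.% 5) _) (cong (j ℕDM./ 5 ℕ.* 5 ℕ.+_) j≡s)))))) (sec-mono s (j ℕDM./ 5)))))))
    (sec-v-poly s (suc j) cs s<5))
... | no  j≢s = ≈-trans (sec-+ s _ _) (≈-trans (+-cong (≈-trans (sec-const-* s c _) (≈-trans (*-congˡ (≈-trans (sec-v^ s j s<5) (≈-trans (*-congˡ
    (≈-trans (sec-cong s (≡⇒≈ (cong mono (trans (ℕDM.m≡m%n+[m/n]*n j 5) (ℕₚ.+-comm (j ℕDM.% 5) _)))))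
        (sec-mono-other (j ℕDM./ 5) (ℕDM.m%n<n j 5) s<5 j≢s)))
    (zeroʳ _)))) (zeroʳ _))) (sec-v-poly s (suc j) cs s<5)) (+-identityˡ _))

W : FPS
W = 1# - v - v * v

Unit-W : Unit W
Unit-W = trans (at W≈ 0) (trans (+-at 1# _ 0) (cong₂ ℤ._+_ Unit-1# (trans (at (*-congʳ {x = - (1# + v)} (≡⇒≈ v≡)) 0)
    (trans (at (*-assoc (mono 1) (dil ratio) _) 0) (mono-suc-*-zero 0 _)))))
  where
  open FPS-Solver
  W≈ : W ≈ 1# + v * (- (1# + v))
  W≈ = solve 1 (λ v → con 1ℤ :- v :- v :* v := con 1ℤ :+ v :* (:- (con 1ℤ :+ v))) ≈-refl v

-- E(q) = E(q²⁵) (1 / R(q⁵) - q - q² R(q⁵)), multiplied by R(q⁵).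
E*dil-ratio : E * dil ratio ≈ dil E₅ * W
E*dil-ratio = sec-ext λ s s<5 → ≈-trans (sec-cong s (*-comm E (dil ratio))) (≈-trans (sec-dil-* s<5 ratio E) (≈-trans (go s s<5)
  (≈-sym (≈-trans (sec-dil-* s<5 E₅ W) (*-congˡ (≈-trans (sec-cong s W≈poly) (sec-v-poly s 0 (1ℤ ∷ ℤ.- 1ℤ ∷ ℤ.- 1ℤ ∷ []) s<5)))))))
  where
  open FPS-Solver
  W≈poly : W ≈ v-poly 0 (1ℤ ∷ ℤ.- 1ℤ ∷ ℤ.- 1ℤ ∷ [])
  W≈poly = solve 1 (λ v → con 1ℤ :- v :- v :* v := con 1ℤ :* v :^ 0 :+ (con (ℤ.- 1ℤ) :* v :^ 1 :+ (con (ℤ.- 1ℤ) :* v :^ 2 :+ con 0ℤ))) ≈-refl v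
  go : ∀ s → s ℕ.< 5 → ratio * sec s E ≈ E₅ * sec-poly s 0 (1ℤ ∷ ℤ.- 1ℤ ∷ ℤ.- 1ℤ ∷ [])
  go 0 _ = ≈-trans ratio*sec₀ (≈-trans (solve 1 (λ e → e := e :* (con 1ℤ :* (con 1ℤ :* con 1ℤ) :+ con 0ℤ)) ≈-refl E₅)
      (*-congˡ (+-congʳ (*-congˡ (*-congˡ (≈-sym mono-zero))))))
    where
    ratio*sec₀ : ratio * sec 0 E ≈ E₅
    ratio*sec₀ = ≈-trans (solve 3 (λ a h e → a :* h :* e := h :* (e :* a)) ≈-refl A H (sec 0 E)) (≈-trans (*-congˡ sec₀-E) (≈-trans
      (solve 3 (λ h e c → h :* (e :* c) := e :* (c :* h)) ≈-refl H E₅ C) (≈-trans (*-congˡ (*-inv C Unit-C)) (*-identityʳ E₅))))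
  go 1 _ = ≈-trans (*-congˡ sec₁-E) (≈-trans (solve 2 (λ r e → r :* (:- e) := e :*
      (con (ℤ.- 1ℤ) :* (r :^ 1 :* con 1ℤ) :+ con 0ℤ)) ≈-refl ratio E₅) (*-congˡ (+-congʳ (*-congˡ (*-congˡ (≈-sym mono-zero))))))
  go 2 _ = ≈-trans ratio*sec₂ (≈-trans (solve 2 (λ r e → :- (e :* (r :* r)) := e :*
      (con (ℤ.- 1ℤ) :* (r :^ 2 :* con 1ℤ) :+ con 0ℤ)) ≈-refl ratio E₅) (*-congˡ (+-congʳ (*-congˡ (*-congˡ (≈-sym mono-zero))))))
    where
    ratio*sec₂ : ratio * sec 2 E ≈ - (E₅ * (ratio * ratio))
    ratio*sec₂ = *-cancelˡ {C} Unit-C (≈-trans (solve 3 (λ c r e → c :* (r :* e) := r :* (e :* c)) ≈-refl C ratio (sec 2 E))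
        (≈-trans (*-congˡ sec₂-E) (≈-trans
      (*-congˡ (-‿cong (*-congˡ (≈-sym ratio*C)))) (solve 3 (λ c r e → r :* (:- (e :* (r :* c))) := c :* (:- (e :* (r :* r)))) ≈-refl C ratio E₅))))
  go 3 _ = ≈-trans (*-congˡ sec₃-E) (≈-trans (zeroʳ _) (≈-sym (zeroʳ _)))
  go 4 _ = ≈-trans (*-congˡ sec₄-E) (≈-trans (zeroʳ _) (≈-sym (zeroʳ _)))
  go (suc (suc (suc (suc (suc s))))) (s≤s (s≤s (s≤s (s≤s (s≤s ())))))

-- The norm of 1 - v - v² and the identity of degree six

opaque
  -- `y` is q R⁵, and its dilation is v⁵; hence `dil s` is the norm 1 - 11 v⁵ - v¹⁰ of `W`.
  y s : FPS
  y = mono 1 * ratio ^ 5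
  s = 1# - const (+ 11) * y - y * y

  y≡ : y ≡ mono 1 * ratio ^ 5
  y≡ = refl

  s≡ : s ≡ 1# - const (+ 11) * y - y * y
  s≡ = refl

dil-y : dil y ≈ v ^ 5
dil-y = ≈-trans (dil-cong (≡⇒≈ y≡)) (≈-trans (dil-* (mono 1) (ratio ^ 5)) (≈-trans (*-congʳ (dil-mono 1)) (≈-sym (v^ 5))))

-- `N * D` is the product of the four conjugates of `W` other than `W`, split over ℤ into two
-- quartics. The substitution f ↦ v⁴ f(-1/v) takes N to D.
N D : FPS
N = 1# - const (+ 2) * v + const (+ 4) * v ^ 2 - const (+ 3) * v ^ 3 + v ^ 4
D = 1# + const (+ 3) * v + const (+ 4) * v ^ 2 + const (+ 2) * v ^ 3 + v ^ 4

module _ where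
  open FPS-Solver

  Nᵖ Dᵖ Wᵖ : Polynomial 1 → Polynomial 1
  Nᵖ v = con 1ℤ :- con (+ 2) :* v :+ con (+ 4) :* v :^ 2 :- con (+ 3) :* v :^ 3 :+ v :^ 4
  Dᵖ v = con 1ℤ :+ con (+ 3) :* v :+ con (+ 4) :* v :^ 2 :+ con (+ 2) :* v :^ 3 :+ v :^ 4
  Wᵖ v = con 1ℤ :- v :- v :* v

dil-s : dil s ≈ N * D * W
dil-s = begin
  dil s                                              ≈⟨ dil-cong (≡⇒≈ s≡) ⟩
  dil (1# - const (+ 11) * y - y * y)                ≈⟨ ≈-trans (dil-+ _ _)
      (+-cong (≈-trans (dil-+ _ _) (+-cong (dil-const 1ℤ) (≈-trans (dil-neg _) (-‿cong (≈-trans (dil-* _ _) (*-cong (dil-const (+ 11)) dil-y))))))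
                                                          (≈-trans (dil-neg _) (-‿cong (≈-trans (dil-* y y) (*-cong dil-y dil-y))))) ⟩
  1# - const (+ 11) * v ^ 5 - v ^ 5 * v ^ 5          ≈⟨ solve 1 (λ v → con 1ℤ :- con (+ 11) :* v :^ 5 :- v :^ 5 :* v :^ 5
      := Nᵖ v :* Dᵖ v :* Wᵖ v) ≈-refl v ⟩
  N * D * W                                          ∎
  where open ≈-Reasoning
        open FPS-Solver

-- The right-hand side is D² (1 - 11 x - x²) at x = v N / D.
W⁵ : W ^ 5 ≈ D * D - const (+ 11) * (v * (N * D)) - v * v * (N * N)
W⁵ = solve 1 (λ v → Wᵖ v :^ 5 := Dᵖ v :* Dᵖ v :- con (+ 11) :* (v :* (Nᵖ v :* Dᵖ v)) :- v :* v :* (Nᵖ v :* Nᵖ v)) ≈-refl v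
  where open FPS-Solver

Unit-1+v* : ∀ g → Unit (1# + v * g)
Unit-1+v* g = trans (+-at 1# _ 0) (cong₂ ℤ._+_ Unit-1# (trans (at (*-congʳ {x = g} (≡⇒≈ v≡)) 0)
    (trans (at (*-assoc (mono 1) (dil ratio) g) 0) (mono-suc-*-zero 0 _))))

Unit-s : Unit s
Unit-s = trans (at s≈ 0) (trans (+-at 1# _ 0) (cong₂ ℤ._+_ Unit-1# (trans (at (*-assoc (mono 1) (ratio ^ 5) _) 0) (mono-suc-*-zero 0 _))))
  where
  open FPS-Solver
  s≈ : s ≈ 1# + mono 1 * ratio ^ 5 * (- (const (+ 11) + y))
  s≈ = ≈-trans (≡⇒≈ s≡) (≈-trans (solve 1 (λ y → con 1ℤ :- con (+ 11) :* y :- y :* y := con 1ℤ :+ y :* (:- (con (+ 11) :+ y))) ≈-refl y)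
      (+-congˡ (*-congʳ (≡⇒≈ y≡))))

-- This is θ y / y. As `y` dilates to v⁵, its dilation is θ v / v.
κ : FPS
κ = 1# + const (+ 5) * Λ ratio

θ-v : θ v ≈ v * dil κ
θ-v = begin
  θ v                                                        ≈⟨ θ-cong (≡⇒≈ v≡) ⟩
  θ (mono 1 * dil ratio)                                     ≈⟨ θ-* (mono 1) (dil ratio) ⟩
  θ (mono 1) * dil ratio + mono 1 * θ (dil ratio)            ≈⟨ +-cong (*-congʳ (θ-mono 1))
      (*-congˡ (≈-trans (θ≈Λ* {dil ratio} Unit-ratio) (*-congʳ (Λ-dil Unit-ratio)))) ⟩
  const 1ℤ * mono 1 * dil ratio + mono 1 * (const (+ 5) * dil (Λ ratio) * dil ratio)
    ≈⟨ solve 3 (λ m r l → con 1ℤ :* m :* r :+ m :* (con (+ 5) :* l :* r) := m :* r :* (con 1ℤ :+ con (+ 5) :* l)) ≈-refl (mono 1)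
        (dil ratio) (dil (Λ ratio)) ⟩
  mono 1 * dil ratio * (1# + const (+ 5) * dil (Λ ratio))    ≈⟨ *-cong (≡⇒≈ (sym v≡))
      (≈-sym (≈-trans (dil-+ 1# _) (+-cong (dil-const 1ℤ) (≈-trans (dil-* _ _) (*-congʳ (dil-const (+ 5))))))) ⟩
  v * dil κ                                                  ∎
  where open ≈-Reasoning
        open FPS-Solver

θ-y : θ y ≈ y * κ
θ-y = begin
  θ y                                                        ≈⟨ θ-cong (≡⇒≈ y≡) ⟩
  θ (mono 1 * ratio ^ 5)                                     ≈⟨ θ-* (mono 1) (ratio ^ 5) ⟩
  θ (mono 1) * ratio ^ 5 + mono 1 * θ (ratio ^ 5)            ≈⟨ +-cong (*-congʳ (θ-mono 1))
      (*-congˡ (≈-trans (θ≈Λ* (Unit-^ {ratio} 5 Unit-ratio)) (*-congʳ (Λ-^ 5 Unit-ratio)))) ⟩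
  const 1ℤ * mono 1 * ratio ^ 5 + mono 1 * (const (+ 5) * Λ ratio * ratio ^ 5)
    ≈⟨ solve 3 (λ m r l → con 1ℤ :* m :* r :+ m :* (con (+ 5) :* l :* r) := m :* r :* (con 1ℤ :+ con (+ 5) :* l)) ≈-refl (mono 1)
        (ratio ^ 5) (Λ ratio) ⟩
  mono 1 * ratio ^ 5 * κ                                     ≈⟨ *-congʳ (≡⇒≈ (sym y≡)) ⟩
  y * κ                                                      ∎
  where open ≈-Reasoning
        open FPS-Solver

-- With θ v = v κ(q⁵), section 0 of θ W / W keeps exactly the powers v⁵ and v¹⁰ of the numerator over dil s.
sec₀-Λ-W : sec 0 (Λ W) ≈ Λ s
sec₀-Λ-W = begin
  sec 0 (Λ W)                                                ≈⟨ sec-cong 0 Λ-W ⟩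
  sec 0 (dil (- (κ * inv s)) * v-poly 1 cs)                  ≈⟨ sec-dil-* (s≤s z≤n) (- (κ * inv s)) (v-poly 1 cs) ⟩
  - (κ * inv s) * sec 0 (v-poly 1 cs)                        ≈⟨ *-congˡ (sec-v-poly 0 1 cs (s≤s z≤n)) ⟩
  - (κ * inv s) * (const (+ 11) * (ratio ^ 5 * mono 1) + (const (+ 2) * (ratio ^ 10 * mono 2) + 0#))
                                                             ≈⟨ *-congˡ (+-congˡ (+-congʳ (*-congˡ (*-congˡ (mono-+ 1 1))))) ⟩
  - (κ * inv s) * (const (+ 11) * (ratio ^ 5 * mono 1) + (const (+ 2) * (ratio ^ 10 * (mono 1 * mono 1)) + 0#))
    ≈⟨ solve 4 (λ k i r m → :- (k :* i) :* (con (+ 11) :* (r :^ 5 :* m) :+ (con (+ 2) :* (r :^ 10 :* (m :* m)) :+ con 0ℤ))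
                          := :- (con (+ 11) :* (m :* r :^ 5 :* k) :+ con (+ 2) :* (m :* r :^ 5 :* (m :* r :^ 5 :* k))) :* i) ≈-refl κ
                              (inv s) ratio (mono 1) ⟩
  - (const (+ 11) * (mono 1 * ratio ^ 5 * κ) + const (+ 2) * (mono 1 * ratio ^ 5 * (mono 1 * ratio ^ 5 * κ))) * inv s
    ≡⟨ cong (λ y → - (const (+ 11) * (y * κ) + const (+ 2) * (y * (y * κ))) * inv s) (sym y≡) ⟩
  - (const (+ 11) * (y * κ) + const (+ 2) * (y * (y * κ))) * inv s ≈⟨ *-congʳ (≈-sym θ-s) ⟩
  Λ s                                                        ∎
  where
  open ≈-Reasoning
  open FPS-Solver
  -- The coefficients of (1 + 2v) v N D from v¹ to v¹⁰. The entries 11 at v⁵ and 2 at v¹⁰ are those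
  -- of 11 y + 2 y², the numerator in - θ s = (11 y + 2 y²) κ.
  cs : List ℤ
  cs = + 1 ∷ + 3 ∷ + 4 ∷ + 7 ∷ + 11 ∷ + 7 ∷ ℤ.- (+ 4) ∷ + 3 ∷ ℤ.- 1ℤ ∷ + 2 ∷ []
  θ-s : θ s ≈ - (const (+ 11) * (y * κ) + const (+ 2) * (y * (y * κ)))
  θ-s = ≈-trans (θ-cong (≡⇒≈ s≡)) (≈-trans (θ-+ _ _) (≈-trans (+-cong
      (≈-trans (θ-+ _ _) (+-cong (θ-const 1ℤ) (≈-trans (θ-neg _) (-‿cong (≈-trans (θ-* _ y) (+-cong (*-congʳ (θ-const (+ 11))) (*-congˡ θ-y)))))))
      (≈-trans (θ-neg _) (-‿cong (≈-trans (θ-* y y) (+-cong (*-congʳ θ-y) (*-congˡ θ-y))))))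
    (solve 2 (λ y k → con 0ℤ :+ (:- (con 0ℤ :* y :+ con (+ 11) :* (y :* k))) :+ (:- (y :* k :* y :+ y :* (y :* k)))
                    := :- (con (+ 11) :* (y :* k) :+ con (+ 2) :* (y :* (y :* k)))) ≈-refl y κ)))
  θ-W : θ W ≈ - ((1# + const (+ 2) * v) * (v * dil κ))
  θ-W = ≈-trans (θ-+ _ _) (≈-trans (+-cong
      (≈-trans (θ-+ _ _) (+-cong (θ-const 1ℤ) (≈-trans (θ-neg _) (-‿cong θ-v))))
      (≈-trans (θ-neg _) (-‿cong (≈-trans (θ-* v v) (+-cong (*-congʳ θ-v) (*-congˡ θ-v))))))
    (solve 2 (λ v k → con 0ℤ :+ (:- (v :* k)) :+ (:- (v :* k :* v :+ v :* (v :* k))) := :-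
        ((con 1ℤ :+ con (+ 2) :* v) :* (v :* k))) ≈-refl v (dil κ)))
  inv-W : inv W ≈ N * D * dil (inv s)
  inv-W = ≈-sym (inv-unique Unit-W (≈-trans (solve 4 (λ w n d i → w :* (n :* d :* i) := n :* d :* w :* i) ≈-refl W N D (dil (inv s)))
    (≈-trans (*-congʳ (≈-sym dil-s)) (≈-trans (≈-sym (dil-* s (inv s))) (≈-trans (dil-cong (*-inv s Unit-s)) (dil-const 1ℤ))))))
  numerator : (1# + const (+ 2) * v) * v * (N * D) ≈ v-poly 1 cs
  numerator = solve 1 (λ v → (con 1ℤ :+ con (+ 2) :* v) :* v :* (Nᵖ v :* Dᵖ v)
    := con (+ 1) :* v :^ 1 :+ (con (+ 3) :* v :^ 2 :+ (con (+ 4) :* v :^ 3 :+ (con (+ 7) :* v :^ 4 :+ (con (+ 11) :* v :^ 5 :+ (con (+ 7) :* v :^ 6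
       :+ (con (ℤ.- (+ 4)) :* v :^ 7 :+ (con (+ 3) :* v :^ 8 :+ (con (ℤ.- 1ℤ) :* v :^ 9 :+ (con (+ 2) :* v :^ 10 :+ con 0ℤ)))))))))) ≈-refl v
  Λ-W : Λ W ≈ dil (- (κ * inv s)) * v-poly 1 cs
  Λ-W = ≈-trans (*-cong θ-W inv-W) (≈-trans
    (solve 5 (λ u v k nd i → :- (u :* (v :* k)) :* (nd :* i) := :- (k :* i) :* (u :* v :* nd)) ≈-refl (1# + const (+ 2) * v) v (dil κ)
        (N * D) (dil (inv s)))
    (*-cong (≈-sym (≈-trans (dil-neg _) (-‿cong (dil-* κ (inv s))))) numerator))

-- Ramanujan's 1/R⁵ − 11 q − q² R⁵ = E⁶/E₅⁶.
s*E₅⁶ : s * E₅ ^ 6 ≈ ratio ^ 5 * E ^ 6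
s*E₅⁶ = ≈-sym (Λ-injective (Unit-* {ratio ^ 5} {E ^ 6} (Unit-^ {ratio} 5 Unit-ratio) (Unit-^ {E} 6 Unit-E))
    (Unit-* {s} {E₅ ^ 6} Unit-s (Unit-^ {E₅} 6 Unit-E₅)) (begin
  Λ (ratio ^ 5 * E ^ 6)
    ≈⟨ ≈-trans (Λ-* {ratio ^ 5} {E ^ 6} (Unit-^ {ratio} 5 Unit-ratio) (Unit-^ {E} 6 Unit-E)) (+-cong (Λ-^ 5 Unit-ratio) (Λ-^ 6 Unit-E)) ⟩
  const (+ 5) * Λ ratio + const (+ 6) * Λ E
    ≈⟨ +-congˡ sec₀-Λ-E ⟨
  const (+ 5) * Λ ratio + (sec 0 (Λ E) + Λ E₅)
    ≈⟨ solve 3 (λ a b c → a :+ (b :+ c) := b :+ a :+ c) ≈-refl (const (+ 5) * Λ ratio) (sec 0 (Λ E)) (Λ E₅) ⟩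
  sec 0 (Λ E) + const (+ 5) * Λ ratio + Λ E₅
    ≈⟨ +-congʳ sections ⟩
  const (+ 5) * Λ E₅ + Λ s + Λ E₅
    ≈⟨ solve 2 (λ e s → con (+ 5) :* e :+ s :+ e := s :+ con (+ 6) :* e) ≈-refl (Λ E₅) (Λ s) ⟩
  Λ s + const (+ 6) * Λ E₅
    ≈⟨ ≈-trans (Λ-* {s} {E₅ ^ 6} Unit-s (Unit-^ {E₅} 6 Unit-E₅)) (+-congˡ (Λ-^ 6 Unit-E₅)) ⟨
  Λ (s * E₅ ^ 6) ∎))
  where
  open ≈-Reasoning
  open FPS-Solver
  -- The norms of the two sides of `E*dil-ratio`.
  sections : sec 0 (Λ E) + const (+ 5) * Λ ratio ≈ const (+ 5) * Λ E₅ + Λ s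
  sections = begin
    sec 0 (Λ E) + const (+ 5) * Λ ratio          ≈⟨ +-congˡ (sec₀-Λ-dil Unit-ratio) ⟨
    sec 0 (Λ E) + sec 0 (Λ (dil ratio))          ≈⟨ sec-+ 0 _ _ ⟨
    sec 0 (Λ E + Λ (dil ratio))                  ≈⟨ sec-cong 0 (≈-trans (≈-sym (Λ-* {E} {dil ratio} Unit-E Unit-ratio))
        (≈-trans (Λ-cong (Unit-* {E} {dil ratio} Unit-E Unit-ratio) E*dil-ratio) (Λ-* {dil E₅} {W} Unit-E₅ Unit-W))) ⟩
    sec 0 (Λ (dil E₅) + Λ W)                     ≈⟨ sec-+ 0 _ _ ⟩
    sec 0 (Λ (dil E₅)) + sec 0 (Λ W)             ≈⟨ +-cong (sec₀-Λ-dil Unit-E₅) sec₀-Λ-W ⟩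
    const (+ 5) * Λ E₅ + Λ s                     ∎

-- The previous identity, taken at q and at q⁵, is a quadratic equation for q R⁵ over ℤ[v] with the single integral root v N / D.
ratio⁵*D : ratio ^ 5 * D ≈ dil ratio * N
ratio⁵*D = ≈-sym (mono-cancelˡ 1 (≈-trans vN≈yD′ (≈-trans (*-congʳ (≡⇒≈ y≡)) (*-assoc _ _ _))))
  where
  open ≈-Reasoning
  open FPS-Solver
  dil-s*E₂₅⁶ : dil s * dil E₅ ^ 6 ≈ dil ratio ^ 5 * E₅ ^ 6
  dil-s*E₂₅⁶ = ≈-trans (*-congˡ (≈-sym (dil-^ E₅ 6))) (≈-trans (≈-sym (dil-* s (E₅ ^ 6))) (≈-trans (dil-cong s*E₅⁶) (≈-trans (dil-* _ _)
    (*-cong (dil-^ ratio 5) (≈-trans (dil-^ E 6) (^-congˡ 6 dil-E))))))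
  -- The Euler products are eliminated between `s*E₅⁶`, its dilation and the sixth power of
  -- `E*dil-ratio`.
  sextic : s * (v * (N * D)) ≈ y * W ^ 5
  sextic = *-cancelˡ {W} Unit-W (*-cancelˡ {dil E₅ ^ 6} (Unit-^ {dil E₅} 6 Unit-E₅) (begin
    dil E₅ ^ 6 * (W * (s * (v * (N * D))))
      ≈⟨ solve 6 (λ e w s v n d → e :* (w :* (s :* (v :* (n :* d)))) := s :* v :* (n :* d :* w :* e)) ≈-refl (dil E₅ ^ 6) W s v N D ⟩
    s * v * (N * D * W * dil E₅ ^ 6)
      ≈⟨ *-congˡ (≈-trans (*-congʳ (≈-sym dil-s)) dil-s*E₂₅⁶) ⟩
    s * v * (dil ratio ^ 5 * E₅ ^ 6)
      ≈⟨ solve 4 (λ s v r e → s :* v :* (r :* e) := v :* r :* (s :* e)) ≈-refl s v (dil ratio ^ 5) (E₅ ^ 6) ⟩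
    v * dil ratio ^ 5 * (s * E₅ ^ 6)
      ≈⟨ *-cong (*-congʳ (≡⇒≈ v≡)) s*E₅⁶ ⟩
    mono 1 * dil ratio * dil ratio ^ 5 * (ratio ^ 5 * E ^ 6)
      ≈⟨ solve 4 (λ m d r e → m :* d :* d :^ 5 :* (r :* e :^ 6) := m :* r :* (e :* d) :^ 6) ≈-refl (mono 1) (dil ratio) (ratio ^ 5) E ⟩
    mono 1 * ratio ^ 5 * (E * dil ratio) ^ 6
      ≈⟨ *-cong (≡⇒≈ (sym y≡)) (^-congˡ 6 E*dil-ratio) ⟩
    y * (dil E₅ * W) ^ 6
      ≈⟨ solve 3 (λ y e w → y :* (e :* w) :^ 6 := e :^ 6 :* (w :* (y :* w :^ 5))) ≈-refl y (dil E₅) W ⟩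
    dil E₅ ^ 6 * (W * (y * W ^ 5)) ∎))
  -- By `W⁵` the coefficients of `sextic` match those of s at v N / D. The terms with 11 cancel, and
  -- the remaining quadratic in y has the roots v N / D and -D / (v N).
  factored : (D + y * (v * N)) * (v * N - y * D) ≈ 0#
  factored = begin
    (D + y * (v * N)) * (v * N - y * D)
      ≈⟨ solve 4 (λ d y v n → (d :+ y :* (v :* n)) :* (v :* n :- y :* d)
           := (con 1ℤ :- con (+ 11) :* y :- y :* y) :* (v :* (n :* d)) :- y :*
               (d :* d :- con (+ 11) :* (v :* (n :* d)) :- v :* v :* (n :* n))) ≈-refl D y v N ⟩
    (1# - const (+ 11) * y - y * y) * (v * (N * D)) - y * (D * D - const (+ 11) * (v * (N * D)) - v * v * (N * N))
      ≈⟨ +-cong (*-congʳ (≡⇒≈ (sym s≡))) (-‿cong (*-congˡ (≈-sym W⁵))) ⟩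
    s * (v * (N * D)) - y * W ^ 5
      ≈⟨ +-congʳ sextic ⟩
    y * W ^ 5 - y * W ^ 5
      ≈⟨ -‿inverseʳ _ ⟩
    0# ∎
  -- The factor belonging to -D / (v N) has constant term 1, since v has constant term 0; it can be
  -- cancelled.
  Unit-factor : Unit (D + y * (v * N))
  Unit-factor = Unit-≈ (solve 3 (λ v y n → con 1ℤ :+ v :* (con (+ 3) :+ con (+ 4) :* v :+ con (+ 2) :* v :^ 2 :+ v :^ 3 :+ y :* n)
    := con 1ℤ :+ con (+ 3) :* v :+ con (+ 4) :* v :^ 2 :+ con (+ 2) :* v :^ 3 :+ v :^ 4 :+ y :* (v :* n)) ≈-refl v y N) (Unit-1+v* _)
  vN-yD≈0 : v * N - y * D ≈ 0#
  vN-yD≈0 = *-cancelˡ {D + y * (v * N)} Unit-factor (≈-trans factored (≈-sym (zeroʳ _)))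
  vN≈yD′ : mono 1 * (dil ratio * N) ≈ y * D
  vN≈yD′ = ≈-trans (≈-sym (*-assoc _ _ _)) (≈-trans (*-congʳ (≡⇒≈ (sym v≡))) (≈-trans
    (solve 2 (λ a b → a := (a :- b) :+ b) ≈-refl (v * N) (y * D)) (≈-trans (+-congʳ vN-yD≈0) (+-identityˡ _))))

-- The 5-dissection of R⁵

dissection : List ℤ
dissection = + 1 ∷ ℤ.- (+ 5) ∷ + 15 ∷ ℤ.- (+ 30) ∷ + 40 ∷ ℤ.- (+ 36) ∷ + 15 ∷ + 5 ∷ ℤ.- (+ 10) ∷ + 5 ∷ ℤ.- (+ 1) ∷ []

-- Multiplying R⁵ = R(q⁵) N / D by N D W = `dil s` removes D, and the multiplier is a series in q⁵,
-- transparent to sections. The list `dissection` holds the coefficients of N² W.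
ratio⁵-dissection : dil s * ratio ^ 5 ≈ dil ratio * v-poly 0 dissection
ratio⁵-dissection = begin
  dil s * ratio ^ 5               ≈⟨ *-congʳ dil-s ⟩
  N * D * W * ratio ^ 5           ≈⟨ solve 4 (λ n d w r → n :* d :* w :* r := r :* d :* (n :* w)) ≈-refl N D W (ratio ^ 5) ⟩
  ratio ^ 5 * D * (N * W)         ≈⟨ *-congʳ ratio⁵*D ⟩
  dil ratio * N * (N * W)         ≈⟨ ≈-trans (*-assoc _ _ _) (*-congˡ polynomial) ⟩
  dil ratio * v-poly 0 dissection ∎
  where
  open ≈-Reasoning
  open FPS-Solver
  polynomial : N * (N * W) ≈ v-poly 0 dissection
  polynomial = solve 1 (λ v → Nᵖ v :* (Nᵖ v :* Wᵖ v)
    := con (+ 1) :* v :^ 0 :+ (con (ℤ.- (+ 5)) :* v :^ 1 :+ (con (+ 15) :* v :^ 2 :+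
        (con (ℤ.- (+ 30)) :* v :^ 3 :+ (con (+ 40) :* v :^ 4 :+ (con (ℤ.- (+ 36)) :* v :^ 5
       :+ (con (+ 15) :* v :^ 6 :+ (con (+ 5) :* v :^ 7 :+ (con (ℤ.- (+ 10)) :* v :^ 8 :+
           (con (+ 5) :* v :^ 9 :+ (con (ℤ.- (+ 1)) :* v :^ 10 :+ con 0ℤ))))))))))) ≈-refl v

-- A section of `ratio⁵-dissection` leaves the factor R / s. By `s*E₅⁶` this is R⁻⁴ (E₅ / E)⁶ = R⁻⁴
-- (G H)⁶, and R = H / G makes it G¹⁰ H².
sec-ratio⁵ : ∀ t → t ℕ.< 5 → sec t (ratio ^ 5) ≈ sec-poly t 0 dissection * (G ^ 10 * H ^ 2)
sec-ratio⁵ t t<5 = *-cancelˡ {ratio ^ 5 * E ^ 6} (Unit-* {ratio ^ 5} {E ^ 6} (Unit-^ {ratio} 5 Unit-ratio) (Unit-^ {E} 6 Unit-E)) (begin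
  ratio ^ 5 * E ^ 6 * sec t (ratio ^ 5)          ≈⟨ *-congʳ (≈-sym s*E₅⁶) ⟩
  s * E₅ ^ 6 * sec t (ratio ^ 5)                 ≈⟨ solve 3 (λ s e x → s :* e :* x := e :* (s :* x)) ≈-refl s (E₅ ^ 6) (sec t (ratio ^ 5)) ⟩
  E₅ ^ 6 * (s * sec t (ratio ^ 5))               ≈⟨ *-congˡ (sec-dil-* t<5 s (ratio ^ 5)) ⟨
  E₅ ^ 6 * sec t (dil s * ratio ^ 5)             ≈⟨ *-congˡ (≈-trans (sec-cong t ratio⁵-dissection)
      (≈-trans (sec-dil-* t<5 ratio _) (*-congˡ (sec-v-poly t 0 dissection t<5)))) ⟩
  E₅ ^ 6 * (A * H * P)                           ≈⟨ solve 4 (λ e a h p → e :* (a :* h :* p) := con 1ℤ :^ 10 :*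
      (con 1ℤ :^ 6 :* (a :* h :* p :* e))) ≈-refl (E₅ ^ 6) A H P ⟩
  1# ^ 10 * (1# ^ 6 * (A * H * P * E₅ ^ 6))      ≈⟨ *-cong (^-congˡ 10 (≈-sym (*-inv A Unit-A))) (*-congʳ (^-congˡ 6 (≈-sym (*-inv C Unit-C)))) ⟩
  (A * G) ^ 10 * ((C * H) ^ 6 * (A * H * P * E₅ ^ 6))
    ≈⟨ *-cong (^-distrib-* A G 10) (*-congʳ (^-distrib-* C H 6)) ⟩
  A ^ 10 * G ^ 10 * (C ^ 6 * H ^ 6 * (A * H * P * E₅ ^ 6))
    ≈⟨ solve 6 (λ a g c h p e → a :^ 10 :* g :* (c :* h :^ 6 :* (a :* h :* p :* e)) := (a :* h) :^ 5 :* (a :^ 6 :* c :* e) :*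
        (p :* (g :* h :^ 2))) ≈-refl A (G ^ 10) (C ^ 6) H P (E₅ ^ 6) ⟩
  ratio ^ 5 * (A ^ 6 * C ^ 6 * E₅ ^ 6) * (P * (G ^ 10 * H ^ 2))
    ≈⟨ *-congʳ (*-congˡ (≈-sym (≈-trans (^-congˡ 6 E≈ACE₅) (≈-trans (^-distrib-* (A * C) E₅ 6) (*-congʳ (^-distrib-* A C 6)))))) ⟩
  ratio ^ 5 * E ^ 6 * (P * (G ^ 10 * H ^ 2))     ∎)
  where
  open ≈-Reasoning
  open FPS-Solver
  P = sec-poly t 0 dissection

-- Positivity

NonNeg Positive : FPS → Set
NonNeg f = ∀ n → 0ℤ ℤ.≤ f n
Positive f = ∀ n → 0ℤ ℤ.< f n

NonNeg-≈ : ∀ {f g} → f ≈ g → NonNeg f → NonNeg g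
NonNeg-≈ p nf n = subst (0ℤ ℤ.≤_) (at p n) (nf n)

Positive-≈ : ∀ {f g} → f ≈ g → Positive f → Positive g
Positive-≈ p pf n = subst (0ℤ ℤ.<_) (at p n) (pf n)

0≤*0≤ : ∀ {i j} → 0ℤ ℤ.≤ i → 0ℤ ℤ.≤ j → 0ℤ ℤ.≤ i ℤ.* j
0≤*0≤ {+ m} {+ n} _ _ = subst (0ℤ ℤ.≤_) (ℤₚ.pos-* m n) (ℤ.+≤+ z≤n)

NonNeg-+ : ∀ {f g} → NonNeg f → NonNeg g → NonNeg (f + g)
NonNeg-+ {f} {g} nf ng n = subst (0ℤ ℤ.≤_) (sym (+-at f g n)) (ℤₚ.+-mono-≤ (nf n) (ng n))

*-at-nonneg : ∀ n f g → (∀ i → i ≤ n → 0ℤ ℤ.≤ f i) → (∀ i → i ≤ n → 0ℤ ℤ.≤ g i) → 0ℤ ℤ.≤ (f * g) n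
*-at-nonneg zero f g nf ng = subst (0ℤ ℤ.≤_) (sym (*-at-zero f g)) (0≤*0≤ (nf 0 z≤n) (ng 0 z≤n))
*-at-nonneg (suc n) f g nf ng = subst (0ℤ ℤ.≤_) (sym (*-at-suc f g n)) (ℤₚ.+-mono-≤
  (0≤*0≤ (nf 0 z≤n) (ng (suc n) ℕₚ.≤-refl))
  (*-at-nonneg n (tail f) g (λ i i≤n → nf (suc i) (s≤s i≤n)) (λ i i≤n → ng i (ℕₚ.m≤n⇒m≤1+n i≤n))))

NonNeg-* : ∀ {f g} → NonNeg f → NonNeg g → NonNeg (f * g)
NonNeg-* {f} {g} nf ng n = *-at-nonneg n f g (λ i _ → nf i) (λ i _ → ng i)

NonNeg-const : ∀ c → NonNeg (const (+ c))
NonNeg-const c zero    = subst (0ℤ ℤ.≤_) (sym (const-at-zero (+ c))) (ℤ.+≤+ z≤n)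
NonNeg-const c (suc n) = subst (0ℤ ℤ.≤_) (sym (const-at-suc (+ c) n)) ℤₚ.≤-refl

NonNeg-mono : ∀ m → NonNeg (mono m)
NonNeg-mono zero    zero    = ℤ.+≤+ z≤n
NonNeg-mono zero    (suc n) = ℤ.+≤+ z≤n
NonNeg-mono (suc m) zero    = ℤ.+≤+ z≤n
NonNeg-mono (suc m) (suc n) = NonNeg-mono m n

NonNeg-^ : ∀ {f} k → NonNeg f → NonNeg (f ^ k)
NonNeg-^ zero    nf = NonNeg-const 1
NonNeg-^ {f} (suc k) nf = NonNeg-* {f} {f ^ k} nf (NonNeg-^ k nf)

NonNeg-fprod : ∀ {f} n → (∀ k → NonNeg (f k)) → NonNeg (fprod f n)
NonNeg-fprod zero    nf = NonNeg-const 1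
NonNeg-fprod {f} (suc n) nf = NonNeg-* {fprod f n} {f n} (NonNeg-fprod n nf) (nf n)

Positive-+ : ∀ {f g} → Positive f → NonNeg g → Positive (f + g)
Positive-+ {f} {g} pf ng n = subst (0ℤ ℤ.<_) (sym (+-at f g n)) (ℤₚ.+-mono-<-≤ (pf n) (ng n))

Positive⇒NonNeg : ∀ {f} → Positive f → NonNeg f
Positive⇒NonNeg pf n = ℤₚ.<⇒≤ (pf n)

-- The constant term of `g` contributes the coefficient of `f` itself; the other terms of the
-- convolution are nonnegative.
Positive-* : ∀ {f g} → Positive f → NonNeg g → Unit g → Positive (f * g)
Positive-* {f} {g} pf ng ug n = subst (0ℤ ℤ.<_) (at (*-comm g f) n) (go n)
  where
  leading : ∀ n → g 0 ℤ.* f n ≡ f n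
  leading n = trans (cong (ℤ._* f n) ug) (ℤₚ.*-identityˡ (f n))
  go : ∀ n → 0ℤ ℤ.< (g * f) n
  go zero    = subst (0ℤ ℤ.<_) (sym (trans (*-at-zero g f) (leading 0))) (pf 0)
  go (suc n) = subst (0ℤ ℤ.<_) (sym (trans (*-at-suc g f n) (cong (ℤ._+ (tail g * f) n) (leading (suc n)))))
    (ℤₚ.+-mono-<-≤ (pf (suc n)) (NonNeg-* {tail g} {f} (λ i → ng (suc i)) (Positive⇒NonNeg pf) n))

const-*-positive : ∀ c {f} → Positive f → Positive (const (+ suc c) * f)
const-*-positive c {f} pf n = subst (0ℤ ℤ.<_) (sym (const-*-at (+ suc c) f n)) (go (f n) (pf n))
  where
  go : ∀ i → 0ℤ ℤ.< i → 0ℤ ℤ.< + suc c ℤ.* i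
  go i 0<i = subst (ℤ._< + suc c ℤ.* i) (ℤₚ.*-zeroʳ (+ suc c)) (ℤₚ.*-monoˡ-<-pos (+ suc c) 0<i)

geometric : ∀ d r k → inv (fac d (suc r) k) ≈ 1# + mono (d ℕ.* k ℕ.+ suc r) * inv (fac d (suc r) k)
geometric d r k = ≈-sym (begin
  1# + z * g               ≈⟨ +-congʳ (≈-sym (*-inv (fac d (suc r) k) (Unit-fac d r k))) ⟩
  fac d (suc r) k * g + z * g ≈⟨ +-congʳ (*-congʳ (fac≈ d (suc r) k)) ⟩
  (1# - z) * g + z * g     ≈⟨ solve 2 (λ z g → (con 1ℤ :- z) :* g :+ z :* g := g) ≈-refl z g ⟩
  g                        ∎)
  where
  open ≈-Reasoning
  open FPS-Solver
  z = mono (d ℕ.* k ℕ.+ suc r)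
  g = inv (fac d (suc r) k)

-- In the recursion `geometric` the monomial has positive degree, so each coefficient refers to
-- earlier ones only.
NonNeg-inv-fac : ∀ d r k → NonNeg (inv (fac d (suc r) k))
NonNeg-inv-fac d r k = <-rec (λ n → 0ℤ ℤ.≤ g n) step
  where
  g = inv (fac d (suc r) k)
  step : ∀ n → (∀ {i} → i ℕ.< n → 0ℤ ℤ.≤ g i) → 0ℤ ℤ.≤ g n
  step zero    _  = ℤ.+≤+ z≤n
  step (suc n) ih = subst (0ℤ ℤ.≤_) (sym (trans (at (geometric d r k) (suc n)) (+-at 1# _ (suc n))))
    (ℤₚ.+-mono-≤ (NonNeg-const 1 (suc n)) (subst (λ e → 0ℤ ℤ.≤ (mono e * g) (suc n)) (sym (ℕₚ.+-suc (d ℕ.* k) r))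
      (subst (0ℤ ℤ.≤_) (sym (mono-suc-*-suc _ g n)) (*-at-nonneg n (mono (d ℕ.* k ℕ.+ r)) g (λ i _ → NonNeg-mono (d ℕ.* k ℕ.+ r) i)
          (λ i i≤n → ih (s≤s i≤n))))))

-- The factor is 1 - q, and the recursion copies each coefficient to the next.
Positive-geometric : Positive (inv (fac 5 1 0))
Positive-geometric zero    = ℤ.+<+ (s≤s z≤n)
Positive-geometric (suc n) = subst (0ℤ ℤ.<_) (sym (trans (at (geometric 5 0 0) (suc n)) (trans (+-at 1# _ (suc n))
  (trans (cong₂ ℤ._+_ (const-at-suc 1ℤ n) (trans (mono-suc-*-suc 0 g n) (at (≈-trans (*-congʳ mono-zero) (*-identityˡ g)) n)))
      (ℤₚ.+-identityˡ (g n))))))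
  (Positive-geometric n)
  where g = inv (fac 5 1 0)

-- Comparison of the products G and H

gₖ hₖ : ℕ → FPS
gₖ k = inv (fac 5 1 k) * inv (fac 5 4 k)
hₖ k = inv (fac 5 2 k) * inv (fac 5 3 k)

Gₙ Hₙ : ℕ → FPS
Gₙ = fprod gₖ
Hₙ = fprod hₖ

inv-pair-approx : ∀ r t {M n} → M ≤ n → inv (poch 5 (suc r) * poch 5 (suc t)) ≈[ M ] fprod (λ k → inv (fac 5 (suc r) k) * inv (fac 5 (suc t) k)) n
inv-pair-approx r t {M} {n} M≤n = begin
  inv (poch 5 (suc r) * poch 5 (suc t))                       ≈⟨ ≈⇒≈[] (inv-* {poch 5 (suc r)} {poch 5 (suc t)} (Unit-poch 4 r) (Unit-poch 4 t)) ⟩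
  inv (poch 5 (suc r)) * inv (poch 5 (suc t))                 ≈⟨ *-cong[] (approx r) (approx t) ⟩
  fprod (inv ∘ fac 5 (suc r)) n * fprod (inv ∘ fac 5 (suc t)) n ≈⟨ ≈⇒≈[] (fprod-* (inv ∘ fac 5 (suc r)) (inv ∘ fac 5 (suc t)) n) ⟨
  fprod (λ k → inv (fac 5 (suc r) k) * inv (fac 5 (suc t) k)) n ∎
  where
  open ≈[]-Reasoning M
  approx : ∀ r → inv (poch 5 (suc r)) ≈[ M ] fprod (inv ∘ fac 5 (suc r)) n
  approx r = ≈[]-trans (inv-cong[] (Unit-poch 4 r) (Unit-fprod n (Unit-fac 5 r)) (poch-approx 4 r M≤n)) (≈⇒≈[] (inv-fprod n (Unit-fac 5 r)))

G-approx : ∀ {M n} → M ≤ n → G ≈[ M ] Gₙ n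
G-approx = inv-pair-approx 0 3

H-approx : ∀ {M n} → M ≤ n → H ≈[ M ] Hₙ n
H-approx = inv-pair-approx 1 2

NonNeg-gₖ : ∀ k → NonNeg (gₖ k)
NonNeg-gₖ k = NonNeg-* {inv (fac 5 1 k)} {inv (fac 5 4 k)} (NonNeg-inv-fac 5 0 k) (NonNeg-inv-fac 5 3 k)

NonNeg-hₖ : ∀ k → NonNeg (hₖ k)
NonNeg-hₖ k = NonNeg-* {inv (fac 5 2 k)} {inv (fac 5 3 k)} (NonNeg-inv-fac 5 1 k) (NonNeg-inv-fac 5 2 k)

-- `α` = 1 / (1 - q) and `α₄` = 1 / (1 - q⁴) are the two parts of the factor k = 0 of `G`.
q p₁ p₂ α α₄ : FPS
q  = mono 1
p₁ = 1# - q
p₂ = 1# - q ^ 2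
α  = inv (fac 5 1 0)
α₄ = inv (fac 5 4 0)

p₁α : p₁ * α ≈ 1#
p₁α = ≈-trans (*-congʳ (≈-sym (fac≈ 5 1 0))) (*-inv (fac 5 1 0) (Unit-fac 5 0 0))

q⁴ : (1# - q ^ 4) * α₄ ≈ 1#
q⁴ = ≈-trans (*-congʳ (≈-trans (+-congˡ (-‿cong (mono-^ 1 4))) (≈-sym (fac≈ 5 4 0)))) (*-inv (fac 5 4 0) (Unit-fac 5 3 0))

p₂β : p₂ * inv (fac 5 2 0) ≈ 1#
p₂β = ≈-trans (*-congʳ (≈-trans (+-congˡ (-‿cong (mono-^ 1 2))) (≈-sym (fac≈ 5 2 0)))) (*-inv (fac 5 2 0) (Unit-fac 5 1 0))

-- With x = q^(5k), (1 - xq²)(1 - xq³) - (1 - xq)(1 - xq⁴) = x (q - q² - q³ + q⁴) = x q (1 - q)(1 -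
-- q²).
gₖ-hₖ : ∀ k → gₖ k ≈ hₖ k + p₁ * p₂ * (mono (5 ℕ.* k ℕ.+ 1) * (gₖ k * hₖ k))
gₖ-hₖ k = begin
  a′ * b′                                                   ≈⟨ solve 2 (λ a b → a :* b := a :* b :* (con 1ℤ :* con 1ℤ)) ≈-refl a′ b′ ⟩
  a′ * b′ * (1# * 1#)                                       ≈⟨ *-congˡ (*-cong (≈-sym (inverse 1)) (≈-sym (inverse 2))) ⟩
  a′ * b′ * (F 2 * c′ * (F 3 * d′))                         ≈⟨ solve 6
      (λ a b c d c′ d′ → a :* b :* (c :* c′ :* (d :* d′)) := a :* b :* (c′ :* d′) :* (c :* d)) ≈-refl a′ b′ (F 2) (F 3) c′ d′ ⟩
  a′ * b′ * (c′ * d′) * (F 2 * F 3)                         ≈⟨ *-congˡ difference ⟩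
  a′ * b′ * (c′ * d′) * (F 1 * F 4 + p₁ * p₂ * (x * q))     ≈⟨ solve 8
      (λ a b c d e f p z → a :* b :* (c :* d) :* (e :* f :+ p :* z) := (e :* a) :* (f :* b) :* (c :* d) :+ p :*
          (z :* (a :* b :* (c :* d)))) ≈-refl a′ b′ c′ d′ (F 1) (F 4) (p₁ * p₂) (x * q) ⟩
  F 1 * a′ * (F 4 * b′) * (c′ * d′) + p₁ * p₂ * (x * q * (a′ * b′ * (c′ * d′)))
    ≈⟨ +-cong (≈-trans (*-congʳ (≈-trans (*-cong (inverse 0) (inverse 3)) (*-identityˡ 1#))) (*-identityˡ _))
        (*-congˡ (*-congʳ (≈-sym (mono-+ (5 ℕ.* k) 1)))) ⟩
  c′ * d′ + p₁ * p₂ * (mono (5 ℕ.* k ℕ.+ 1) * (gₖ k * hₖ k)) ∎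
  where
  open ≈-Reasoning
  open FPS-Solver
  x = mono (5 ℕ.* k)
  F : ℕ → FPS
  F r = fac 5 r k
  a′ = inv (F 1)
  b′ = inv (F 4)
  c′ = inv (F 2)
  d′ = inv (F 3)
  inverse : ∀ r → F (suc r) * inv (F (suc r)) ≈ 1#
  inverse r = *-inv (F (suc r)) (Unit-fac 5 r k)
  F≈ : ∀ r → F r ≈ 1# - x * q ^ r
  F≈ r = ≈-trans (fac≈ 5 r k) (+-congˡ (-‿cong (≈-trans (mono-+ (5 ℕ.* k) r)
      (*-congˡ (≈-sym (≈-trans (mono-^ 1 r) (≡⇒≈ (cong mono (ℕₚ.*-identityʳ r)))))))))
  difference : F 2 * F 3 ≈ F 1 * F 4 + p₁ * p₂ * (x * q)
  difference = ≈-trans (*-cong (F≈ 2) (F≈ 3)) (≈-trans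
    (solve 2 (λ x q → (con 1ℤ :- x :* q :^ 2) :* (con 1ℤ :- x :* q :^ 3)
      := (con 1ℤ :- x :* q :^ 1) :* (con 1ℤ :- x :* q :^ 4) :+ (con 1ℤ :- q) :* (con 1ℤ :- q :^ 2) :* (x :* q)) ≈-refl x q)
    (+-congʳ (*-cong (≈-sym (F≈ 1)) (≈-sym (F≈ 4)))))

-- The factor 1 - q cancels against the factor k = 0 of the product, which is present because the
-- length is `suc n`. In the same way 1 - q² cancels in `NonNeg-p₂H`.
NonNeg-p₁G : ∀ n → NonNeg (p₁ * Gₙ (suc n))
NonNeg-p₁G zero = NonNeg-≈ (≈-sym (≈-trans (solve 3 (λ p a b → p :* (con 1ℤ :* (a :* b)) := p :* a :* b) ≈-refl p₁ α α₄)
    (≈-trans (*-congʳ p₁α) (*-identityˡ α₄)))) (NonNeg-inv-fac 5 3 0)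
  where open FPS-Solver
NonNeg-p₁G (suc n) = NonNeg-≈ (*-assoc p₁ (Gₙ (suc n)) (gₖ (suc n))) (NonNeg-* {p₁ * Gₙ (suc n)} (NonNeg-p₁G n) (NonNeg-gₖ (suc n)))

NonNeg-p₂H : ∀ n → NonNeg (p₂ * Hₙ (suc n))
NonNeg-p₂H zero = NonNeg-≈ (≈-sym (≈-trans (solve 3 (λ p a b → p :* (con 1ℤ :* (a :* b)) := p :* a :* b) ≈-refl p₂ (inv (fac 5 2 0))
    (inv (fac 5 3 0))) (≈-trans (*-congʳ p₂β) (*-identityˡ _)))) (NonNeg-inv-fac 5 2 0)
  where open FPS-Solver
NonNeg-p₂H (suc n) = NonNeg-≈ (*-assoc p₂ (Hₙ (suc n)) (hₖ (suc n))) (NonNeg-* {p₂ * Hₙ (suc n)} (NonNeg-p₂H n) (NonNeg-hₖ (suc n)))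

-- The contribution of k = 0 stays explicit as q α α₄ H, since `class₁-expand` needs its exact
-- value; nonnegativity is enough for the remainder `J`.
G-H-excess : ∀ n → ∃ λ J → NonNeg J × Gₙ (suc n) ≈ Hₙ (suc n) + p₁ * p₂ * (q * (α * α₄) * Hₙ (suc n) + J)
G-H-excess zero = 0# , NonNeg-const 0 , (≈-trans (*-identityˡ (gₖ 0)) (≈-trans (gₖ-hₖ 0)
  (solve 4 (λ h p z g → h :+ p :* (z :* (g :* h)) := con 1ℤ :* h :+ p :* (z :* g :* (con 1ℤ :* h) :+ con 0ℤ)) ≈-refl (hₖ 0) (p₁ * p₂) q (gₖ 0))))
  where open FPS-Solver
G-H-excess (suc n) with J , nJ , G≈ ← G-H-excess n = J′ , nJ′ , G≈′
  where
  open FPS-Solver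
  g = gₖ (suc n)
  h = hₖ (suc n)
  z = mono (5 ℕ.* suc n ℕ.+ 1)
  Hn = Hₙ (suc n)
  J′ : FPS
  -- The last summand is the cross term of the old difference and the new one. It has a second
  -- factor p₁ p₂: p₁ cancels α, and p₂ stays with `Hn`, where `NonNeg-p₂H` applies.
  J′ = z * (Hn * (g * h)) + J * g + q * z * α₄ * (p₂ * Hn) * (g * h)
  nz : NonNeg z
  nz = NonNeg-mono (5 ℕ.* suc n ℕ.+ 1)
  ngh : NonNeg (g * h)
  ngh = NonNeg-* {g} {h} (NonNeg-gₖ (suc n)) (NonNeg-hₖ (suc n))
  nJ′ : NonNeg J′
  nJ′ = NonNeg-+ {z * (Hn * (g * h)) + J * g}
    (NonNeg-+ {z * (Hn * (g * h))} (NonNeg-* {z} nz (NonNeg-* {Hn} (NonNeg-fprod (suc n) NonNeg-hₖ) ngh)) (NonNeg-* {J} nJ (NonNeg-gₖ (suc n))))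
    (NonNeg-* {q * z * α₄ * (p₂ * Hn)} (NonNeg-* {q * z * α₄} (NonNeg-* {q * z} (NonNeg-* {q} (NonNeg-mono 1) nz) (NonNeg-inv-fac 5 3 0))
        (NonNeg-p₂H n)) ngh)
  g≈ : g ≈ h + p₁ * p₂ * (z * (g * h))
  g≈ = gₖ-hₖ (suc n)
  open ≈-Reasoning
  G≈′ : Gₙ (suc n) * g ≈ Hn * h + p₁ * p₂ * (q * (α * α₄) * (Hn * h) + J′)
  G≈′ = begin
    Gₙ (suc n) * g
      ≈⟨ *-congʳ G≈ ⟩
    (Hn + p₁ * p₂ * (q * (α * α₄) * Hn + J)) * g
      ≈⟨ solve 6 (λ H p x J g h → (H :+ p :* (x :* H :+ J)) :* g := (H :+ p :* x :* H) :* g :+ p :* (J :* g)) ≈-refl Hn (p₁ * p₂)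
          (q * (α * α₄)) J g h ⟩
    (Hn + p₁ * p₂ * (q * (α * α₄)) * Hn) * g + p₁ * p₂ * (J * g)
      ≈⟨ +-congʳ (*-congˡ g≈) ⟩
    (Hn + p₁ * p₂ * (q * (α * α₄)) * Hn) * (h + p₁ * p₂ * (z * (g * h))) + p₁ * p₂ * (J * g)
      ≈⟨ solve 10 (λ H p₁ p₂ q α α₄ J g h z →
           (H :+ p₁ :* p₂ :* (q :* (α :* α₄)) :* H) :* (h :+ p₁ :* p₂ :* (z :* (g :* h))) :+ p₁ :* p₂ :* (J :* g)
           := H :* h :+ p₁ :* p₂ :* (q :* (α :* α₄) :* (H :* h) :+ (z :* (H :* (g :* h)) :+ J :* g :+ (p₁ :* α) :*
               (q :* z :* α₄ :* (p₂ :* H) :* (g :* h)))))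
           ≈-refl Hn p₁ p₂ q α α₄ J g h z ⟩
    Hn * h + p₁ * p₂ * (q * (α * α₄) * (Hn * h) + (z * (Hn * (g * h)) + J * g + p₁ * α * (q * z * α₄ * (p₂ * Hn) * (g * h))))
      ≈⟨ +-congˡ (*-congˡ (+-congˡ (+-congˡ (≈-trans (*-congʳ p₁α) (*-identityˡ _))))) ⟩
    Hn * h + p₁ * p₂ * (q * (α * α₄) * (Hn * h) + J′) ∎

class₁-excess : FPS → FPS → FPS
class₁-excess g h = g ^ 9 * h ^ 3 - const (+ 3) * (q * (g ^ 4 * h ^ 8))

-- Writing g - h = p₁ p₂ K, each factor p₁ p₂ is absorbed by one g and one h of the prefactor g⁴ h³.
class₁-expand : ∀ g h J → g ≈ h + p₁ * p₂ * (q * (α * α₄) * h + J) →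
  let K = q * (α * α₄) * h + J in
  class₁-excess g h ≈
    g * ((p₁ * g) ^ 2 * g * h ^ 8 * α₄ * (1# + const (+ 4) * q + const (+ 7) * q ^ 2 + const (+ 5) * q ^ 3 + const (+ 2) * q ^ 4 * α))
    + ((p₁ * g) ^ 2 * (p₂ * h) ^ 2 * (g ^ 2 * h) * K ^ 2 * (g ^ 3 + const (+ 2) * (g ^ 2 * h) + const (+ 3) * (g * h ^ 2) + const (+ 4) * h ^ 3)
    + const (+ 5) * (p₁ * g * (p₂ * h) * (g ^ 3 * h ^ 6) * J))
class₁-expand g h J g≈ = begin
  class₁-excess g h
    -- Taylor expansion about h, with d = g - h: g⁵ = h⁵ + 5 h⁴ d + d² Q, where Q = g³ + 2g²h + 3gh²
    -- + 4h³ has positive coefficients.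
    ≈⟨ solve 3 (λ g h q → g :^ 9 :* h :^ 3 :- con (+ 3) :* (q :* (g :^ 4 :* h :^ 8))
         := g :^ 4 :* h :^ 3 :* (h :^ 5 :* (con 1ℤ :- con (+ 3) :* q) :+ con (+ 5) :* (h :^ 4 :* (g :- h))
            :+ (g :- h) :^ 2 :* (g :^ 3 :+ con (+ 2) :* (g :^ 2 :* h) :+ con (+ 3) :* (g :* h :^ 2) :+ con (+ 4) :* h :^ 3))) ≈-refl g h q ⟩
  g ^ 4 * h ^ 3 * (h ^ 5 * (1# - const (+ 3) * q) + const (+ 5) * (h ^ 4 * (g - h)) + (g - h) ^ 2 * Q)
    ≈⟨ *-congˡ (+-cong (+-congˡ (*-congˡ (*-congˡ g-h≈))) (*-congʳ (^-congˡ 2 g-h≈))) ⟩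
  g ^ 4 * h ^ 3 * (h ^ 5 * (1# - const (+ 3) * q) + const (+ 5) * (h ^ 4 * (p₁ * p₂ * K)) + (p₁ * p₂ * K) ^ 2 * Q)
    ≈⟨ solve 10 (λ g h q p₁ p₂ α α₄ J K Q → g :^ 4 :* h :^ 3 :* (h :^ 5 :* (con 1ℤ :- con (+ 3) :* q) :+ con (+ 5) :*
        (h :^ 4 :* (p₁ :* p₂ :* (q :* (α :* α₄) :* h :+ J))) :+ (p₁ :* p₂ :* K) :^ 2 :* Q)
         := g :^ 4 :* h :^ 8 :* (con 1ℤ :- con (+ 3) :* q :+ con (+ 5) :* (q :* p₂ :* (p₁ :* α :* α₄)))
            :+ ((p₁ :* g) :^ 2 :* (p₂ :* h) :^ 2 :* (g :^ 2 :* h) :* K :^ 2 :* Q :+ con (+ 5) :* (p₁ :* g :* (p₂ :* h) :* (g :^ 3 :* h :^ 6) :* J)))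
         ≈-refl g h q p₁ p₂ α α₄ J K Q ⟩
  g ^ 4 * h ^ 8 * (1# - const (+ 3) * q + const (+ 5) * (q * p₂ * (p₁ * α * α₄))) + rest
    ≈⟨ +-congʳ (*-congˡ leading) ⟩
  g ^ 4 * h ^ 8 * (p₁ ^ 2 * α₄ * X) + rest
    ≈⟨ +-congʳ (solve 5 (λ g h p a x → g :^ 4 :* h :^ 8 :* (p :^ 2 :* a :* x) := g :* ((p :* g) :^ 2 :* g :* h :^ 8 :* a :* x)) ≈-refl g h p₁ α₄ X) ⟩
  g * ((p₁ * g) ^ 2 * g * h ^ 8 * α₄ * X) + rest ∎
  where
  open ≈-Reasoning
  open FPS-Solver
  K Q X rest : FPS
  K = q * (α * α₄) * h + J
  Q = g ^ 3 + const (+ 2) * (g ^ 2 * h) + const (+ 3) * (g * h ^ 2) + const (+ 4) * h ^ 3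
  X = 1# + const (+ 4) * q + const (+ 7) * q ^ 2 + const (+ 5) * q ^ 3 + const (+ 2) * q ^ 4 * α
  rest = (p₁ * g) ^ 2 * (p₂ * h) ^ 2 * (g ^ 2 * h) * K ^ 2 * Q + const (+ 5) * (p₁ * g * (p₂ * h) * (g ^ 3 * h ^ 6) * J)
  g-h≈ : g - h ≈ p₁ * p₂ * K
  g-h≈ = ≈-trans (+-congʳ g≈) (solve 2 (λ h d → h :+ d :- h := d) ≈-refl h (p₁ * p₂ * K))
  -- Over 1 - q⁴ the numerator is (1 - 3q)(1 - q⁴) + 5q (1 - q²). It is divisible by 1 - q; the
  -- quotient still has negative coefficients, and a second division by 1 - q gives the nonnegative
  -- series `X`. The two factors 1 - q are absorbed by two factors g.
  leading : 1# - const (+ 3) * q + const (+ 5) * (q * p₂ * (p₁ * α * α₄)) ≈ p₁ ^ 2 * α₄ * X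
  leading = begin
    1# - const (+ 3) * q + const (+ 5) * (q * p₂ * (p₁ * α * α₄))
      ≈⟨ +-cong (≈-trans (≈-sym (*-identityʳ _)) (*-congˡ (≈-sym q⁴))) (*-congˡ (*-congˡ (≈-trans (*-congʳ p₁α) (*-identityˡ α₄)))) ⟩
    (1# - const (+ 3) * q) * ((1# - q ^ 4) * α₄) + const (+ 5) * (q * p₂ * α₄)
      ≈⟨ solve 2 (λ q a → (con 1ℤ :- con (+ 3) :* q) :* ((con 1ℤ :- q :^ 4) :* a) :+ con (+ 5) :* (q :* (con 1ℤ :- q :^ 2) :* a)
           := (con 1ℤ :- q) :* a :* ((con 1ℤ :- q) :* (con 1ℤ :+ con (+ 4) :* q :+ con (+ 7) :* q :^ 2 :+ con (+ 5) :* q :^ 3) :+ con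
               (+ 2) :* q :^ 4 :* con 1ℤ)) ≈-refl q α₄ ⟩
    p₁ * α₄ * (p₁ * (1# + const (+ 4) * q + const (+ 7) * q ^ 2 + const (+ 5) * q ^ 3) + const (+ 2) * q ^ 4 * 1#)
      ≈⟨ *-congˡ (+-congˡ (*-congˡ (≈-sym p₁α))) ⟩
    p₁ * α₄ * (p₁ * (1# + const (+ 4) * q + const (+ 7) * q ^ 2 + const (+ 5) * q ^ 3) + const (+ 2) * q ^ 4 * (p₁ * α))
      ≈⟨ solve 5 (λ p a x y α → p :* a :* (p :* x :+ y :* (p :* α)) := p :^ 2 :* a :* (x :+ y :* α)) ≈-refl p₁ α₄
          (1# + const (+ 4) * q + const (+ 7) * q ^ 2 + const (+ 5) * q ^ 3) (const (+ 2) * q ^ 4) α ⟩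
    p₁ ^ 2 * α₄ * X ∎

Unit-gₖ : ∀ k → Unit (gₖ k)
Unit-gₖ k = Unit-* {inv (fac 5 1 k)} {inv (fac 5 4 k)} refl refl

Unit-hₖ : ∀ k → Unit (hₖ k)
Unit-hₖ k = Unit-* {inv (fac 5 2 k)} {inv (fac 5 3 k)} refl refl

Unit-p₁ : Unit p₁
Unit-p₁ = Unit-≈ (fac≈ 5 1 0) (Unit-fac 5 0 0)

-- The coefficients are the partial sums of (1 - q) G, a nonnegative series with constant term 1.
Positive-Gₙ : ∀ n → Positive (Gₙ (suc n))
Positive-Gₙ n = Positive-≈ (≈-trans (≈-sym (*-assoc α p₁ _)) (≈-trans (*-congʳ (≈-trans (*-comm α p₁) p₁α)) (*-identityˡ _)))
  (Positive-* {α} {p₁ * Gₙ (suc n)} Positive-geometric (NonNeg-p₁G n) (Unit-* {p₁} Unit-p₁ (Unit-fprod (suc n) Unit-gₖ)))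

-- Strict positivity comes from the first summand of `class₁-expand`, where one factor g was kept
-- apart from a nonnegative cofactor with constant term 1.
class₁-positive : ∀ n → Positive (class₁-excess (Gₙ (suc n)) (Hₙ (suc n)))
class₁-positive n with J , nJ , g≈ ← G-H-excess n = Positive-≈ (≈-sym (class₁-expand g h J g≈))
  (Positive-+ {g * ((p₁ * g) ^ 2 * g * h ^ 8 * α₄ * X)}
    (Positive-* {g} {(p₁ * g) ^ 2 * g * h ^ 8 * α₄ * X} (Positive-Gₙ n) nonneg unit)
    (NonNeg-+ {(p₁ * g) ^ 2 * (p₂ * h) ^ 2 * (g ^ 2 * h) * K ^ 2 * Q}
      (NonNeg-* {(p₁ * g) ^ 2 * (p₂ * h) ^ 2 * (g ^ 2 * h) * K ^ 2} {Q} (NonNeg-* {(p₁ * g) ^ 2 * (p₂ * h) ^ 2 * (g ^ 2 * h)} {K ^ 2}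
        (NonNeg-* {(p₁ * g) ^ 2 * (p₂ * h) ^ 2} {g ^ 2 * h} (NonNeg-* {(p₁ * g) ^ 2} {(p₂ * h) ^ 2} (NonNeg-^ 2 np₁g) (NonNeg-^ 2 np₂h))
            (NonNeg-* {g ^ 2} {h} (NonNeg-^ 2 ng) nh))
        (NonNeg-^ 2 nK)) nQ)
      (NonNeg-* {const (+ 5)} (NonNeg-const 5) (NonNeg-* {p₁ * g * (p₂ * h) * (g ^ 3 * h ^ 6)} {J}
          (NonNeg-* {p₁ * g * (p₂ * h)} {g ^ 3 * h ^ 6} (NonNeg-* {p₁ * g} {p₂ * h} np₁g np₂h)
              (NonNeg-* {g ^ 3} {h ^ 6} (NonNeg-^ 3 ng) (NonNeg-^ 6 nh))) nJ))))
  where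
  g h K Q X₀ X : FPS
  g = Gₙ (suc n)
  h = Hₙ (suc n)
  K = q * (α * α₄) * h + J
  Q = g ^ 3 + const (+ 2) * (g ^ 2 * h) + const (+ 3) * (g * h ^ 2) + const (+ 4) * h ^ 3
  X₀ = 1# + const (+ 4) * q + const (+ 7) * q ^ 2 + const (+ 5) * q ^ 3
  X = X₀ + const (+ 2) * q ^ 4 * α
  ng : NonNeg g
  ng = NonNeg-fprod (suc n) NonNeg-gₖ
  nh : NonNeg h
  nh = NonNeg-fprod (suc n) NonNeg-hₖ
  nq : NonNeg q
  nq = NonNeg-mono 1
  np₁g : NonNeg (p₁ * g)
  np₁g = NonNeg-p₁G n
  np₂h : NonNeg (p₂ * h)
  np₂h = NonNeg-p₂H n
  nα : NonNeg α
  nα = NonNeg-inv-fac 5 0 0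
  nα₄ : NonNeg α₄
  nα₄ = NonNeg-inv-fac 5 3 0
  nK : NonNeg K
  nK = NonNeg-+ {q * (α * α₄) * h} (NonNeg-* {q * (α * α₄)} (NonNeg-* {q} nq (NonNeg-* {α} {α₄} nα nα₄)) nh) nJ
  nQ : NonNeg Q
  nQ = NonNeg-+ {g ^ 3 + const (+ 2) * (g ^ 2 * h) + const (+ 3) * (g * h ^ 2)}
    (NonNeg-+ {g ^ 3 + const (+ 2) * (g ^ 2 * h)} (NonNeg-+ {g ^ 3} (NonNeg-^ 3 ng)
        (NonNeg-* {const (+ 2)} (NonNeg-const 2) (NonNeg-* {g ^ 2} (NonNeg-^ 2 ng) nh)))
      (NonNeg-* {const (+ 3)} (NonNeg-const 3) (NonNeg-* {g} ng (NonNeg-^ 2 nh)))) (NonNeg-* {const (+ 4)} (NonNeg-const 4) (NonNeg-^ 3 nh))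
  nX : NonNeg X
  nX = NonNeg-+ {X₀} (NonNeg-+ {1# + const (+ 4) * q + const (+ 7) * q ^ 2}
      (NonNeg-+ {1# + const (+ 4) * q} (NonNeg-+ {1#} (NonNeg-const 1) (NonNeg-* {const (+ 4)} (NonNeg-const 4) nq))
    (NonNeg-* {const (+ 7)} (NonNeg-const 7) (NonNeg-^ 2 nq))) (NonNeg-* {const (+ 5)} (NonNeg-const 5) (NonNeg-^ 3 nq)))
    (NonNeg-* {const (+ 2) * q ^ 4} (NonNeg-* {const (+ 2)} (NonNeg-const 2) (NonNeg-^ 4 nq)) nα)
  nonneg : NonNeg ((p₁ * g) ^ 2 * g * h ^ 8 * α₄ * X)
  nonneg = NonNeg-* {(p₁ * g) ^ 2 * g * h ^ 8 * α₄} (NonNeg-* {(p₁ * g) ^ 2 * g * h ^ 8}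
      (NonNeg-* {(p₁ * g) ^ 2 * g} (NonNeg-* {(p₁ * g) ^ 2} (NonNeg-^ 2 np₁g) ng) (NonNeg-^ 8 nh)) nα₄) nX
  Ug : Unit g
  Ug = Unit-fprod (suc n) Unit-gₖ
  Uh : Unit h
  Uh = Unit-fprod (suc n) Unit-hₖ
  UX : Unit X
  UX = Unit-≈ {1# + q * (const (+ 4) + const (+ 7) * q + const (+ 5) * q ^ 2 + const (+ 2) * q ^ 3 * α)}
    (solve 2 (λ q a → con 1ℤ :+ q :* (con (+ 4) :+ con (+ 7) :* q :+ con (+ 5) :* q :^ 2 :+ con (+ 2) :* q :^ 3 :* a)
      := con 1ℤ :+ con (+ 4) :* q :+ con (+ 7) :* q :^ 2 :+ con (+ 5) :* q :^ 3 :+ con (+ 2) :* q :^ 4 :* a) ≈-refl q α)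
    (trans (+-at 1# _ 0) (cong₂ ℤ._+_ Unit-1# (mono-suc-*-zero 0 _)))
    where open FPS-Solver
  unit : Unit ((p₁ * g) ^ 2 * g * h ^ 8 * α₄ * X)
  unit = Unit-* {(p₁ * g) ^ 2 * g * h ^ 8 * α₄} (Unit-* {(p₁ * g) ^ 2 * g * h ^ 8}
      (Unit-* {(p₁ * g) ^ 2 * g} (Unit-* {(p₁ * g) ^ 2} (Unit-^ {p₁ * g} 2 (Unit-* {p₁} Unit-p₁ Ug)) Ug) (Unit-^ {h} 8 Uh)) refl) UX

-- The finite products must contain the factor k = 0, hence `suc n`, which is also the length that
-- fixes the coefficient of q^n.
Positive-approx : ∀ {f} (fₙ : ℕ → FPS) → (∀ {M n} → M ≤ n → f ≈[ M ] fₙ n) → (∀ n → Positive (fₙ (suc n))) → Positive f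
Positive-approx fₙ f≈ pf n = subst (0ℤ ℤ.<_) (sym (at< (f≈ ℕₚ.≤-refl) n ℕₚ.≤-refl)) (pf n n)

NonNeg-approx : ∀ {f} (fₙ : ℕ → FPS) → (∀ {M n} → M ≤ n → f ≈[ M ] fₙ n) → (∀ n → NonNeg (fₙ n)) → NonNeg f
NonNeg-approx fₙ f≈ nf n = subst (0ℤ ℤ.≤_) (sym (at< (f≈ ℕₚ.≤-refl) n ℕₚ.≤-refl)) (nf (suc n) n)

Positive-G : Positive G
Positive-G = Positive-approx Gₙ G-approx Positive-Gₙ

NonNeg-H : NonNeg H
NonNeg-H = NonNeg-approx Hₙ H-approx (λ n → NonNeg-fprod n NonNeg-hₖ)

Positive-class₁ : Positive (class₁-excess G H)
Positive-class₁ = Positive-approx (λ n → class₁-excess (Gₙ n) (Hₙ n))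
  (λ M≤n → +-cong[] (*-cong[] (^-cong[] 9 (G-approx M≤n)) (^-cong[] 3 (H-approx M≤n)))
    (neg-cong[] (*-cong[] ≈[]-refl (*-cong[] ≈[]-refl (*-cong[] (^-cong[] 4 (G-approx M≤n)) (^-cong[] 8 (H-approx M≤n)))))))
  class₁-positive

-- From the sections of R⁵ to the signs of B

ratio^*G^ : ∀ j k → ratio ^ j * G ^ (j ℕ.+ k) ≈ G ^ k * H ^ j
ratio^*G^ zero    k = *-comm 1# _
ratio^*G^ (suc j) k = begin
  A * H * ratio ^ j * (G * G ^ (j ℕ.+ k))       ≈⟨ solve 5 (λ a h r g x → a :* h :* r :* (g :* x) := a :* g :* (h :* (r :* x))) ≈-refl A H
      (ratio ^ j) G (G ^ (j ℕ.+ k)) ⟩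
  A * G * (H * (ratio ^ j * G ^ (j ℕ.+ k)))     ≈⟨ *-cong (*-inv A Unit-A) (*-congˡ (ratio^*G^ j k)) ⟩
  1# * (H * (G ^ k * H ^ j))                    ≈⟨ solve 3 (λ h x y → con 1ℤ :* (h :* (x :* y)) := x :* (h :* y)) ≈-refl H (G ^ k) (H ^ j) ⟩
  G ^ k * (H * H ^ j)                           ∎
  where open ≈-Reasoning
        open FPS-Solver

-- As R G = H, each factor R turns one of the ten G into an H. A class t ≥ 1 meets `dissection` in
-- the two powers t and t + 5 of v, whose sections carry q⁰ and q¹; the last hypothesis is checked
-- by `refl`.
section : ∀ t c c′ i k i′ k′ → i ℕ.+ k ≡ 10 → i′ ℕ.+ k′ ≡ 10 → t ℕ.< 5 →
  sec-poly t 0 dissection ≡ const c * (ratio ^ i * mono 0) + (const c′ * (ratio ^ i′ * mono 1) + 0#) →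
  sec t (ratio ^ 5) ≈ const c * (G ^ k * (H ^ i * H ^ 2)) + const c′ * (q * (G ^ k′ * (H ^ i′ * H ^ 2)))
section t c c′ i k i′ k′ i+k i′+k′ t<5 eq = begin
  sec t (ratio ^ 5)
    ≈⟨ sec-ratio⁵ t t<5 ⟩
  sec-poly t 0 dissection * (G ^ 10 * H ^ 2)
    ≡⟨ cong (_* (G ^ 10 * H ^ 2)) eq ⟩
  (const c * (ratio ^ i * mono 0) + (const c′ * (ratio ^ i′ * q) + 0#)) * (G ^ 10 * H ^ 2)
    ≈⟨ *-congʳ (+-congʳ (*-congˡ (*-congˡ mono-zero))) ⟩
  (const c * (ratio ^ i * 1#) + (const c′ * (ratio ^ i′ * q) + 0#)) * (G ^ 10 * H ^ 2)
    ≈⟨ solve 7 (λ c r c′ r′ q g h → (c :* (r :* con 1ℤ) :+ (c′ :* (r′ :* q) :+ con 0ℤ)) :* (g :* h)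
         := c :* (r :* g :* h) :+ c′ :* (q :* (r′ :* g :* h))) ≈-refl (const c) (ratio ^ i) (const c′) (ratio ^ i′) q (G ^ 10) (H ^ 2) ⟩
  const c * (ratio ^ i * G ^ 10 * H ^ 2) + const c′ * (q * (ratio ^ i′ * G ^ 10 * H ^ 2))
    ≈⟨ +-cong (*-congˡ (power i k i+k)) (*-congˡ (*-congˡ (power i′ k′ i′+k′))) ⟩
  const c * (G ^ k * (H ^ i * H ^ 2)) + const c′ * (q * (G ^ k′ * (H ^ i′ * H ^ 2))) ∎
  where
  open ≈-Reasoning
  open FPS-Solver
  power : ∀ i k → i ℕ.+ k ≡ 10 → ratio ^ i * G ^ 10 * H ^ 2 ≈ G ^ k * (H ^ i * H ^ 2)
  power i k i+k = ≈-trans (*-congʳ (≈-trans (≡⇒≈ (cong (λ n → ratio ^ i * G ^ n) (sym i+k))) (ratio^*G^ i k))) (*-assoc _ _ _)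

-- A single factor `G` of the first monomial is positive, and its cofactor is nonnegative with
-- constant term 1.
Positive-monomials : ∀ c c′ k i k′ i′ → Positive (const (+ suc c) * (G ^ suc k * (H ^ i * H ^ 2)) + const (+ c′) * (q * (G ^ k′ * (H ^ i′ * H ^ 2))))
Positive-monomials c c′ k i k′ i′ = Positive-+ {const (+ suc c) * (G ^ suc k * (H ^ i * H ^ 2))}
  (const-*-positive c (Positive-≈ (≈-sym (*-assoc G (G ^ k) _)) (Positive-* {G} {G ^ k * (H ^ i * H ^ 2)} Positive-G (monomial k i)
    (Unit-* {G ^ k} (Unit-^ {G} k refl) (Unit-* {H ^ i} {H ^ 2} (Unit-^ {H} i refl) (Unit-^ {H} 2 refl))))))
  (NonNeg-* {const (+ c′)} (NonNeg-const c′) (NonNeg-* {q} (NonNeg-mono 1) (monomial k′ i′)))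
  where
  monomial : ∀ k i → NonNeg (G ^ k * (H ^ i * H ^ 2))
  monomial k i = NonNeg-* {G ^ k} (NonNeg-^ k (Positive⇒NonNeg Positive-G)) (NonNeg-* {H ^ i} {H ^ 2} (NonNeg-^ i NonNeg-H) (NonNeg-^ 2 NonNeg-H))

pow≈^ : ∀ f k → pow f k ≈ f ^ k
pow≈^ f zero    = one≈1#
pow≈^ f (suc k) = ≈-trans (≡⇒≈ (sym (*-as-⊛ f (pow f k)))) (*-congˡ (pow≈^ f k))

R≡ratio : R ≡ ratio
R≡ratio = begin
  (poch5 1 ⊛ poch5 4) ⊛ inv (poch5 2 ⊛ poch5 3)  ≡⟨ cong₂ (λ a c → a ⊛ inv c) (product 1 4) (product 2 3) ⟩
  A ⊛ inv C                                      ≡⟨ *-as-⊛ A (inv C) ⟨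
  ratio                                          ∎
  where
  open ≡.≡-Reasoning
  product : ∀ r t → poch5 r ⊛ poch5 t ≡ poch 5 r * poch 5 t
  product r t = trans (cong₂ _⊛_ (poch5≡poch r) (poch5≡poch t)) (sym (*-as-⊛ (poch 5 r) (poch 5 t)))

B≈ratio⁵ : B ≈ ratio ^ 5
B≈ratio⁵ = ≈-trans (≡⇒≈ (cong (λ f → pow f 5) R≡ratio)) (pow≈^ ratio 5)

B-section : ∀ t n → B (5 ℕ.* n ℕ.+ t) ≡ sec t (ratio ^ 5) n
B-section t n = trans (cong (λ m → B (m ℕ.+ t)) (ℕₚ.*-comm 5 n)) (at B≈ratio⁵ (n ℕ.* 5 ℕ.+ t))

negative-section : ∀ {f} t → Positive f → sec t (ratio ^ 5) ≈ - f → ∀ n → B (5 ℕ.* n ℕ.+ t) ℤ.< 0ℤ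
negative-section {f} t pf eq n = subst (ℤ._< 0ℤ) (sym (trans (B-section t n) (trans (at eq n) (neg-at f n)))) (ℤₚ.neg-mono-< (pf n))

positive-section : ∀ {f} t → Positive f → sec t (ratio ^ 5) ≈ f → ∀ n → B (5 ℕ.* n ℕ.+ t) > 0ℤ
positive-section t pf eq n = subst (0ℤ ℤ.<_) (sym (trans (B-section t n) (at eq n))) (pf n)

section₁ : sec 1 (ratio ^ 5) ≈ - (const (+ 5) * class₁-excess G H)
section₁ = ≈-trans (section 1 (ℤ.- (+ 5)) (+ 15) 1 9 6 4 refl refl (s≤s (s≤s z≤n)) refl)
  (solve 3 (λ g h q → con (ℤ.- (+ 5)) :* (g :^ 9 :* (h :^ 1 :* h :^ 2)) :+ con (+ 15) :* (q :* (g :^ 4 :* (h :^ 6 :* h :^ 2)))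
    := :- (con (+ 5) :* (g :^ 9 :* h :^ 3 :- con (+ 3) :* (q :* (g :^ 4 :* h :^ 8))))) ≈-refl G H q)
  where open FPS-Solver

section₃ : sec 3 (ratio ^ 5) ≈ - (const (+ 30) * (G ^ 7 * (H ^ 3 * H ^ 2)) + const (+ 10) * (q * (G ^ 2 * (H ^ 8 * H ^ 2))))
section₃ = ≈-trans (section 3 (ℤ.- (+ 30)) (ℤ.- (+ 10)) 3 7 8 2 refl refl (s≤s (s≤s (s≤s (s≤s z≤n)))) refl)
  (solve 2 (λ x y → con (ℤ.- (+ 30)) :* x :+ con (ℤ.- (+ 10)) :* y := :- (con (+ 30) :* x :+ con (+ 10) :* y)) ≈-refl
      (G ^ 7 * (H ^ 3 * H ^ 2)) (q * (G ^ 2 * (H ^ 8 * H ^ 2))))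
  where open FPS-Solver

theorem1p3 : (n : ℕ) →
    (B (5 Data.Nat.* n Data.Nat.+ 1) < 0ℤ) × (B (5 Data.Nat.* n Data.Nat.+ 2) > 0ℤ) ×
    (B (5 Data.Nat.* n Data.Nat.+ 3) < 0ℤ) × (B (5 Data.Nat.* n Data.Nat.+ 4) > 0ℤ)
theorem1p3 n =
    -- Coefficients that must be positive are passed less one: 4, 14, 29 and 39 stand for 5, 15, 30
    -- and 40. So is the exponent of `G` in the first monomial.
    negative-section 1 (const-*-positive 4 Positive-class₁) section₁ n
  , positive-section 2 (Positive-monomials 14 5 7 2 3 7) (section 2 (+ 15) (+ 5) 2 8 7 3 refl refl (s≤s (s≤s (s≤s z≤n))) refl) n
  , negative-section 3 (Positive-monomials 29 10 6 3 2 8) section₃ n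
  , positive-section 4 (Positive-monomials 39 5 5 4 1 9) (section 4 (+ 40) (+ 5) 4 6 9 1 refl refl ℕₚ.≤-refl refl) n
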